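{- Let $(W,\mathcal{S})$ be a finite Coxeter system and $m\ge1$. For each Coxeter element $c$ define a relation $\parallel'_c$ on $\Phi^{(m)}_{\ge-1}$ by $\beta^{(k)}\parallel'_c\gamma^{(\ell)}$ iff $\{\beta^{(k)},\gamma^{(\ell)}\}$ is a face of $\mathrm{Asso}^{(m)}(W,c)$. Then the family $(\parallel'_c)_c$ satisfies: (i) for $\alpha\in\Delta$ and $\beta^{(k)}\in\Phi^{(m)}_{\ge-1}$, $\alpha^{(m)}\parallel'_c\beta^{(k)}$ iff $\beta^{(k)}\in(\Phi_{\langle s_\alpha\rangle})^{(m)}_{\ge-1}$; (ii) for $\beta^{(k)},\gamma^{(\ell)}\in\Phi^{(m)}_{\ge-1}$ and $s$ initial in $c$, $\beta^{(k)}\parallel'_c\gamma^{(\ell)}$ iff $\tau^{(m)}_s(\beta^{(k)})\parallel'_{s^{ -1}cs}\tau_s^{(m)}(\gamma^{(\ell)})$. Moreover any family of relations satisfying (i) and (ii) coincides with $(\parallel'_c)_c$, so $\parallel'_c$ is the $m$-eralized $c$-compatibility relation.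
   Context: $\Phi$ is a root system of $W$, $\Phi^+$ positive roots, $\Delta=\{\alpha_s\}$ simple roots, $s_\alpha$ the reflection of $\alpha$. $\Phi^{(m)}_{\ge-1}=\{\beta^{(k)}:\beta\in\Phi^+,0\le k<m\}\cup\{\alpha^{(m)}:\alpha\in\Delta\}$ ($m$-colored almost positive roots). For $s\in\mathcal{S}$, $\Phi_{\langle s\rangle}$ is the root subsystem of the parabolic subgroup generated by $\mathcal{S}\setminus\{s\}$, and $(\Phi_{\langle s\rangle})^{(m)}_{\ge-1}$ is the set of $\beta^{(k)}\in\Phi^{(m)}_{\ge-1}$ with $\beta\in\Phi_{\langle s\rangle}$. The bijection $\tau_s^{(m)}$ of $\Phi^{(m)}_{\ge-1}$ (colors mod $m+1$): $\alpha_s^{(k)}\mapsto\alpha_s^{(k-1)}$ (with $\alpha_s^{(0)}\mapsto\alpha_s^{(m)}$); $\beta^{(m)}\mapsto\beta^{(m)}$ for $\beta\ne\alpha_s$; otherwise $\beta^{(k)}\mapsto[s(\beta)]^{(k)}$. A Coxeter element $c$ is a product of all simple reflections in some order; $s$ is initial in $c$ if $c$ has a reduced word beginning with $s$. Fix a reduced word $\mathbf{c}=s_1\cdots s_n$. Let $w_\circ(\mathbf{c})$ be the lexicographically first subword of $\mathbf{c}^\infty$ that is a reduced word for the longest element $w_\circ$; for a word $Q$ let $\widetilde Q$ replace each letter $t$ by $w_\circ tw_\circ\in\mathcal{S}$; $w_\circ^m(\mathbf{c})$ is the concatenation $w_\circ(\mathbf{c})\widetilde{w_\circ(\mathbf{c})}w_\circ(\mathbf{c})\cdots$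 ($m$ factors), of length $mN$, $N=\ell(w_\circ)$. Colored positive roots are acted on by $t\in\mathcal{S}$ via $t(\beta^{(k)})=[t(\beta)]^{(k)}$ if $\beta\ne\alpha_t$ and $t(\alpha_t^{(k)})=\alpha_t^{(k+1)}$; the colored inversion sequence of a word $t_1\cdots t_p$ has $i$-th entry $t_1(\cdots t_{i-1}(\alpha_{t_i}^{(0)}))$. $\mathrm{Asso}^{(m)}_\Delta(W,c)$ is the simplicial complex on the positions of the word $\mathbf{c}\,w_\circ^m(\mathbf{c})$ whose facets are the position sets $I$ such that the letters outside $I$ form a word of length $mN$ with product $w_\circ^m$ in $W$. The map $L^{(m)}$ sends position $i\le n$ (letter $s_i$ of $\mathbf{c}$) to $\alpha_{s_i}^{(m)}$, and the $i$-th position of $w_\circ^m(\mathbf{c})$ to the $i$-th entry of the colored inversion sequence of $w_\circ^m(\mathbf{c})$; $\mathrm{Asso}^{(m)}(W,c)$ is the image of the faces of $\mathrm{Asso}^{(m)}_\Delta(W,c)$ under $L^{(m)}$ (up to isomorphism independent of the chosen reduced word).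
   Formalization: The relation is taken to hold only between two distinct colored roots forming a face; read literally with β^(k)=γ^(ℓ), {α^(m)} is a face while α is not in Φ_⟨s_α⟩, so (i) would fail on the diagonal. -}

module Defs where

open import Data.Nat using (ℕ; zero; suc; _+_; _*_; _∸_; _≤_; _<_)
open import Data.Fin using (Fin; toℕ)
open import Data.Bool using (Bool; true; false)
open import Data.List using (List; []; _∷_; _++_; [_]; length; map; take; concat; replicate; lookup; allFin)
open import Data.List.Relation.Unary.All using (All)
open import Data.List.Relation.Unary.Linked using (Linked)
open import Data.List.Relation.Binary.Pointwise using (Pointwise)
open import Data.List.Relation.Binary.Permutation.Propositional using (_↭_)
open import Data.Product using (Σ; ∃; _×_; _,_)
open import Data.Sum using (_⊎_)
open import Data.Empty using (⊥)
open import Relation.Nullary using (¬_)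
open import Relation.Binary.PropositionalEquality using (_≡_; _≢_)
open import Relation.Binary.Construct.Closure.Equivalence using (EqClosure)
open import Function.Bundles using (_⇔_)

-- Coxeter matrices on the generating set Fin n (finite entries only;
-- finite Coxeter groups have all m_st finite).

IsCoxeterMatrix : (n : ℕ) → (Fin n → Fin n → ℕ) → Set
IsCoxeterMatrix n M =
  (∀ s → M s s ≡ 1) × (∀ s t → M s t ≡ M t s) × (∀ s t → s ≢ t → 2 ≤ M s t)

-- Lexicographic strict order on lists of naturals (used on lists of equal length).
LexLt : List ℕ → List ℕ → Set
LexLt [] _ = ⊥
LexLt (_ ∷ _) [] = ⊥
LexLt (x ∷ xs) (y ∷ ys) = (x < y) ⊎ ((x ≡ y) × LexLt xs ys)

At : {A : Set} → List A → ℕ → A → Set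
At [] _ _ = ⊥
At (a ∷ _) zero b = a ≡ b
At (_ ∷ as) (suc p) b = At as p b

module Cox (n : ℕ) (M : Fin n → Fin n → ℕ) (m : ℕ) where

  -- words in the generators; the group W is Word modulo _≈_
  Word : Set
  Word = List (Fin n)

  alt : Fin n → Fin n → ℕ → Word
  alt s t zero = []
  alt s t (suc k) = s ∷ alt t s k

  data Step : Word → Word → Set where
    del   : ∀ u v s → Step (u ++ s ∷ s ∷ v) (u ++ v)
    braid : ∀ u v s t → Step (u ++ alt s t (M s t) ++ v) (u ++ alt t s (M s t) ++ v)

  _≈_ : Word → Word → Set
  _≈_ = EqClosure Step

  IsFinite : Set
  IsFinite = Σ ℕ λ B → ∀ w → Σ Word λ w' → (w' ≈ w) × (length w' ≤ B)

  IsReduced : Word → Set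
  IsReduced w = ∀ w' → w' ≈ w → length w ≤ length w'

  IsLongest : Word → Set
  IsLongest w0 = IsReduced w0 × (∀ u → IsReduced u → length u ≤ length w0)

  -- reflections (conjugates of simple reflections); the positive root β
  -- is identified with its reflection s_β
  IsReflection : Word → Set
  IsReflection t = Σ Word λ u → Σ (Fin n) λ s → t ≈ (u ++ s ∷ Data.List.reverse u)

  -- colored roots β^(k), represented by (reflection word of β , k)
  ColRoot : Set
  ColRoot = Word × ℕ

  CEq : ColRoot → ColRoot → Set
  CEq (t , k) (t' , k') = (t ≈ t') × (k ≡ k')

  Valid : ColRoot → Set
  Valid (t , k) = IsReflection t × ((k < m) ⊎ ((k ≡ m) × Σ (Fin n) λ s → t ≈ [ s ]))

  -- membership in (Φ_<s>)^(m)_{≥-1}: β is a root of the parabolic subgroup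
  -- generated by S ∖ {s}, i.e. s_β lies in that subgroup
  InParaCol : Fin n → ColRoot → Set
  InParaCol s (t , k) = Valid (t , k) × Σ Word λ w → (w ≈ t) × All (λ r → r ≢ s) w

  Act : Fin n → ColRoot → ColRoot → Set
  Act s (t , k) y = ((t ≈ [ s ]) × CEq y ([ s ] , suc k))
                  ⊎ ((¬ (t ≈ [ s ])) × CEq y (s ∷ t ++ [ s ] , k))

  ApplyWord : Word → ColRoot → ColRoot → Set
  ApplyWord [] x y = CEq x y
  ApplyWord (t ∷ u) x y = Σ ColRoot λ z → ApplyWord u x z × Act t z y

  Tau : Fin n → ColRoot → ColRoot → Set
  Tau s (t , k) y =
      ((t ≈ [ s ]) × (k ≡ 0) × CEq y ([ s ] , m))
    ⊎ ((t ≈ [ s ]) × Σ ℕ (λ k' → (k ≡ suc k') × CEq y ([ s ] , k')))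
    ⊎ ((¬ (t ≈ [ s ])) × (k ≡ m) × CEq y (t , k))
    ⊎ ((¬ (t ≈ [ s ])) × (k ≢ m) × CEq y (s ∷ t ++ [ s ] , k))

  CoxWord : Word → Set
  CoxWord c = c ↭ allFin n

  Initial : Fin n → Word → Set
  Initial s c = Σ Word λ rest → ((s ∷ rest) ≈ c) × IsReduced (s ∷ rest)

  CycAt : Word → ℕ → Fin n → Set
  CycAt c p t = Σ ℕ λ R → Σ (Fin (length c)) λ i →
                  (p ≡ R * length c + toℕ i) × (lookup c i ≡ t)

  ValidSub : Word → Word → List ℕ → Word → Set
  ValidSub c w0 ps q = Linked _<_ ps × Pointwise (CycAt c) ps q × IsReduced q × (q ≈ w0)

  W0c : Word → Word → Word → Set
  W0c c w0 q = Σ (List ℕ) λ ps → ValidSub c w0 ps q ×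
                 (∀ ps' q' → ValidSub c w0 ps' q' → (ps ≡ ps') ⊎ LexLt ps ps')

  -- w∘^m(c) = Q Q~ Q Q~ ... (k factors), σ = conjugation by w∘ on S
  pow : ℕ → (Fin n → Fin n) → Word → Word
  pow zero σ q = []
  pow (suc k) σ q = q ++ pow k σ (map σ q)

  outside : Word → List Bool → Word
  outside (a ∷ F) (false ∷ I) = a ∷ outside F I
  outside (a ∷ F) (true ∷ I) = outside F I
  outside _ _ = []

  -- facets of Asso_Δ^(m)(W,c) on the positions of F = c w∘^m(c)
  IsFacet : Word → Word → List Bool → Set
  IsFacet F w0 I = (length I ≡ length F) × (length (outside F I) ≡ m * length w0)
                   × (outside F I ≈ concat (replicate m w0))

  -- the label L^(m) of position p of  c Q  (Q = w∘^m(c))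
  Label : Word → Word → ℕ → ColRoot → Set
  Label c Q p x =
      ((p < length c) × Σ (Fin n) λ s → At c p s × CEq x ([ s ] , m))
    ⊎ ((length c ≤ p) × Σ (Fin n) λ t → At Q (p ∸ length c) t
         × ApplyWord (take (p ∸ length c) Q) ([ t ] , 0) x)

  -- x ∥'_c y : {x , y} (two distinct colored roots) is a face of Asso^(m)(W,c)
  Compat : Word → ColRoot → ColRoot → Set
  Compat c x y = (¬ CEq x y) ×
    Σ Word λ w0 → IsLongest w0 ×
    Σ (Fin n → Fin n) λ σ → (∀ t → (w0 ++ t ∷ w0) ≈ [ σ t ]) ×
    Σ Word λ q → W0c c w0 q ×
    Σ (List Bool) λ I → IsFacet (c ++ pow m σ q) w0 I ×
    Σ ℕ λ p → Σ ℕ λ p' → At I p true × At I p' true ×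
      Label c (pow m σ q) p x × Label c (pow m σ q) p' y

  SatI : (Word → ColRoot → ColRoot → Set) → Set
  SatI R = ∀ c → CoxWord c → ∀ s t → t ≈ [ s ] → ∀ x → Valid x →
             (R c (t , m) x ⇔ InParaCol s x)

  SatII : (Word → ColRoot → ColRoot → Set) → Set
  SatII R = ∀ c → CoxWord c → ∀ s → Initial s c →
            ∀ c' → CoxWord c' → c' ≈ (s ∷ c ++ [ s ]) →
            ∀ x y → Valid x → Valid y → ∀ x' y' → Tau s x x' → Tau s y y' →
            (R c x y ⇔ R c' x' y')

{-# OPTIONS --safe #-}

-- Reflections stand for positive roots, and ν g t (g makes the root of t negative)
-- is a cocycle.  Everything rests on one fact about factorisations: if a product of
-- k reflections equals a word with k distinct letters, the factors lie in the
-- parabolic subgroup of these letters.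
--
-- Call a word alternating for c if each letter is initial in the Coxeter element
-- obtained by conjugating c with the preceding letters.  Descents propagate along
-- the order of the current Coxeter element, so an alternating reduced word extends
-- until it reaches w∘; up to commutations it is the lexicographically first one,
-- w∘(c).  Hence w∘(c) = s Q and w∘(scs) = Q ψ(s), so c w∘ᵐ(c) = s X becomes X ψᵐ(s),
-- which is (ii) with τ_s as the change of labels.
--
-- For (i) rotate until c = s c₁.  A facet containing the first position is a
-- factorisation of c₁ into n - 1 reflections, so its labels lie in W_⟨s⟩.
-- Conversely, the letters of w∘ᵐ(c) that stay in their coset of W_⟨s⟩ form an
-- alternating word for c₁, along which the facet c₁ can be moved to any position.
--
-- Uniqueness: rotating along an alternating word for w∘ turns every coloured root
-- into some α⁽ᵐ⁾, where (i) decides.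

module Submission where

open import Defs
open import Data.Nat as ℕ using (ℕ; zero; suc; _≤_; z≤n; s≤s; _<_)
open import Data.Fin as Fin using (Fin; zero; suc; punchIn; punchOut; toℕ)
open import Data.Fin.Properties using (_≟_; punchIn-punchOut; any?; pigeonhole; toℕ-fromℕ<)
open import Data.List using (List; []; _∷_; _++_; [_]; length; map; reverse; concatMap; allFin; lookup; initLast; _∷ʳ′_; replicate; take; concat)
open import Data.List.Properties using (++-assoc; ++-identityʳ; unfold-reverse; length-++; length-reverse; length-map; map-++; map-id; map-∘; map-cong; ∷-injectiveʳ; length-replicate)
open import Data.List.Membership.Propositional using (_∈_; _∉_)
open import Data.List.Membership.Propositional.Properties using (∈-map⁺; ∈-concatMap⁺; ∈-allFin; ∈-∃++; ∈-++⁺ˡ; ∈-map⁻; ∈-++⁺ʳ; ∈-++⁻)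
open import Data.List.Relation.Unary.Any as Any using (here; there)
open import Data.List.Relation.Unary.Any.Properties using (lookup-index)
open import Data.Product using (Σ; _×_; _,_; proj₁; proj₂)
open import Data.Sum using (_⊎_; inj₁; inj₂)
open import Data.Empty using (⊥; ⊥-elim)
open import Relation.Nullary using (¬_; Dec; yes; no; does)
open import Relation.Nullary.Decidable using (¬?; decidable-stable; dec-true; dec-false; does-⇔; _×-dec_)
open import Relation.Binary.PropositionalEquality using (_≡_; _≢_; refl; sym; trans; cong; cong₂; subst; subst₂; setoid)
open import Relation.Binary.Construct.Closure.Equivalence as Eq using ()
open import Relation.Binary.Construct.Closure.Symmetric using (fwd; bwd)
open import Relation.Binary.Construct.Closure.ReflexiveTransitive using (ε; _◅_)
import Data.Nat.Properties as ℕ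
open import Data.Nat.DivMod using (_%_; _/_; m≡m%n+[m/n]*n; m%n<n; [m+kn]%n≡m%n; m<n⇒m%n≡m; n%n≡0)
open import Data.Integer as ℤ using (ℤ; _+_; -_; 0ℤ; 1ℤ)
import Data.Integer.Properties as ℤ
open import Data.Integer.Tactic.RingSolver using (solve-∀)
open import Data.Bool using (Bool; true; false; if_then_else_; _xor_)
import Data.Bool.Properties as 𝔹
open import Data.Vec as Vec using (Vec; []; _∷_)
open import Function.Bundles using (mk⇔; _⇔_; Equivalence)
open import Data.List.Relation.Unary.All as All using (All; []; _∷_)
import Data.List.Relation.Unary.All.Properties as All
open import Relation.Unary using (Decidable)
open import Data.List.Membership.DecPropositional as DecMem using ()
open import Data.List.Relation.Unary.AllPairs using ([]; _∷_)
open import Data.List.Relation.Unary.Unique.Propositional using (Unique)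
open import Data.Unit using (⊤; tt)
open import Data.List.Relation.Unary.Unique.Propositional.Properties using (allFin⁺)
open import Data.List.Relation.Binary.Permutation.Propositional using (_↭_; ↭-refl; ↭-sym; ↭-trans; ↭-reflexive; ↭⇒↭ₛ)
open import Data.List.Relation.Binary.Permutation.Propositional.Properties using (shift; ↭-length; ∈-resp-↭; ++-comm)
import Data.List.Relation.Binary.Permutation.Setoid.Properties as PermSetoid
open import Data.List.Relation.Unary.Linked as Linked using (Linked; []; [-]; _∷_)
open import Data.List.Relation.Unary.Linked.Properties using (Linked⇒AllPairs)
open import Data.List.Relation.Binary.Pointwise as Pointwise using (Pointwise; []; _∷_)

-- The group is given only as words modulo relations: there is no root system, no invariant form
-- and, at the outset, not even a decidable equality. The finiteness bound supplies the last of
-- these. The fact on factorisations is a form of Carter's lemma, which usually comes from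
-- codimensions of fixed spaces; here it has to be extracted from lengths and the parity cocycle
-- alone, and the critical case, two reflections around a peak of the path of partial products, is
-- settled inside the dihedral group that they generate. A linear representation serves only to
-- separate the simple reflections, since the cocycle is just as consistent when two of them
-- coincide. Existence claims over reflections (a lower peak, a minimal coset representative, an
-- element inverting everything) are obtained in double-negated form and used towards stable
-- conclusions, which avoids any search through reflections.

module Words (n : ℕ) (M : Fin n → Fin n → ℕ) (m : ℕ) where
  open Cox n M m

  ≈-refl : ∀ {u} → u ≈ u
  ≈-refl = ε

  ≈-sym : ∀ {u v} → u ≈ v → v ≈ u
  ≈-sym = Eq.symmetric Step

  ≈-trans : ∀ {u v w} → u ≈ v → v ≈ w → u ≈ w
  ≈-trans = Eq.transitive Step

  ≡⇒≈ : ∀ {u v} → u ≡ v → u ≈ v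
  ≡⇒≈ refl = ≈-refl

  step⇒≈ : ∀ {u v} → Step u v → u ≈ v
  step⇒≈ st = fwd st ◅ ε

  step-++ˡ : ∀ p {u v} → Step u v → Step (p ++ u) (p ++ v)
  step-++ˡ p (del u v s) rewrite sym (++-assoc p u (s ∷ s ∷ v)) | sym (++-assoc p u v) =
    del (p ++ u) v s
  step-++ˡ p (braid u v s t)
    rewrite sym (++-assoc p u (alt s t (M s t) ++ v)) | sym (++-assoc p u (alt t s (M s t) ++ v)) =
    braid (p ++ u) v s t

  step-++ʳ : ∀ q {u v} → Step u v → Step (u ++ q) (v ++ q)
  step-++ʳ q (del u v s) rewrite ++-assoc u (s ∷ s ∷ v) q | ++-assoc u v q = del u (v ++ q) s
  step-++ʳ q (braid u v s t)
    rewrite ++-assoc u (alt s t (M s t) ++ v) q | ++-assoc u (alt t s (M s t) ++ v) q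
          | ++-assoc (alt s t (M s t)) v q | ++-assoc (alt t s (M s t)) v q =
    braid u (v ++ q) s t

  ≈-++ : ∀ {u u' v v'} → u ≈ u' → v ≈ v' → (u ++ v) ≈ (u' ++ v')
  ≈-++ {u} {u'} {v} {v'} p q =
    ≈-trans (Eq.gmap (_++ v) (step-++ʳ v) p) (Eq.gmap (u' ++_) (step-++ˡ u') q)

  braid-≈ : ∀ s t → alt s t (M s t) ≈ alt t s (M s t)
  braid-≈ s t = ≈-trans (≡⇒≈ (sym (++-identityʳ _)))
                  (≈-trans (step⇒≈ (braid [] [] s t)) (≡⇒≈ (++-identityʳ _)))

  ≈-reverse : ∀ w → (w ++ reverse w) ≈ []
  ≈-reverse [] = ≈-refl
  ≈-reverse (s ∷ w) rewrite unfold-reverse s w | sym (++-assoc w (reverse w) [ s ]) =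
    ≈-trans (≈-++ {[ s ]} ≈-refl (≈-++ {v = [ s ]} (≈-reverse w) ≈-refl)) (step⇒≈ (del [] [] s))

  ≈-reverseˡ : ∀ w → (reverse w ++ w) ≈ []
  ≈-reverseˡ [] = ≈-refl
  ≈-reverseˡ (s ∷ w) rewrite unfold-reverse s w | ++-assoc (reverse w) [ s ] (s ∷ w) =
    ≈-trans (step⇒≈ (del (reverse w) w s)) (≈-reverseˡ w)

-- Decidable equality in W

-- Todd–Coxeter coset enumeration over the trivial subgroup: the bound in
-- IsFinite provides a finite table, in which rows naming the same element are
-- merged until the defining relations hold.
module Enumeration (n : ℕ) (M : Fin n → Fin n → ℕ) (m : ℕ) where
  open Cox n M m
  open Words n M m

  record Table (k : ℕ) : Set where
    field
      rep      : Fin k → Word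
      step     : Fin k → Fin n → Fin k
      root     : Fin k
      rep-step : ∀ i s → rep (step i s) ≈ (rep i ++ [ s ])
      rep-root : rep root ≈ []

    act : Fin k → Word → Fin k
    act i [] = i
    act i (s ∷ w) = act (step i s) w

    rep-act : ∀ i w → rep (act i w) ≈ (rep i ++ w)
    rep-act i [] = ≡⇒≈ (sym (++-identityʳ (rep i)))
    rep-act i (s ∷ w) = ≈-trans (rep-act (step i s) w)
      (≈-trans (≈-++ {v = w} (rep-step i s) ≈-refl) (≡⇒≈ (++-assoc (rep i) [ s ] w)))

    act-++ : ∀ i u v → act i (u ++ v) ≡ act (act i u) v
    act-++ i [] v = refl
    act-++ i (s ∷ u) v = act-++ (step i s) u v

    eval : Word → Fin k
    eval = act root

    rep-eval : ∀ w → rep (eval w) ≈ w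
    rep-eval w = ≈-trans (rep-act root w) (≈-++ {v = w} rep-root ≈-refl)

  record Closed {k : ℕ} (T : Table k) : Set where
    open Table T
    field
      involutive : ∀ i s → step (step i s) s ≡ i
      braided    : ∀ i s t → act i (alt s t (M s t)) ≡ act i (alt t s (M s t))
      reached    : ∀ i → eval (rep i) ≡ i

    act-Step : ∀ i {u v} → Step u v → act i u ≡ act i v
    act-Step i (del u v s) rewrite act-++ i u (s ∷ s ∷ v) | act-++ i u v =
      cong (λ j → act j v) (involutive (act i u) s)
    act-Step i (braid u v s t)
      rewrite act-++ i u (alt s t (M s t) ++ v) | act-++ i u (alt t s (M s t) ++ v)
            | act-++ (act i u) (alt s t (M s t)) v | act-++ (act i u) (alt t s (M s t)) v =
      cong (λ j → act j v) (braided (act i u) s t)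

    eval-cong : ∀ {u v} → u ≈ v → eval u ≡ eval v
    eval-cong ε = refl
    eval-cong (fwd st ◅ p) = trans (act-Step root st) (eval-cong p)
    eval-cong (bwd st ◅ p) = trans (sym (act-Step root st)) (eval-cong p)

  Coincidence : ∀ {k} → Table k → Set
  Coincidence {k} T = Σ (Fin k) λ i → Σ (Fin k) λ j → i ≢ j × (rep i ≈ rep j)
    where open Table T

  module _ {k : ℕ} (T : Table (suc k)) (i j : Fin (suc k)) (i≢j : i ≢ j)
           (i≈j : Table.rep T i ≈ Table.rep T j) where
    open Table T

    private
      collapse : Fin (suc k) → Fin k
      collapse x with j ≟ x
      ... | yes _ = punchOut {i = j} {i} (λ e → i≢j (sym e))
      ... | no j≢x = punchOut j≢x

      rep-collapse : ∀ x → rep (punchIn j (collapse x)) ≈ rep x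
      rep-collapse x with j ≟ x
      ... | yes refl = ≈-trans (≡⇒≈ (cong rep (punchIn-punchOut {i = j} _))) i≈j
      ... | no j≢x = ≡⇒≈ (cong rep (punchIn-punchOut j≢x))

    merge : Table k
    merge = record
      { rep = λ c → rep (punchIn j c)
      ; step = λ c s → collapse (step (punchIn j c) s)
      ; root = collapse root
      ; rep-step = λ c s → ≈-trans (rep-collapse _) (rep-step (punchIn j c) s)
      ; rep-root = ≈-trans (rep-collapse root) rep-root }

  -- Each closure condition compares two rows whose words are equal in W by `rep-act`. A failing
  -- condition is therefore itself a coincidence.
  closed⊎coincidence : ∀ {k} (T : Table k) → Closed T ⊎ Coincidence T
  closed⊎coincidence {k} T
    with any? (λ i → any? (λ s → ¬? (Table.step T (Table.step T i s) s ≟ i)))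
       | any? (λ i → any? (λ s → any? (λ t →
           ¬? (Table.act T i (alt s t (M s t)) ≟ Table.act T i (alt t s (M s t))))))
       | any? (λ i → ¬? (Table.eval T (Table.rep T i) ≟ i))
  ... | yes (i , s , p) | _ | _ = inj₂ (_ , i , p ,
        ≈-trans (rep-step (step i s) s) (≈-trans (≈-++ {v = [ s ]} (rep-step i s) ≈-refl)
          (≈-trans (≡⇒≈ (++-assoc (rep i) [ s ] [ s ]))
            (≈-trans (step⇒≈ (del (rep i) [] s)) (≡⇒≈ (++-identityʳ (rep i)))))))
    where open Table T
  ... | no _ | yes (i , s , t , p) | _ = inj₂ (_ , _ , p ,
        ≈-trans (rep-act i _) (≈-trans (≈-++ {u = rep i} ≈-refl (braid-≈ s t)) (≈-sym (rep-act i _))))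
    where open Table T
  ... | no _ | no _ | yes (i , p) = inj₂ (_ , i , p , rep-eval (rep i))
    where open Table T
  ... | no a | no b | no c = inj₁ (record
        { involutive = λ i s → decidable-stable (_ ≟ _) λ p → a (i , s , p)
        ; braided = λ i s t → decidable-stable (_ ≟ _) λ p → b (i , s , t , p)
        ; reached = λ i → decidable-stable (_ ≟ _) λ p → c (i , p) })

  -- A merge removes one row, so the number of rows bounds the number of merges; the row `root`
  -- keeps the table from becoming empty.
  close : ∀ k → Table k → Σ ℕ λ k' → Σ (Table k') Closed
  close zero T with Table.root T
  ... | ()
  close (suc k) T with closed⊎coincidence T
  ... | inj₁ cl = suc k , T , cl
  ... | inj₂ (i , j , i≢j , i≈j) = close k (merge T i j i≢j i≈j)

  words : ℕ → List Word
  words zero = [ [] ]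
  words (suc b) = [] ∷ concatMap (λ s → map (s ∷_) (words b)) (allFin n)

  ∈-words : ∀ {b} w → length w ≤ b → w ∈ words b
  ∈-words {zero} [] _ = here refl
  ∈-words {suc b} [] _ = here refl
  ∈-words {suc b} (s ∷ w) (s≤s p) =
    there (∈-concatMap⁺ (λ s → map (s ∷_) (words b)) (Any.map (λ { refl → ∈-map⁺ (s ∷_) (∈-words w p) })
        (∈-allFin s)))

  -- The rows are all words up to the bound, and `index` shortens by means of the bound. Equal
  -- elements may receive different rows, which is what the merging repairs.
  initialTable : (fin : IsFinite) → Table (length (words (proj₁ fin)))
  initialTable (b , bounded) = record
    { rep = lookup (words b)
    ; step = λ i s → index (lookup (words b) i ++ [ s ])
    ; root = index []
    ; rep-step = λ i s → rep-index _
    ; rep-root = rep-index [] }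
    where
    index : Word → Fin (length (words b))
    index w with bounded w
    ... | w' , _ , short = Any.index (∈-words w' short)
    rep-index : ∀ w → lookup (words b) (index w) ≈ w
    rep-index w with bounded w
    ... | w' , w'≈w , short = ≈-trans (≡⇒≈ (sym (lookup-index (∈-words w' short)))) w'≈w

-- An element of the group is a row of the closed table, so that equality in W
-- becomes decidable propositional equality.
record Model (n : ℕ) (M : Fin n → Fin n → ℕ) (m : ℕ) : Set where
  open Cox n M m
  field
    size       : ℕ
    eval       : Word → Fin size
    rep        : Fin size → Word
    eval-rep   : ∀ g → eval (rep g) ≡ g
    eval-cong  : ∀ {u v} → u ≈ v → eval u ≡ eval v
    eval-sound : ∀ {u v} → eval u ≡ eval v → u ≈ v

model : ∀ n M m → Cox.IsFinite n M m → Model n M m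
model n M m fin with Enumeration.close n M m _ (Enumeration.initialTable n M m fin)
... | k , T , cl = record
  { size = k
  ; eval = eval
  ; rep = rep
  ; eval-rep = reached
  ; eval-cong = eval-cong
  ; eval-sound = λ {u} {v} e →
      ≈-trans (≈-sym (rep-eval u)) (≈-trans (≡⇒≈ (cong rep e)) (rep-eval v)) }
  where
  open Words n M m
  open Enumeration n M m
  open Table T
  open Closed cl

-- Distinctness of the simple reflections

-- A linear representation over ℤ in which distinct simple reflections act
-- differently.  Instead of 2cos(π/M) it uses an integral operator annihilated
-- by the Chebyshev polynomial U_{M-1}: the adjacency operator of a disjoint
-- union of paths with M-1 vertices.
Seq : Set
Seq = ℕ → ℤ

infix 4 _≐_
infixl 6 _⊕_

_≐_ : Seq → Seq → Set
f ≐ g = ∀ i → f i ≡ g i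

_⊕_ : Seq → Seq → Seq
(f ⊕ g) i = f i + g i

⊖_ : Seq → Seq
(⊖ f) i = - f i

module Paths (b : ℕ) where

  -- The edge from `i` to `suc i` is removed, which leaves paths with `suc b` vertices. All of ℕ is
  -- used because each pair of generators has its own path length while all operators must act on
  -- the same sequences.
  cut : ℕ → Bool
  cut i = does (suc i % suc b ℕ.≟ 0)

  link : Bool → ℤ → ℤ
  link c x = if c then 0ℤ else x

  adj : Seq → Seq
  adj f zero = link (cut 0) (f 1)
  adj f (suc i) = link (cut i) (f i) + link (cut (suc i)) (f (suc (suc i)))

  link-+ : ∀ c x y → link c (x + y) ≡ link c x + link c y
  link-+ true x y = refl
  link-+ false x y = refl

  link-neg : ∀ c x → link c (- x) ≡ - link c x
  link-neg true x = refl
  link-neg false x = refl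

  adj-cong : ∀ {f g} → f ≐ g → adj f ≐ adj g
  adj-cong e zero = cong (link (cut 0)) (e 1)
  adj-cong e (suc i) = cong₂ (λ x y → link (cut i) x + link (cut (suc i)) y) (e i) (e (suc (suc i)))

  adj-⊕ : ∀ f g → adj (f ⊕ g) ≐ adj f ⊕ adj g
  adj-⊕ f g zero = link-+ (cut 0) (f 1) (g 1)
  adj-⊕ f g (suc i)
    rewrite link-+ (cut i) (f i) (g i)
          | link-+ (cut (suc i)) (f (suc (suc i))) (g (suc (suc i))) = exchange (link (cut i) (f i))
              (link (cut i) (g i)) (link (cut (suc i)) (f (suc (suc i)))) (link (cut (suc i)) (g (suc (suc i))))
    where
    exchange : ∀ a b c d → (a + b) + (c + d) ≡ (a + c) + (b + d)
    exchange = solve-∀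

  adj-⊖ : ∀ f → adj (⊖ f) ≐ ⊖ adj f
  adj-⊖ f zero = link-neg (cut 0) (f 1)
  adj-⊖ f (suc i)
    rewrite link-neg (cut i) (f i) | link-neg (cut (suc i)) (f (suc (suc i))) =
    sym (ℤ.neg-distrib-+ (link (cut i) (f i)) (link (cut (suc i)) (f (suc (suc i)))))

  -- cheb j is U_{j-1}(adj).
  cheb : ℕ → Seq → Seq
  cheb zero f i = 0ℤ
  cheb (suc zero) f = f
  cheb (suc (suc j)) f = adj (cheb (suc j) f) ⊕ (⊖ cheb j f)

  cheb-⊕ : ∀ j f g → cheb j (f ⊕ g) ≐ cheb j f ⊕ cheb j g
  cheb-⊕ zero f g i = refl
  cheb-⊕ (suc zero) f g i = refl
  cheb-⊕ (suc (suc j)) f g i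
    rewrite adj-cong (cheb-⊕ (suc j) f g) i | adj-⊕ (cheb (suc j) f) (cheb (suc j) g) i
          | cheb-⊕ j f g i =
    exchange (adj (cheb (suc j) f) i) (adj (cheb (suc j) g) i) (cheb j f i) (cheb j g i)
    where
    exchange : ∀ a b c d → (a + b) + - (c + d) ≡ (a + - c) + (b + - d)
    exchange = solve-∀

  cheb-⊖ : ∀ j f → cheb j (⊖ f) ≐ ⊖ cheb j f
  cheb-⊖ zero f i = refl
  cheb-⊖ (suc zero) f i = refl
  cheb-⊖ (suc (suc j)) f i
    rewrite adj-cong (cheb-⊖ (suc j) f) i | adj-⊖ (cheb (suc j) f) i | cheb-⊖ j f i =
    sym (ℤ.neg-distrib-+ (adj (cheb (suc j) f) i) (- cheb j f i))

  adj-0 : ∀ i → adj (λ _ → 0ℤ) i ≡ 0ℤ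
  adj-0 zero with cut 0
  ... | true = refl
  ... | false = refl
  adj-0 (suc i) with cut i | cut (suc i)
  ... | true | true = refl
  ... | true | false = refl
  ... | false | true = refl
  ... | false | false = refl

  cheb-adj : ∀ j f → cheb j (adj f) ≐ adj (cheb j f)
  cheb-adj zero f i = sym (adj-0 i)
  cheb-adj (suc zero) f i = refl
  cheb-adj (suc (suc j)) f i
    rewrite adj-cong (cheb-adj (suc j) f) i | cheb-adj j f i
          | adj-⊕ (adj (cheb (suc j) f)) (⊖ cheb j f) i | adj-⊖ (cheb j f) i = refl

  private
    B = suc b

    cut-inner : ∀ q k → suc k < B → cut (k ℕ.+ q ℕ.* B) ≡ false
    cut-inner q k k<b = dec-false (_ ℕ.≟ 0) λ e →
      ℕ.1+n≢0 (trans (sym (trans ([m+kn]%n≡m%n (suc k) q B) (m<n⇒m%n≡m k<b))) e)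

    cut-last : ∀ q → cut (b ℕ.+ q ℕ.* B) ≡ true
    cut-last q = dec-true (_ ℕ.≟ 0) (trans ([m+kn]%n≡m%n B q B) (n%n≡0 B))

    adj-start : ∀ q f → adj f (q ℕ.* B) ≡ link (cut (q ℕ.* B)) (f (suc (q ℕ.* B)))
    adj-start zero f = refl
    adj-start (suc q) f rewrite cut-last q = ℤ.+-identityˡ _

    -- On a path, U_k of the adjacency operator brings the value of the vertex at distance `k` to
    -- the left end; this is the three-term recursion read along the path.
    cheb-start : ∀ q k f → k < B → cheb (suc k) f (q ℕ.* B) ≡ f (k ℕ.+ q ℕ.* B)
    cheb-start q zero f k<b = refl
    cheb-start q (suc zero) f k<b
      rewrite adj-start q f | cut-inner q 0 k<b = ℤ.+-identityʳ _
    cheb-start q (suc (suc k)) f k<b =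
      trans (cong₂ (λ x y → x + - y)
              (trans (sym (cheb-adj (suc (suc k)) f (q ℕ.* B)))
                (trans (cheb-start q (suc k) (adj f) (ℕ.<-trans (ℕ.n<1+n _) k<b)) expand))
              (cheb-start q k f (ℕ.<-trans (ℕ.n<1+n _) (ℕ.<-trans (ℕ.n<1+n _) k<b))))
        (cancel (f (k ℕ.+ q ℕ.* B)) (f (suc (suc k) ℕ.+ q ℕ.* B)))
      where
      cancel : ∀ x y → (x + y) + - x ≡ y
      cancel = solve-∀
      expand : adj f (suc k ℕ.+ q ℕ.* B) ≡ f (k ℕ.+ q ℕ.* B) + f (suc (suc k) ℕ.+ q ℕ.* B)
      expand rewrite cut-inner q (suc k) k<b | cut-inner q k (ℕ.<-trans (ℕ.n<1+n _) k<b) = refl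

    cheb-top-start : ∀ q f → cheb (suc B) f (q ℕ.* B) ≡ 0ℤ
    cheb-top-start q f = go b refl
      where
      go : ∀ b' → b' ≡ b → cheb (suc B) f (q ℕ.* B) ≡ 0ℤ
      go zero refl rewrite adj-start q f | cut-last q = refl
      go (suc b') refl
        rewrite sym (cheb-adj B f (q ℕ.* B))
              | cheb-start q b (adj f) (ℕ.n<1+n _)
              | cheb-start q b' f (ℕ.<-trans (ℕ.n<1+n _) (ℕ.n<1+n _))
              | cut-last q
              | cut-inner q b' (ℕ.n<1+n _) = cancel (f (b' ℕ.+ q ℕ.* B))
        where
        cancel : ∀ x → (x + 0ℤ) + - x ≡ 0ℤ
        cancel = solve-∀

    -- The vanishing at the left end spreads along the path: `cheb` commutes with `adj`, and `adj`
    -- at one vertex expresses the next value through the one before.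
    cheb-top-at : ∀ q k → k < B → ∀ f → cheb (suc B) f (k ℕ.+ q ℕ.* B) ≡ 0ℤ
    cheb-top-at q zero _ f = cheb-top-start q f
    cheb-top-at q (suc zero) k<b f = trans (sym (ex q))
        (trans (sym (cheb-adj (suc B) f (q ℕ.* B))) (cheb-top-start q (adj f)))
      where
      ex : ∀ q → adj (cheb (suc B) f) (q ℕ.* B) ≡ cheb (suc B) f (1 ℕ.+ q ℕ.* B)
      ex q rewrite adj-start q (cheb (suc B) f) | cut-inner q 0 k<b = refl
    cheb-top-at q (suc (suc k)) k<b f =
      trans (sym (trans (cong (_+ g (suc (suc k) ℕ.+ q ℕ.* B)) (cheb-top-at q k (ℕ.<-trans (ℕ.n<1+n _) k+1<b)
          f)) (ℤ.+-identityˡ _)))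
        (trans (sym expand) (trans (sym (cheb-adj (suc B) f (suc k ℕ.+ q ℕ.* B))) (cheb-top-at q (suc k) k+1<b
            (adj f))))
      where
      g = cheb (suc B) f
      k+1<b = ℕ.<-trans (ℕ.n<1+n (suc k)) k<b
      expand : adj g (suc k ℕ.+ q ℕ.* B) ≡ g (k ℕ.+ q ℕ.* B) + g (suc (suc k) ℕ.+ q ℕ.* B)
      expand rewrite cut-inner q k k+1<b | cut-inner q (suc k) k<b = refl

  cheb-top : ∀ f i → cheb (suc (suc b)) f i ≡ 0ℤ
  cheb-top f i = subst (λ j → cheb (suc B) f j ≡ 0ℤ) (sym (m≡m%n+[m/n]*n i B))
                   (cheb-top-at (i / B) (i % B) (m%n<n i B) f)

  -- Firing two vertices alternately k times, starting with the one of value a: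
  -- their values afterwards and the total amounts fired.
  firedValue₁ firedValue₂ firedSum₁ firedSum₂ : ℕ → Seq → Seq → Seq
  firedValue₁ zero a c = a
  firedValue₁ (suc k) a c = firedValue₂ k (c ⊕ adj a) (⊖ a)
  firedValue₂ zero a c = c
  firedValue₂ (suc k) a c = firedValue₁ k (c ⊕ adj a) (⊖ a)
  firedSum₁ zero a c i = 0ℤ
  firedSum₁ (suc k) a c = a ⊕ firedSum₂ k (c ⊕ adj a) (⊖ a)
  firedSum₂ zero a c i = 0ℤ
  firedSum₂ (suc k) a c = firedSum₁ k (c ⊕ adj a) (⊖ a)

  -- The value fired at move `k`, counted from zero, when the two vertices start with `a` and `c`:
  -- firing obeys the Chebyshev recursion.
  amount : ℕ → Seq → Seq → Seq
  amount k a c = cheb (suc k) a ⊕ cheb k c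

  amount-shift : ∀ k a c → amount k (c ⊕ adj a) (⊖ a) ≐ amount (suc k) a c
  amount-shift k a c i
    rewrite cheb-⊕ (suc k) c (adj a) i | cheb-adj (suc k) a i | cheb-⊖ k a i =
    rearrange (cheb (suc k) c i) (adj (cheb (suc k) a) i) (cheb k a i)
    where
    rearrange : ∀ x y z → (x + y) + - z ≡ (y + - z) + x
    rearrange = solve-∀

  evens odds : ℕ → Seq → ℤ
  evens zero A = 0ℤ
  evens (suc k) A = A 0 + odds k (λ j → A (suc j))
  odds zero A = 0ℤ
  odds (suc k) A = evens k (λ j → A (suc j))

  evens-cong : ∀ k {A A'} → A ≐ A' → evens k A ≡ evens k A'
  odds-cong : ∀ k {A A'} → A ≐ A' → odds k A ≡ odds k A'
  evens-cong zero e = refl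
  evens-cong (suc k) e = cong₂ _+_ (e 0) (odds-cong k (λ j → e (suc j)))
  odds-cong zero e = refl
  odds-cong (suc k) e = evens-cong k (λ j → e (suc j))

  evens-⊕ : ∀ k A A' → evens k (A ⊕ A') ≡ evens k A + evens k A'
  odds-⊕ : ∀ k A A' → odds k (A ⊕ A') ≡ odds k A + odds k A'
  evens-⊕ zero A A' = refl
  evens-⊕ (suc k) A A' =
    trans (cong (_+_ (A 0 + A' 0)) (odds-⊕ k (λ j → A (suc j)) (λ j → A' (suc j))))
      (exchange (A 0) (A' 0) (odds k (λ j → A (suc j))) (odds k (λ j → A' (suc j))))
    where
    exchange : ∀ a b c d → (a + b) + (c + d) ≡ (a + c) + (b + d)
    exchange = solve-∀
  odds-⊕ zero A A' = refl
  odds-⊕ (suc k) A A' = evens-⊕ k (λ j → A (suc j)) (λ j → A' (suc j))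

  evens-last : ∀ k A → A k ≡ 0ℤ → evens (suc k) A ≡ evens k A
  odds-last : ∀ k A → A k ≡ 0ℤ → odds (suc k) A ≡ odds k A
  evens-last zero A e = trans (cong (_+ 0ℤ) e) refl
  evens-last (suc k) A e = cong (_+_ (A 0)) (odds-last k (λ j → A (suc j)) e)
  odds-last zero A e = refl
  odds-last (suc k) A e = evens-last k (λ j → A (suc j)) e

  firedSum₁-evens : ∀ k a c i → firedSum₁ k a c i ≡ evens k (λ j → amount j a c i)
  firedSum₂-odds : ∀ k a c i → firedSum₂ k a c i ≡ odds k (λ j → amount j a c i)
  firedSum₁-evens zero a c i = refl
  firedSum₁-evens (suc k) a c i = cong₂ _+_ (sym (ℤ.+-identityʳ (a i)))
    (trans (firedSum₂-odds k _ _ i) (odds-cong k (λ j → amount-shift j a c i)))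
  firedSum₂-odds zero a c i = refl
  firedSum₂-odds (suc k) a c i =
    trans (firedSum₁-evens k _ _ i) (evens-cong k (λ j → amount-shift j a c i))

  -- Both totals are sums of Chebyshev terms over alternate indices, shifted by one against each
  -- other. The boundary terms `cheb 0` and `cheb (suc (suc b))` vanish.
  firedSum-swap : ∀ a c → firedSum₁ (suc (suc b)) a c ≐ firedSum₂ (suc (suc b)) c a
  firedSum-swap a c i = trans (firedSum₁-evens m a c i) (trans
    (trans (evens-⊕ m (λ j → cheb (suc j) a i) (λ j → cheb j c i))
      (trans (cong₂ _+_ (odds-last m (λ j → cheb j a i) (cheb-top a i))
               (trans (sym (evens-last m (λ j → cheb j c i) (cheb-top c i)))
                      (ℤ.+-identityˡ (odds m (λ j → cheb (suc j) c i)))))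
        (trans (ℤ.+-comm (odds m (λ j → cheb j a i)) _)
          (sym (odds-⊕ m (λ j → cheb (suc j) c i) (λ j → cheb j a i))))))
    (sym (firedSum₂-odds m c a i)))
    where m = suc (suc b)

  -- A vertex holds the amount that it fires next or minus the amount that it fired last, depending
  -- on whose turn it is. In `amounts` the entry at 0 is `- c`, as if the second vertex had just
  -- fired.
  pick₁ pick₂ : ℕ → Seq → ℤ
  pick₁ zero A = A 1
  pick₁ (suc k) A = pick₂ k (λ j → A (suc j))
  pick₂ zero A = - A 0
  pick₂ (suc k) A = pick₁ k (λ j → A (suc j))

  pick₁-cong : ∀ k {A A'} → A ≐ A' → pick₁ k A ≡ pick₁ k A'
  pick₂-cong : ∀ k {A A'} → A ≐ A' → pick₂ k A ≡ pick₂ k A'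
  pick₁-cong zero e = e 1
  pick₁-cong (suc k) e = pick₂-cong k (λ j → e (suc j))
  pick₂-cong zero e = cong -_ (e 0)
  pick₂-cong (suc k) e = pick₁-cong k (λ j → e (suc j))

  pick-swap₁ : ∀ k A A' → A (suc k) ≡ - A' k → - A k ≡ A' (suc k) → pick₁ k A ≡ pick₂ k A'
  pick-swap₂ : ∀ k A A' → A (suc k) ≡ - A' k → - A k ≡ A' (suc k) → pick₂ k A ≡ pick₁ k A'
  pick-swap₁ zero A A' e e' = e
  pick-swap₁ (suc k) A A' e e' = pick-swap₂ k (λ j → A (suc j)) (λ j → A' (suc j)) e e'
  pick-swap₂ zero A A' e e' = e'
  pick-swap₂ (suc k) A A' e e' = pick-swap₁ k (λ j → A (suc j)) (λ j → A' (suc j)) e e'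

  amounts : Seq → Seq → ℕ → Seq
  amounts a c i zero = - c i
  amounts a c i (suc j) = amount j a c i

  amounts-shift : ∀ a c i → amounts (c ⊕ adj a) (⊖ a) i ≐ (λ j → amounts a c i (suc j))
  amounts-shift a c i zero = trans (ℤ.neg-involutive (a i)) (sym (ℤ.+-identityʳ (a i)))
  amounts-shift a c i (suc j) = amount-shift j a c i

  firedValue₁-pick : ∀ k a c i → firedValue₁ k a c i ≡ pick₁ k (amounts a c i)
  firedValue₂-pick : ∀ k a c i → firedValue₂ k a c i ≡ pick₂ k (amounts a c i)
  firedValue₁-pick zero a c i = sym (ℤ.+-identityʳ (a i))
  firedValue₁-pick (suc k) a c i =
    trans (firedValue₂-pick k _ _ i) (pick₂-cong k (amounts-shift a c i))
  firedValue₂-pick zero a c i = sym (ℤ.neg-involutive (c i))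
  firedValue₂-pick (suc k) a c i =
    trans (firedValue₁-pick k _ _ i) (pick₁-cong k (amounts-shift a c i))

  firedValue-swap : ∀ a c → firedValue₁ (suc (suc b)) a c ≐ firedValue₂ (suc (suc b)) c a
  firedValue-swap a c i = trans (firedValue₁-pick m a c i) (trans
    (pick-swap₁ m (amounts a c i) (amounts c a i) (top a c) (sym (trans (top c a) refl)))
    (sym (firedValue₂-pick m c a i)))
    where
    m = suc (suc b)
    top : ∀ a c → amounts a c i (suc m) ≡ - amounts c a i m
    top a c = trans (cong₂ _+_ (cong (_+ - cheb (suc b) a i) (adj-top a i)) (cheb-top c i))
      (trans (ring (cheb (suc b) a i)) (cong (λ x → - (x + cheb (suc b) a i)) (sym (cheb-top c i))))
      where
      ring : ∀ x → (0ℤ + - x) + 0ℤ ≡ - (0ℤ + x)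
      ring = solve-∀
      adj-top : ∀ a i → adj (cheb m a) i ≡ 0ℤ
      adj-top a i = trans (adj-cong (cheb-top a) i) (adj-0 i)

module NumbersGame (n : ℕ) (M : Fin n → Fin n → ℕ) (m : ℕ) (cox : IsCoxeterMatrix n M) where
  open Cox n M m

  private
    M-sym = proj₁ (proj₂ cox)

  -- The edge weights of Mozes's numbers game, as operators. For M = 2 the paths are single
  -- vertices, so commuting generators get weight zero.
  X : Fin n → Fin n → Seq → Seq
  X s t = Paths.adj (M s t ℕ.∸ 2)

  Position : Set
  Position = Fin n → Seq

  infix 4 _≗_
  _≗_ : Position → Position → Set
  p ≗ p' = ∀ r → p r ≐ p' r

  fire : Fin n → Position → Position
  fire s p t with s ≟ t
  ... | yes _ = ⊖ p s
  ... | no _ = p t ⊕ X s t (p s)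

  fire-self : ∀ s p → fire s p s ≐ ⊖ p s
  fire-self s p i with s ≟ s
  ... | yes _ = refl
  ... | no ne = ⊥-elim (ne refl)

  fire-other : ∀ s t p → s ≢ t → fire s p t ≐ p t ⊕ X s t (p s)
  fire-other s t p ne i with s ≟ t
  ... | yes e = ⊥-elim (ne e)
  ... | no _ = refl

  fire-cong : ∀ s {p p'} → p ≗ p' → fire s p ≗ fire s p'
  fire-cong s e t i with s ≟ t
  ... | yes _ = cong -_ (e s i)
  ... | no _ = cong₂ _+_ (e t i) (Paths.adj-cong (M s t ℕ.∸ 2) (e s) i)

  play : Word → Position → Position
  play [] p = p
  play (s ∷ w) p = play w (fire s p)

  play-cong : ∀ w {p p'} → p ≗ p' → play w p ≗ play w p'
  play-cong [] e = e
  play-cong (s ∷ w) e = play-cong w (fire-cong s e)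

  play-++ : ∀ u v p → play (u ++ v) p ≡ play v (play u p)
  play-++ [] v p = refl
  play-++ (s ∷ u) v p = play-++ u v (fire s p)

  fire-involutive : ∀ s p → fire s (fire s p) ≗ p
  fire-involutive s p t i = go (s ≟ t)
    where
    ring : ∀ x y → (x + y) + - y ≡ x
    ring = solve-∀
    go : Dec (s ≡ t) → fire s (fire s p) t i ≡ p t i
    go (yes refl) = trans (fire-self s (fire s p) i)
      (trans (cong -_ (fire-self s p i)) (ℤ.neg-involutive (p s i)))
    go (no ne) = trans (fire-other s t (fire s p) ne i)
      (trans (cong₂ _+_ (fire-other s t p ne i)
               (trans (Paths.adj-cong b (fire-self s p) i) (Paths.adj-⊖ b (p s) i)))
        (ring (p t i) (X s t (p s) i)))
      where b = M s t ℕ.∸ 2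

  record Alternated (s t : Fin n) (k : ℕ) (p q : Position) (a c : Seq) : Set where
    open Paths (M s t ℕ.∸ 2)
    field
      first  : q s ≐ firedValue₁ k a c
      second : q t ≐ firedValue₂ k a c
      rest   : ∀ r → s ≢ r → t ≢ r →
               q r ≐ (p r ⊕ X s r (firedSum₁ k a c)) ⊕ X t r (firedSum₂ k a c)

  alternated : ∀ {s t} → s ≢ t → ∀ k p a c → p s ≐ a → p t ≐ c →
               Alternated s t k p (play (alt s t k) p) a c
  alternated s≢t zero p a c ea ec = record
    { first = ea ; second = ec
    ; rest = λ r _ _ i → sym (trans (cong₂ (λ x y → (p r i + x) + y)
                               (Paths.adj-0 _ i) (Paths.adj-0 _ i))
                             (trans (ℤ.+-identityʳ _) (ℤ.+-identityʳ (p r i)))) }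
  alternated {s} {t} s≢t (suc k) p a c ea ec = record
    { first = λ i → trans (second i) (cong (λ b → Paths.firedValue₂ b k (c ⊕ adj a) (⊖ a) i) swap)
    ; second = λ i → trans (first i) (cong (λ b → Paths.firedValue₁ b k (c ⊕ adj a) (⊖ a) i) swap)
    ; rest = λ r s≢r t≢r i → trans (rest r t≢r s≢r i)
        (trans (cong (λ b → ((fire s p r i + X t r (Paths.firedSum₁ b k (c ⊕ adj a) (⊖ a)) i)
                     + X s r (Paths.firedSum₂ b k (c ⊕ adj a) (⊖ a)) i)) swap)
        (trans (cong (λ x → (x + X t r (firedSum₁ k (c ⊕ adj a) (⊖ a)) i)
                     + X s r (firedSum₂ k (c ⊕ adj a) (⊖ a)) i)
                 (trans (fire-other s r p s≢r i)
                   (cong (_+_ (p r i)) (Paths.adj-cong (M s r ℕ.∸ 2) ea i))))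
        (trans (ring (p r i) (X s r a i) (X t r (firedSum₁ k (c ⊕ adj a) (⊖ a)) i)
                  (X s r (firedSum₂ k (c ⊕ adj a) (⊖ a)) i))
          (cong (λ x → (p r i + x) + X t r (firedSum₁ k (c ⊕ adj a) (⊖ a)) i)
             (sym (Paths.adj-⊕ (M s r ℕ.∸ 2) a (firedSum₂ k (c ⊕ adj a) (⊖ a)) i)))))) }
    where
    open Paths (M s t ℕ.∸ 2)
    swap : M t s ℕ.∸ 2 ≡ M s t ℕ.∸ 2
    swap = cong (ℕ._∸ 2) (M-sym t s)
    ring : ∀ w x y z → ((w + x) + y) + z ≡ (w + (x + z)) + y
    ring = solve-∀
    open Alternated (alternated (λ e → s≢t (sym e)) k (fire s p) (c ⊕ adj a) (⊖ a)
      (λ i → trans (fire-other s t p s≢t i) (cong₂ _+_ (ec i) (adj-cong ea i)))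
      (λ i → trans (fire-self s p i) (cong -_ (ea i))))

  play-braid : ∀ s t p → play (alt s t (M s t)) p ≗ play (alt t s (M s t)) p
  play-braid s t p r i with s ≟ t
  ... | yes refl = refl
  ... | no s≢t = subst (λ k → play (alt s t k) p r i ≡ play (alt t s k) p r i)
                   (ℕ.m+[n∸m]≡n (proj₂ (proj₂ cox) s t s≢t)) (go (s ≟ r) (t ≟ r))
    where
    open Paths (M s t ℕ.∸ 2)
    k = 2 ℕ.+ (M s t ℕ.∸ 2)
    swap : M t s ℕ.∸ 2 ≡ M s t ℕ.∸ 2
    swap = cong (ℕ._∸ 2) (M-sym t s)
    module ST = Alternated (alternated s≢t k p (p s) (p t) (λ _ → refl) (λ _ → refl))
    module TS = Alternated (alternated (λ e → s≢t (sym e)) k p (p t) (p s) (λ _ → refl) (λ _ → refl))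
    ring : ∀ x y z → (x + y) + z ≡ (x + z) + y
    ring = solve-∀
    go : Dec (s ≡ r) → Dec (t ≡ r) → play (alt s t k) p r i ≡ play (alt t s k) p r i
    go (yes refl) _ = trans (ST.first i) (trans (firedValue-swap (p s) (p t) i)
      (sym (trans (TS.second i) (cong (λ b → Paths.firedValue₂ b k (p t) (p s) i) swap))))
    go (no _) (yes refl) = trans (ST.second i) (trans (sym (firedValue-swap (p t) (p s) i))
      (sym (trans (TS.first i) (cong (λ b → Paths.firedValue₁ b k (p t) (p s) i) swap))))
    go (no s≢r) (no t≢r) = trans (ST.rest r s≢r t≢r i) (trans
      (cong₂ (λ x y → (p r i + x) + y)
        (Paths.adj-cong (M s r ℕ.∸ 2) (firedSum-swap (p s) (p t)) i)
        (Paths.adj-cong (M t r ℕ.∸ 2) (λ j → sym (firedSum-swap (p t) (p s) j)) i))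
      (trans (ring (p r i) (X s r (firedSum₂ k (p t) (p s)) i) (X t r (firedSum₁ k (p t) (p s)) i))
        (sym (trans (TS.rest r t≢r s≢r i)
          (cong (λ b → (p r i + X t r (Paths.firedSum₁ b k (p t) (p s)) i)
                        + X s r (Paths.firedSum₂ b k (p t) (p s)) i) swap)))))

  play-Step : ∀ {u v} → Step u v → ∀ p → play u p ≗ play v p
  play-Step (del u v s) p
    rewrite play-++ u (s ∷ s ∷ v) p | play-++ u v p = play-cong v (fire-involutive s (play u p))
  play-Step (braid u v s t) p
    rewrite play-++ u (alt s t (M s t) ++ v) p | play-++ u (alt t s (M s t) ++ v) p
          | play-++ (alt s t (M s t)) v (play u p) | play-++ (alt t s (M s t)) v (play u p) =
    play-cong v (play-braid s t (play u p))

  play-≈ : ∀ {u v} → u ≈ v → ∀ p → play u p ≗ play v p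
  play-≈ ε p r i = refl
  play-≈ (fwd st ◅ e) p r i = trans (play-Step st p r i) (play-≈ e p r i)
  play-≈ (bwd st ◅ e) p r i = trans (sym (play-Step st p r i)) (play-≈ e p r i)

  -- Play on the position with 1 at `s` and 0 elsewhere: firing `s` turns the 1 into -1, while
  -- firing `t` sends nothing.
  generator-injective : ∀ {s t} → [ s ] ≈ [ t ] → s ≡ t
  generator-injective {s} {t} e with s ≟ t
  ... | yes s≡t = s≡t
  ... | no s≢t = ⊥-elim (impossible (trans (sym at-s) (trans (play-≈ e unit s 0) at-t)))
    where
    unit : Position
    unit r i with s ≟ r
    ... | yes _ = 1ℤ
    ... | no _ = 0ℤ
    unit-s : ∀ i → unit s i ≡ 1ℤ
    unit-s i with s ≟ s
    ... | yes _ = refl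
    ... | no ne = ⊥-elim (ne refl)
    unit-t : ∀ i → unit t i ≡ 0ℤ
    unit-t i with s ≟ t
    ... | yes s≡t = ⊥-elim (s≢t s≡t)
    ... | no _ = refl
    at-s : fire s unit s 0 ≡ - 1ℤ
    at-s = trans (fire-self s unit 0) (cong -_ (unit-s 0))
    at-t : fire t unit s 0 ≡ 1ℤ
    at-t = trans (fire-other t s unit (λ e → s≢t (sym e)) 0)
      (cong₂ _+_ (unit-s 0) (trans (Paths.adj-cong (M t s ℕ.∸ 2) unit-t 0) (Paths.adj-0 (M t s ℕ.∸ 2) 0)))
    impossible : - 1ℤ ≡ 1ℤ → ⊥
    impossible ()

-- Equations in groups

-- Equations valid in every group in which some of the variables are
-- involutions, decided by free reduction.
module GroupSolver {G : Set} (_∙_ : G → G → G) (1g : G) (_⁻¹ : G → G)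
  (assoc : ∀ x y z → (x ∙ y) ∙ z ≡ x ∙ (y ∙ z))
  (idˡ : ∀ x → 1g ∙ x ≡ x) (idʳ : ∀ x → x ∙ 1g ≡ x)
  (invˡ : ∀ x → (x ⁻¹) ∙ x ≡ 1g) (invʳ : ∀ x → x ∙ (x ⁻¹) ≡ 1g) where

  Involution : Set
  Involution = Σ G λ x → x ∙ x ≡ 1g

  infixr 7 _⊙_
  infix 8 _ⁱ

  data Expr (a b : ℕ) : Set where
    var  : Fin a → Expr a b
    ivar : Fin b → Expr a b
    _⊙_  : Expr a b → Expr a b → Expr a b
    _ⁱ   : Expr a b → Expr a b
    ι    : Expr a b

  data Letter (a b : ℕ) : Set where
    pos neg : Fin a → Letter a b
    inv     : Fin b → Letter a b

  x₀ : ∀ {a b} → Expr (suc a) b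
  x₀ = var zero
  x₁ : ∀ {a b} → Expr (suc (suc a)) b
  x₁ = var (suc zero)
  x₂ : ∀ {a b} → Expr (suc (suc (suc a))) b
  x₂ = var (suc (suc zero))
  x₃ : ∀ {a b} → Expr (suc (suc (suc (suc a)))) b
  x₃ = var (suc (suc (suc zero)))
  y₀ : ∀ {a b} → Expr a (suc b)
  y₀ = ivar zero
  y₁ : ∀ {a b} → Expr a (suc (suc b))
  y₁ = ivar (suc zero)

  infixr 6 _▸_
  _▸_ : ∀ {a b} → Expr a b → Expr a b → Expr a b
  x ▸ t = x ⊙ (t ⊙ x ⁱ)

  module _ {a b : ℕ} where
    flip : Letter a b → Letter a b
    flip (pos i) = neg i
    flip (neg i) = pos i
    flip (inv j) = inv j

    cancels : (k l : Letter a b) → Dec (l ≡ flip k)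
    cancels (pos i) (pos j) = no λ ()
    cancels (pos i) (neg j) with i ≟ j
    ... | yes refl = yes refl
    ... | no ne = no λ { refl → ne refl }
    cancels (pos i) (inv j) = no λ ()
    cancels (neg i) (pos j) with i ≟ j
    ... | yes refl = yes refl
    ... | no ne = no λ { refl → ne refl }
    cancels (neg i) (neg j) = no λ ()
    cancels (neg i) (inv j) = no λ ()
    cancels (inv i) (pos j) = no λ ()
    cancels (inv i) (neg j) = no λ ()
    cancels (inv i) (inv j) with i ≟ j
    ... | yes refl = yes refl
    ... | no ne = no λ { refl → ne refl }

    push : Letter a b → List (Letter a b) → List (Letter a b)
    push k [] = k ∷ []
    push k (l ∷ ls) with cancels k l
    ... | yes _ = ls
    ... | no _ = k ∷ l ∷ ls

    append : List (Letter a b) → List (Letter a b) → List (Letter a b)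
    append [] ls = ls
    append (k ∷ ks) ls = push k (append ks ls)

    invert : List (Letter a b) → List (Letter a b)
    invert [] = []
    invert (k ∷ ks) = append (invert ks) (flip k ∷ [])

    normalise : Expr a b → List (Letter a b)
    normalise (var i) = pos i ∷ []
    normalise (ivar j) = inv j ∷ []
    normalise (e ⊙ f) = append (normalise e) (normalise f)
    normalise (e ⁱ) = invert (normalise e)
    normalise ι = []

    module _ (ρ : Vec G a) (σ : Vec Involution b) where
      ⟦_⟧ : Expr a b → G
      ⟦ var i ⟧ = Vec.lookup ρ i
      ⟦ ivar j ⟧ = proj₁ (Vec.lookup σ j)
      ⟦ e ⊙ f ⟧ = ⟦ e ⟧ ∙ ⟦ f ⟧
      ⟦ e ⁱ ⟧ = ⟦ e ⟧ ⁻¹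
      ⟦ ι ⟧ = 1g

      ⟦_⟧ˡ : Letter a b → G
      ⟦ pos i ⟧ˡ = Vec.lookup ρ i
      ⟦ neg i ⟧ˡ = Vec.lookup ρ i ⁻¹
      ⟦ inv j ⟧ˡ = proj₁ (Vec.lookup σ j)

      ⟦_⟧* : List (Letter a b) → G
      ⟦ [] ⟧* = 1g
      ⟦ k ∷ ks ⟧* = ⟦ k ⟧ˡ ∙ ⟦ ks ⟧*

      flip-inverse : ∀ k → ⟦ k ⟧ˡ ∙ ⟦ flip k ⟧ˡ ≡ 1g
      flip-inverse (pos i) = invʳ _
      flip-inverse (neg i) = invˡ _
      flip-inverse (inv j) = proj₂ (Vec.lookup σ j)

      push-sound : ∀ k ls → ⟦ push k ls ⟧* ≡ ⟦ k ⟧ˡ ∙ ⟦ ls ⟧*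
      push-sound k [] = refl
      push-sound k (l ∷ ls) with cancels k l
      ... | yes refl = sym (trans (sym (assoc _ _ _)) (trans (cong (_∙ ⟦ ls ⟧*) (flip-inverse k)) (idˡ _)))
      ... | no _ = refl

      append-sound : ∀ ks ls → ⟦ append ks ls ⟧* ≡ ⟦ ks ⟧* ∙ ⟦ ls ⟧*
      append-sound [] ls = sym (idˡ _)
      append-sound (k ∷ ks) ls = trans (push-sound k (append ks ls))
        (trans (cong (⟦ k ⟧ˡ ∙_) (append-sound ks ls)) (sym (assoc _ _ _)))

      inverse-unique : ∀ {x y} → x ∙ y ≡ 1g → y ≡ x ⁻¹
      inverse-unique {x} {y} e = trans (sym (idˡ y)) (trans (cong (_∙ y) (sym (invˡ x)))
        (trans (assoc _ _ _) (trans (cong ((x ⁻¹) ∙_) e) (idʳ _))))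

      invert-sound : ∀ ks → ⟦ ks ⟧* ∙ ⟦ invert ks ⟧* ≡ 1g
      invert-sound [] = idˡ 1g
      invert-sound (k ∷ ks) = trans (cong ((⟦ k ⟧ˡ ∙ ⟦ ks ⟧*) ∙_) (append-sound (invert ks) (flip k ∷ [])))
        (trans (assoc _ _ _) (trans (cong (⟦ k ⟧ˡ ∙_) (sym (assoc _ _ _)))
          (trans (cong (λ z → ⟦ k ⟧ˡ ∙ (z ∙ (⟦ flip k ⟧ˡ ∙ 1g))) (invert-sound ks))
            (trans (cong (⟦ k ⟧ˡ ∙_) (trans (idˡ _) (idʳ _))) (flip-inverse k)))))

      normalise-sound : ∀ e → ⟦ normalise e ⟧* ≡ ⟦ e ⟧
      normalise-sound (var i) = idʳ _
      normalise-sound (ivar j) = idʳ _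
      normalise-sound (e ⊙ f) = trans (append-sound (normalise e) (normalise f))
        (cong₂ _∙_ (normalise-sound e) (normalise-sound f))
      normalise-sound (e ⁱ) = trans (inverse-unique (invert-sound (normalise e)))
        (cong _⁻¹ (normalise-sound e))
      normalise-sound ι = refl

  grp : ∀ {a b} (e f : Expr a b) (ρ : Vec G a) (σ : Vec Involution b) →
        normalise e ≡ normalise f → ⟦ ρ ⟧ σ e ≡ ⟦ ρ ⟧ σ f
  grp e f ρ σ eq = trans (sym (normalise-sound ρ σ e))
    (trans (cong (⟦ ρ ⟧* σ) eq) (normalise-sound ρ σ f))

-- Lists, lexicographic order and cyclic reading

true≢false : true ≢ false
true≢false ()

All-reverse : ∀ {A : Set} {P : A → Set} {xs} → All P xs → All P (reverse xs)
All-reverse [] = []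
All-reverse {P = P} {x ∷ xs} (p ∷ ps) = subst (All P) (sym (unfold-reverse x xs)) (All.∷ʳ⁺ (All-reverse ps) p)

All-delete : ∀ {A : Set} {P : A → Set} u {s v} → All P (u ++ s ∷ v) → All P (u ++ v)
All-delete [] (_ ∷ ps) = ps
All-delete (_ ∷ u) (p ∷ ps) = p ∷ All-delete u ps

∈-insert : ∀ {A : Set} u {s : A} {v r} → r ∈ u ++ v → r ∈ u ++ s ∷ v
∈-insert [] p = there p
∈-insert (_ ∷ u) (here e) = here e
∈-insert (_ ∷ u) (there p) = there (∈-insert u p)

∈-middle : ∀ {A : Set} u {s : A} {v} → s ∈ u ++ s ∷ v
∈-middle [] = here refl
∈-middle (_ ∷ u) = there (∈-middle u)

Unique-delete : ∀ {A : Set} u {s : A} {v} → Unique (u ++ s ∷ v) → Unique (u ++ v)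
Unique-delete [] (_ ∷ us) = us
Unique-delete (_ ∷ u) (x ∷ us) = All-delete u x ∷ Unique-delete u us

Unique-resp : ∀ {A : Set} {xs ys : List A} → xs ↭ ys → Unique xs → Unique ys
Unique-resp {A} p = PermSetoid.Unique-resp-↭ (setoid A) (↭⇒↭ₛ p)

Unique-∉ : ∀ {A : Set} (u : List A) {s v} → Unique (u ++ s ∷ v) → s ∉ u
Unique-∉ (x ∷ u) (x∉ ∷ us) (here refl) = All.lookup x∉ (∈-middle u) refl
Unique-∉ (x ∷ u) (x∉ ∷ us) (there p) = Unique-∉ u us p

Unique-++ˡ : ∀ {A : Set} (u : List A) {v} → Unique (u ++ v) → Unique u
Unique-++ˡ [] us = []
Unique-++ˡ (x ∷ u) (x∉ ∷ us) = All.++⁻ˡ u x∉ ∷ Unique-++ˡ u us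

LexLt-asym : ∀ {xs ys} → LexLt xs ys → LexLt ys xs → ⊥
LexLt-asym {x ∷ xs} {y ∷ ys} (inj₁ p) (inj₁ q) = ℕ.<-asym p q
LexLt-asym {x ∷ xs} {y ∷ ys} (inj₁ p) (inj₂ (refl , _)) = ℕ.<-irrefl refl p
LexLt-asym {x ∷ xs} {y ∷ ys} (inj₂ (refl , _)) (inj₁ q) = ℕ.<-irrefl refl q
LexLt-asym {x ∷ xs} {y ∷ ys} (inj₂ (_ , p)) (inj₂ (_ , q)) = LexLt-asym p q

-- Cyclic reading by rotating the word instead of dividing the position, so that reading one letter
-- is one step of the recursion and matches the rotation of a Coxeter element.
Cyc : {A : Set} → List A → ℕ → A → Set
Cyc [] p t = ⊥
Cyc (s ∷ c) zero t = s ≡ t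
Cyc (s ∷ c) (suc p) t = Cyc (c ++ [ s ]) p t

module _ {A : Set} where
  Cyc-rotate : ∀ (u v : List A) j t → Cyc (u ++ v) (length u ℕ.+ j) t ≡ Cyc (v ++ u) j t
  Cyc-rotate [] v j t = cong (λ c → Cyc c j t) (sym (++-identityʳ v))
  Cyc-rotate (s ∷ u) v j t = trans (cong (λ c → Cyc c (length u ℕ.+ j) t) (++-assoc u v [ s ]))
    (trans (Cyc-rotate u (v ++ [ s ]) j t) (cong (λ c → Cyc c j t) (++-assoc v [ s ] u)))

  Cyc-period : ∀ (c : List A) R j t → Cyc c (R ℕ.* length c ℕ.+ j) t ≡ Cyc c j t
  Cyc-period c zero j t = refl
  Cyc-period c (suc R) j t = trans (cong (λ p → Cyc c p t) (ℕ.+-assoc (length c) _ j))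
    (trans (cong (λ c' → Cyc c' (length c ℕ.+ (R ℕ.* length c ℕ.+ j)) t) (sym (++-identityʳ c)))
      (trans (Cyc-rotate c [] _ t) (Cyc-period c R j t)))

  Cyc-lookup : ∀ (u v : List A) (i : Fin (length v)) t → Cyc (v ++ u) (toℕ i) t ≡ (lookup v i ≡ t)
  Cyc-lookup u (x ∷ v) zero t = refl
  Cyc-lookup u (x ∷ v) (suc i) t = trans (cong (λ c → Cyc c (toℕ i) t) (++-assoc v u [ x ]))
      (Cyc-lookup (u ++ [ x ]) v i t)

-- The group W on the rows of the table

module System (n : ℕ) (M : Fin n → Fin n → ℕ) (m : ℕ) (cox : IsCoxeterMatrix n M) (fin : Cox.IsFinite n M m)
  (1≤m : 1 ≤ m) (mod : Model n M m) where
  open Cox n M m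
  open Words n M m
  open Model mod

  G : Set
  G = Fin size

  infixr 7 _∙_
  infix 8 _⁻¹

  _∙_ : G → G → G
  x ∙ y = eval (rep x ++ rep y)

  1g : G
  1g = eval []

  _⁻¹ : G → G
  x ⁻¹ = eval (reverse (rep x))

  rep-eval : ∀ w → rep (eval w) ≈ w
  rep-eval w = eval-sound (eval-rep (eval w))

  eval-++ : ∀ u v → eval (u ++ v) ≡ eval u ∙ eval v
  eval-++ u v = eval-cong (≈-++ (≈-sym (rep-eval u)) (≈-sym (rep-eval v)))

  assoc : ∀ x y z → (x ∙ y) ∙ z ≡ x ∙ (y ∙ z)
  assoc x y z = eval-cong (≈-trans (≈-++ (rep-eval _) ≈-refl)
    (≈-trans (≡⇒≈ (++-assoc (rep x) (rep y) (rep z))) (≈-++ {u = rep x} ≈-refl (≈-sym (rep-eval _)))))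

  idˡ : ∀ x → 1g ∙ x ≡ x
  idˡ x = trans (eval-cong (≈-++ {v = rep x} (rep-eval []) ≈-refl)) (eval-rep x)

  idʳ : ∀ x → x ∙ 1g ≡ x
  idʳ x = trans (eval-cong (≈-trans (≈-++ {u = rep x} ≈-refl (rep-eval [])) (≡⇒≈ (++-identityʳ _))))
      (eval-rep x)

  invˡ : ∀ x → x ⁻¹ ∙ x ≡ 1g
  invˡ x = eval-cong (≈-trans (≈-++ {v = rep x} (rep-eval _) ≈-refl) (≈-reverseˡ (rep x)))

  invʳ : ∀ x → x ∙ x ⁻¹ ≡ 1g
  invʳ x = eval-cong (≈-trans (≈-++ {u = rep x} ≈-refl (rep-eval _)) (≈-reverse (rep x)))

  open GroupSolver _∙_ 1g _⁻¹ assoc idˡ idʳ invˡ invʳ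

  infixr 6 _▷_
  _▷_ : G → G → G
  g ▷ t = g ∙ (t ∙ g ⁻¹)

  gen : Fin n → G
  gen s = eval [ s ]

  gen² : ∀ s → gen s ∙ gen s ≡ 1g
  gen² s = trans (sym (eval-++ [ s ] [ s ])) (eval-cong (step⇒≈ (del [] [] s)))

  geni : Fin n → Involution
  geni s = gen s , gen² s

  eval-∷ : ∀ s w → eval (s ∷ w) ≡ gen s ∙ eval w
  eval-∷ s w = eval-++ [ s ] w

  eval-reverse : ∀ w → eval (reverse w) ≡ eval w ⁻¹
  eval-reverse w = trans (sym (idˡ _)) (trans (cong (_∙ eval (reverse w)) (sym (invˡ (eval w))))
    (trans (assoc _ _ _) (trans (cong (eval w ⁻¹ ∙_)
        (trans (sym (eval-++ w (reverse w))) (eval-cong (≈-reverse w)))) (idʳ _))))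

  ▷-∙ : ∀ g h t → (g ∙ h) ▷ t ≡ g ▷ h ▷ t
  ▷-∙ g h t = grp ((x₀ ⊙ x₁) ▸ x₂) (x₀ ▸ x₁ ▸ x₂) (g ∷ h ∷ t ∷ []) [] refl

  ▷-cancel : ∀ g t → g ⁻¹ ▷ g ▷ t ≡ t
  ▷-cancel g t = grp (x₀ ⁱ ▸ x₀ ▸ x₁) x₁ (g ∷ t ∷ []) [] refl

  ▷-cancel′ : ∀ g t → g ▷ g ⁻¹ ▷ t ≡ t
  ▷-cancel′ g t = grp (x₀ ▸ x₀ ⁱ ▸ x₁) x₁ (g ∷ t ∷ []) [] refl

  ▷-injective : ∀ g {t t'} → g ▷ t ≡ g ▷ t' → t ≡ t'
  ▷-injective g {t} {t'} e = trans (sym (▷-cancel g t)) (trans (cong (g ⁻¹ ▷_) e) (▷-cancel g t'))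

  ∙-cancelˡ : ∀ g {x y} → g ∙ x ≡ g ∙ y → x ≡ y
  ∙-cancelˡ g {x} {y} e = trans (grp x₁ (x₀ ⁱ ⊙ (x₀ ⊙ x₁)) (g ∷ x ∷ []) [] refl)
    (trans (cong (g ⁻¹ ∙_) e) (grp (x₀ ⁱ ⊙ (x₀ ⊙ x₁)) x₁ (g ∷ y ∷ []) [] refl))

  ∙-cancelʳ : ∀ g {x y} → x ∙ g ≡ y ∙ g → x ≡ y
  ∙-cancelʳ g {x} {y} e = trans (grp x₁ ((x₁ ⊙ x₀) ⊙ x₀ ⁱ) (g ∷ x ∷ []) [] refl)
    (trans (cong (_∙ g ⁻¹) e) (grp ((x₁ ⊙ x₀) ⊙ x₀ ⁱ) x₁ (g ∷ y ∷ []) [] refl))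

  eqb : G → G → Bool
  eqb x y = does (x ≟ y)

  eqb-⇔ : ∀ {x y x' y'} → (x ≡ y → x' ≡ y') → (x' ≡ y' → x ≡ y) → eqb x y ≡ eqb x' y'
  eqb-⇔ {x} {y} {x'} {y'} f g = does-⇔ (mk⇔ f g) (x ≟ y) (x' ≟ y')

  eqb-refl : ∀ x → eqb x x ≡ true
  eqb-refl x = dec-true (x ≟ x) refl

  eqb-≢ : ∀ {x y} → x ≢ y → eqb x y ≡ false
  eqb-≢ {x} {y} = dec-false (x ≟ y)

  eqb-true : ∀ {x y} → eqb x y ≡ true → x ≡ y
  eqb-true {x} {y} e with x ≟ y
  ... | yes p = p
  eqb-true {x} {y} () | no _

  -- The parity cocycle and the exchange condition

  -- The parity of the number of occurrences of t among the reflections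
  -- s₁⋯sᵢ₋₁ ▷ sᵢ of a word (Bourbaki, Lie IV §1.4).
  η : Word → G → Bool
  η [] t = false
  η (s ∷ w) t = eqb t (gen s) xor η w (gen s ▷ t)

  gen-▷² : ∀ s t → gen s ▷ gen s ▷ t ≡ t
  gen-▷² s t = grp (y₀ ▸ y₀ ▸ x₀) x₀ (t ∷ []) (geni s ∷ []) refl

  gen-▷-self : ∀ s → gen s ▷ gen s ≡ gen s
  gen-▷-self s = grp (y₀ ▸ y₀) y₀ [] (geni s ∷ []) refl

  ⁻¹-gen : ∀ s → gen s ⁻¹ ≡ gen s
  ⁻¹-gen s = grp (y₀ ⁱ) y₀ [] (geni s ∷ []) refl

  η-++ : ∀ u v t → η (u ++ v) t ≡ η u t xor η v (eval u ⁻¹ ▷ t)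
  η-++ [] v t = cong (η v) (grp x₀ ((ι ⁱ) ▸ x₀) (t ∷ []) [] refl)
  η-++ (s ∷ u) v t = trans (cong (eqb t (gen s) xor_) (trans (η-++ u v (gen s ▷ t))
      (cong (λ x → η u (gen s ▷ t) xor η v x) (trans
        (grp (x₀ ⁱ ▸ y₀ ▸ x₁) ((y₀ ⊙ x₀) ⁱ ▸ x₁) (eval u ∷ t ∷ []) (geni s ∷ []) refl)
        (cong (λ x → x ⁻¹ ▷ t) (sym (eval-∷ s u)))))))
    (sym (𝔹.xor-assoc (eqb t (gen s)) (η u (gen s ▷ t)) _))

  sumFirst sumLast : ℕ → (ℕ → Bool) → Bool
  sumFirst zero F = false
  sumFirst (suc k) F = F 0 xor sumFirst k (λ j → F (suc j))
  sumLast zero F = false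
  sumLast (suc k) F = F k xor sumLast k F

  sumLast-first : ∀ k F → sumLast (suc k) F ≡ F 0 xor sumLast k (λ j → F (suc j))
  sumLast-first zero F = refl
  sumLast-first (suc k) F = trans (cong (F (suc k) xor_) (sumLast-first k F))
    (trans (sym (𝔹.xor-assoc (F (suc k)) (F 0) S))
      (trans (cong (_xor S) (𝔹.xor-comm (F (suc k)) (F 0))) (𝔹.xor-assoc (F 0) (F (suc k)) S)))
    where S = sumLast k (λ j → F (suc j))

  sumFirst≡sumLast : ∀ k F → sumFirst k F ≡ sumLast k F
  sumFirst≡sumLast zero F = refl
  sumFirst≡sumLast (suc k) F =
    trans (cong (F 0 xor_) (sumFirst≡sumLast k (λ j → F (suc j)))) (sym (sumLast-first k F))

  sum-reverse : ∀ k F F' → (∀ i j → suc (i ℕ.+ j) ≡ k → F i ≡ F' j) → sumFirst k F ≡ sumLast k F'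
  sum-reverse zero F F' e = refl
  sum-reverse (suc k) F F' e =
    cong₂ _xor_ (e 0 k refl) (sum-reverse k _ F' λ i j p → e (suc i) j (cong suc p))

  altReflection : Fin n → Fin n → ℕ → G
  altReflection s t zero = gen s
  altReflection s t (suc j) = gen s ▷ altReflection t s j

  η-alt : ∀ s t k r → η (alt s t k) r ≡ sumFirst k (λ j → eqb r (altReflection s t j))
  η-alt s t zero r = refl
  η-alt s t (suc k) r = cong (eqb r (gen s) xor_) (trans (η-alt t s k (gen s ▷ r)) (sum-cong k λ j →
      eqb-⇔ (λ e → trans (sym (gen-▷² s r)) (cong (gen s ▷_) e)) (λ { refl → gen-▷² s _ })))
    where
    sum-cong : ∀ k {F F'} → (∀ j → F j ≡ F' j) → sumFirst k F ≡ sumFirst k F'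
    sum-cong zero e = refl
    sum-cong (suc k) e = cong₂ _xor_ (e 0) (sum-cong k (λ j → e (suc j)))

  power : G → ℕ → G
  power x zero = 1g
  power x (suc k) = x ∙ power x k

  power-shift : ∀ x y k → x ∙ power (y ∙ x) k ≡ power (x ∙ y) k ∙ x
  power-shift x y zero = grp (x₀ ⊙ ι) (ι ⊙ x₀) (x ∷ []) [] refl
  power-shift x y (suc k) = trans (grp (x₀ ⊙ ((x₁ ⊙ x₀) ⊙ x₂)) ((x₀ ⊙ x₁) ⊙ (x₀ ⊙ x₂))
      (x ∷ y ∷ power (y ∙ x) k ∷ []) [] refl)
    (trans (cong ((x ∙ y) ∙_) (power-shift x y k)) (sym (assoc _ _ _)))

  power-+ : ∀ x j k → power x (j ℕ.+ k) ≡ power x j ∙ power x k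
  power-+ x zero k = sym (idˡ _)
  power-+ x (suc j) k = trans (cong (x ∙_) (power-+ x j k)) (sym (assoc _ _ _))

  altReflection-power : ∀ s t j → altReflection s t j ≡ power (gen s ∙ gen t) j ∙ gen s
  altReflection-power s t zero = sym (idˡ _)
  altReflection-power s t (suc j) = trans (cong (gen s ▷_) (altReflection-power t s j))
    (trans (grp (y₀ ▸ (x₀ ⊙ y₁)) ((y₀ ⊙ x₀) ⊙ (y₁ ⊙ y₀)) (power (gen t ∙ gen s) j ∷ []) (geni s ∷ geni t ∷ [])
        refl)
      (trans (cong (_∙ (gen t ∙ gen s)) (power-shift (gen s) (gen t) j))
        (trans (grp ((x₀ ⊙ y₀) ⊙ (y₁ ⊙ y₀)) ((x₀ ⊙ (y₀ ⊙ y₁)) ⊙ y₀) (power (gen s ∙ gen t) j ∷ [])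
            (geni s ∷ geni t ∷ []) refl)
          (cong (_∙ gen s) (trans (cong (power (gen s ∙ gen t) j ∙_) (sym (idʳ _)))
            (trans (sym (power-+ (gen s ∙ gen t) j 1)) (cong (power (gen s ∙ gen t)) (ℕ.+-comm j 1))))))))

  power-inverse : ∀ s t k → power (gen s ∙ gen t) k ∙ power (gen t ∙ gen s) k ≡ 1g
  power-inverse s t zero = idˡ 1g
  power-inverse s t (suc k) = trans
    (cong (λ x → ((gen s ∙ gen t) ∙ power (gen s ∙ gen t) k) ∙ x)
      (trans (sym (cong (power (gen t ∙ gen s)) (ℕ.+-comm k 1)))
          (trans (power-+ _ k 1) (cong (power (gen t ∙ gen s) k ∙_) (idʳ _)))))
    (trans (grp ((x₀ ⊙ x₁) ⊙ (x₂ ⊙ x₃)) (x₀ ⊙ ((x₁ ⊙ x₂) ⊙ x₃)) (_ ∷ power (gen s ∙ gen t) k ∷ power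
        (gen t ∙ gen s) k ∷ _ ∷ []) [] refl)
      (trans (cong (λ x → (gen s ∙ gen t) ∙ (x ∙ (gen t ∙ gen s))) (power-inverse s t k))
        (grp ((y₀ ⊙ y₁) ⊙ (ι ⊙ (y₁ ⊙ y₀))) ι [] (geni s ∷ geni t ∷ []) refl)))

  alt-power : ∀ s t k → eval (alt s t k) ≡ power (gen s ∙ gen t) k ∙ eval (alt t s k)
  alt-power s t zero = sym (idˡ _)
  alt-power s t (suc k) = trans (eval-∷ s _) (trans (cong (gen s ∙_) (alt-power t s k))
    (trans (sym (assoc _ _ _)) (trans (cong (_∙ eval (alt s t k)) (power-shift (gen s) (gen t) k))
     (trans (assoc _ _ _) (sym (trans (cong (((gen s ∙ gen t) ∙ power (gen s ∙ gen t) k) ∙_) (eval-∷ t _))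
       (trans (cong (_∙ (gen t ∙ eval (alt s t k))) (trans (sym (cong (power (gen s ∙ gen t)) (ℕ.+-comm k 1)))
           (power-+ (gen s ∙ gen t) k 1)))
         (grp ((x₀ ⊙ ((y₀ ⊙ y₁) ⊙ ι)) ⊙ (y₁ ⊙ x₁)) (x₀ ⊙ (y₀ ⊙ x₁)) (power (gen s ∙ gen t) k ∷ eval
             (alt s t k) ∷ []) (geni s ∷ geni t ∷ []) refl))))))))

  -- By `alt-power` the two sides of the braid relation differ by the factor (st)^M.
  power-order : ∀ s t → power (gen s ∙ gen t) (M s t) ≡ 1g
  power-order s t = ∙-cancelʳ (eval (alt t s (M s t)))
    (trans (sym (alt-power s t (M s t))) (trans (eval-cong (braid-≈ s t)) (sym (idˡ _))))

  -- These are the reflections (st)^i s and (ts)^j t, and (st)^M = 1. Hence both sides of a braid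
  -- relation run through the same reflections in opposite orders, which makes `η` invariant.
  altReflection-reverse : ∀ s t i j → suc (i ℕ.+ j) ≡ M s t → altReflection s t i ≡ altReflection t s j
  altReflection-reverse s t i j e = trans (altReflection-power s t i) (trans
    (trans (sym (idʳ _)) (trans (cong ((power st i ∙ gen s) ∙_) (sym
        (trans (cong (gen t ∙_) (sym (assoc _ _ _)))
         (trans (cong (λ x → gen t ∙ x ∙ gen t) (power-inverse s t j)) (grp (y₀ ⊙ (ι ⊙ y₀)) ι [] (geni t ∷ [])
             refl)))))
      (trans (grp ((x₀ ⊙ y₀) ⊙ (y₁ ⊙ (x₁ ⊙ (x₂ ⊙ y₁)))) ((x₀ ⊙ ((y₀ ⊙ y₁) ⊙ x₁)) ⊙ (x₂ ⊙ y₁))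
          (power st i ∷ power st j ∷ power ts j ∷ []) (geni s ∷ geni t ∷ []) refl)
        (trans (cong (_∙ (power ts j ∙ gen t)) (trans (sym (power-+ st i (suc j)))
            (trans (cong (power st) (trans (ℕ.+-suc i j) e)) (power-order s t)))) (idˡ _)))))
    (sym (altReflection-power t s j)))
    where
    st = gen s ∙ gen t
    ts = gen t ∙ gen s

  η-Step : ∀ {u v} → Step u v → ∀ r → η u r ≡ η v r
  η-Step (del [] v s) r = trans (sym (𝔹.xor-assoc (eqb r (gen s)) _ _))
    (trans (cong₂ _xor_ (trans (cong (eqb r (gen s) xor_) (eqb-⇔ {gen s ▷ r}
        (λ e → trans (sym (gen-▷² s r)) (trans (cong (gen s ▷_) e) (gen-▷-self s)))
        (λ e → trans (cong (gen s ▷_) e) (gen-▷-self s)))) (𝔹.xor-same (eqb r (gen s))))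
      (cong (η v) (gen-▷² s r))) refl)
  η-Step (del (a ∷ u) v s) r = cong (eqb r (gen a) xor_) (η-Step (del u v s) (gen a ▷ r))
  η-Step (braid [] v s t) r = trans (η-++ (alt s t (M s t)) v r) (trans
    (cong₂ _xor_ same (cong (λ x → η v (x ⁻¹ ▷ r)) (eval-cong (braid-≈ s t))))
    (sym (η-++ (alt t s (M s t)) v r)))
    where
    same : η (alt s t (M s t)) r ≡ η (alt t s (M s t)) r
    same = trans (η-alt s t (M s t) r) (trans
      (sum-reverse (M s t) _ _ λ i j e → cong (eqb r) (altReflection-reverse s t i j e))
      (trans (sym (sumFirst≡sumLast (M s t) _)) (sym (η-alt t s (M s t) r))))
  η-Step (braid (a ∷ u) v s t) r = cong (eqb r (gen a) xor_) (η-Step (braid u v s t) (gen a ▷ r))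

  η-cong : ∀ {u v} → u ≈ v → ∀ r → η u r ≡ η v r
  η-cong ε r = refl
  η-cong (fwd st ◅ e) r = trans (η-Step st r) (η-cong e r)
  η-cong (bwd st ◅ e) r = trans (sym (η-Step st r)) (η-cong e r)

  gen-injective : ∀ {s t} → gen s ≡ gen t → s ≡ t
  gen-injective e = NumbersGame.generator-injective n M m cox (eval-sound e)

  N : G → G → Bool
  N g t = η (rep g) t

  N-eval : ∀ w t → N (eval w) t ≡ η w t
  N-eval w t = η-cong (rep-eval w) t

  N-∙ : ∀ g h t → N (g ∙ h) t ≡ N g t xor N h (g ⁻¹ ▷ t)
  N-∙ g h t = trans (N-eval (rep g ++ rep h) t) (trans (η-++ (rep g) (rep h) t)
    (cong (λ x → N g t xor N h (x ⁻¹ ▷ t)) (eval-rep g)))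

  N-1 : ∀ t → N 1g t ≡ false
  N-1 t = N-eval [] t

  N-gen : ∀ s t → N (gen s) t ≡ eqb t (gen s)
  N-gen s t = trans (N-eval [ s ] t) (𝔹.xor-identityʳ _)

  -- ν g t holds iff g maps the positive root of t to a negative root.
  ν : G → G → Bool
  ν g t = N (g ⁻¹) t

  ν-∙ : ∀ g h t → ν (g ∙ h) t ≡ ν h t xor ν g (h ▷ t)
  ν-∙ g h t = trans (cong (λ x → N x t) (grp ((x₀ ⊙ x₁) ⁱ) (x₁ ⁱ ⊙ x₀ ⁱ) (g ∷ h ∷ []) [] refl))
    (trans (N-∙ (h ⁻¹) (g ⁻¹) t) (cong (λ x → ν h t xor ν g x)
      (grp ((x₀ ⁱ) ⁱ ▸ x₁) (x₀ ▸ x₁) (h ∷ t ∷ []) [] refl)))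

  ν-1 : ∀ t → ν 1g t ≡ false
  ν-1 t = trans (cong (λ x → N x t) (grp (ι ⁱ) ι [] [] refl)) (N-1 t)

  ν-gen : ∀ s t → ν (gen s) t ≡ eqb t (gen s)
  ν-gen s t = trans (cong (λ x → N x t) (⁻¹-gen s)) (N-gen s t)

  N≡ν⁻¹ : ∀ g t → N g t ≡ ν (g ⁻¹) t
  N≡ν⁻¹ g t = cong (λ x → N x t) (grp x₀ ((x₀ ⁱ) ⁱ) (g ∷ []) [] refl)

  xor-cancel : ∀ a b → a xor b ≡ false → a ≡ b
  xor-cancel true true e = refl
  xor-cancel false false e = refl
  xor-cancel true false ()
  xor-cancel false true ()

  ν-⁻¹ : ∀ g t → ν (g ⁻¹) (g ▷ t) ≡ ν g t
  ν-⁻¹ g t = sym (xor-cancel _ _ (trans (sym (ν-∙ (g ⁻¹) g t))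
    (trans (cong (λ x → ν x t) (invˡ g)) (ν-1 t))))

  N-▷ : ∀ g t → N g (g ▷ t) ≡ ν g t
  N-▷ g t = trans (N≡ν⁻¹ g (g ▷ t)) (ν-⁻¹ g t)

  Refl : G → Set
  Refl t = Σ G λ u → Σ (Fin n) λ s → t ≡ u ▷ gen s

  Refl-gen : ∀ s → Refl (gen s)
  Refl-gen s = 1g , s , grp y₀ (ι ▸ y₀) [] (geni s ∷ []) refl

  Refl-▷ : ∀ g {t} → Refl t → Refl (g ▷ t)
  Refl-▷ g (u , s , refl) = g ∙ u , s , sym (▷-∙ g u (gen s))

  Refl² : ∀ {t} → Refl t → t ∙ t ≡ 1g
  Refl² (u , s , refl) = grp ((x₀ ▸ y₀) ⊙ (x₀ ▸ y₀)) ι (u ∷ []) (geni s ∷ []) refl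

  Refl-⁻¹ : ∀ {t} → Refl t → t ⁻¹ ≡ t
  Refl-⁻¹ r = grp (y₀ ⁱ) y₀ [] ((_ , Refl² r) ∷ []) refl

  -- Expand the cocycle along u s u⁻¹: the factors `u` and `u ⁻¹` contribute the same sign twice,
  -- and the middle `s` contributes the inversion.
  ν-self : ∀ {t} → Refl t → ν t t ≡ true
  ν-self (u , s , refl) = trans (ν-∙ u (gen s ∙ u ⁻¹) t) (trans
    (cong₂ _xor_ (trans (ν-∙ (gen s) (u ⁻¹) t) (cong₂ _xor_ (ν-⁻¹ u (gen s))
        (trans (ν-gen s _) (trans (cong (λ x → eqb x (gen s)) (▷-cancel u (gen s))) (eqb-refl (gen s))))))
      (cong (ν u) (grp ((y₀ ⊙ x₀ ⁱ) ▸ x₀ ▸ y₀) y₀ (u ∷ []) (geni s ∷ []) refl)))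
    (lemma (ν u (gen s))))
    where
    t = u ▷ gen s
    lemma : ∀ b → (b xor true) xor b ≡ true
    lemma true = refl
    lemma false = refl

  -- An odd number of occurrences is not zero. Together with `deleteˡ` this is the strong exchange
  -- condition: left multiplication by `t` deletes the letter found here.
  exchange : ∀ w t → η w t ≡ true → Σ Word λ u → Σ (Fin n) λ s → Σ Word λ v →
             (w ≡ u ++ s ∷ v) × (t ≡ eval u ▷ gen s)
  exchange [] t ()
  exchange (s ∷ w) t e with t ≟ gen s
  ... | yes refl = [] , s , w , refl , grp y₀ (ι ▸ y₀) [] (geni s ∷ []) refl
  ... | no _ with exchange w (gen s ▷ t) e
  ...   | u , s' , v , refl , e' = s ∷ u , s' , v , refl ,
          trans (sym (gen-▷² s t)) (trans (cong (gen s ▷_) e') (trans (sym (▷-∙ (gen s) (eval u) (gen s')))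
            (cong (_▷ gen s') (sym (eval-∷ s u)))))

  eval-split : ∀ u s v → eval (u ++ s ∷ v) ≡ eval u ∙ (gen s ∙ eval v)
  eval-split u s v = trans (eval-++ u (s ∷ v)) (cong (eval u ∙_) (eval-∷ s v))

  deleteˡ : ∀ u s v → (eval u ▷ gen s) ∙ eval (u ++ s ∷ v) ≡ eval (u ++ v)
  deleteˡ u s v = trans (cong ((eval u ▷ gen s) ∙_) (eval-split u s v))
    (trans (grp ((x₀ ▸ y₀) ⊙ (x₀ ⊙ (y₀ ⊙ x₁))) (x₀ ⊙ x₁) (eval u ∷ eval v ∷ []) (geni s ∷ []) refl)
      (sym (eval-++ u v)))

  exchangeʳ : ∀ w t → ν (eval w) t ≡ true → Σ Word λ u → Σ (Fin n) λ s → Σ Word λ v →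
              (w ≡ u ++ s ∷ v) × (t ≡ eval v ⁻¹ ▷ gen s)
  exchangeʳ w t e with exchange w (eval w ▷ t) (trans (sym (N-eval w _)) (trans (N-▷ (eval w) t) e))
  ... | u , s , v , refl , e' = u , s , v , refl ,
        trans (sym (▷-cancel (eval (u ++ s ∷ v)) t)) (trans (cong (eval (u ++ s ∷ v) ⁻¹ ▷_) e')
          (trans (cong (λ x → x ⁻¹ ▷ eval u ▷ gen s) (eval-split u s v))
            (grp ((x₀ ⊙ (y₀ ⊙ x₁)) ⁱ ▸ x₀ ▸ y₀) (x₁ ⁱ ▸ y₀) (eval u ∷ eval v ∷ []) (geni s ∷ []) refl)))

  deleteʳ : ∀ u s v → eval (u ++ s ∷ v) ∙ (eval v ⁻¹ ▷ gen s) ≡ eval (u ++ v)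
  deleteʳ u s v = trans (cong (_∙ (eval v ⁻¹ ▷ gen s)) (eval-split u s v))
    (trans (grp ((x₀ ⊙ (y₀ ⊙ x₁)) ⊙ (x₁ ⁱ ▸ y₀)) (x₀ ⊙ x₁) (eval u ∷ eval v ∷ []) (geni s ∷ []) refl)
      (sym (eval-++ u v)))

  length-delete : ∀ (u : Word) s v → suc (length (u ++ v)) ≡ length (u ++ s ∷ v)
  length-delete [] s v = refl
  length-delete (x ∷ u) s v = cong suc (length-delete u s v)

  -- Reduced words and length

  Reduced : Word → Set
  Reduced w = ∀ w' → eval w' ≡ eval w → length w ≤ length w'

  reduced-∷ : ∀ s r → Reduced r → η r (gen s) ≡ false → Reduced (s ∷ r)
  reduced-∷ s r red e w' e' with exchange w' (gen s) odd
    where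
    odd : η w' (gen s) ≡ true
    odd = trans (η-cong (eval-sound e') (gen s))
      (cong₂ _xor_ (eqb-refl (gen s)) (trans (cong (η r) (gen-▷-self s)) e))
  ... | u , s' , v , refl , e'' = subst (suc (length r) ≤_) (length-delete u s' v)
        (s≤s (red (u ++ v) (trans (sym (deleteˡ u s' v)) (trans (cong₂ _∙_ (sym e'') (trans e' (eval-∷ s r)))
          (grp (y₀ ⊙ (y₀ ⊙ x₀)) x₀ (eval r ∷ []) (geni s ∷ []) refl)))))

  -- Letters are put in front one at a time; when the new letter is already an inversion of the
  -- rest, exchange cancels it against a letter there. Letters are only deleted, so the result stays
  -- in every parabolic subgroup that the word shows; this is the last component.
  reduce : ∀ w → Σ Word λ w' → (eval w' ≡ eval w) × Reduced w' × (∀ {P : Fin n → Set} → All P w → All P w')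
  reduce [] = [] , refl , (λ _ _ → z≤n) , λ z → z
  reduce (s ∷ w) with reduce w
  ... | r , er , red , sub with η r (gen s) in e
  ...   | false = s ∷ r , trans (eval-∷ s r) (trans (cong (gen s ∙_) er) (sym (eval-∷ s w))) ,
          reduced-∷ s r red e , λ { (p ∷ ps) → p ∷ sub ps }
  ...   | true with exchange r (gen s) e
  ...     | u , s' , v , refl , e' = u ++ v , ev , red' ,
            λ { (_ ∷ ps) → All-delete u (sub ps) }
    where
    ev' : eval (u ++ v) ≡ gen s ∙ eval (u ++ s' ∷ v)
    ev' = trans (sym (deleteˡ u s' v)) (cong (_∙ eval (u ++ s' ∷ v)) (sym e'))
    ev : eval (u ++ v) ≡ eval (s ∷ w)
    ev = trans ev' (trans (cong (gen s ∙_) er) (sym (eval-∷ s w)))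
    red' : Reduced (u ++ v)
    red' w' e'' = ℕ.≤-pred (subst (_≤ suc (length w')) (sym (length-delete u s' v)) (red (s ∷ w')
      (trans (eval-∷ s w') (trans (cong (gen s ∙_) (trans e'' ev'))
        (grp (y₀ ⊙ (y₀ ⊙ x₀)) x₀ (eval (u ++ s' ∷ v) ∷ []) (geni s ∷ []) refl)))))

  word : G → Word
  word g = proj₁ (reduce (rep g))

  eval-word : ∀ g → eval (word g) ≡ g
  eval-word g = trans (proj₁ (proj₂ (reduce (rep g)))) (eval-rep g)

  word-reduced : ∀ g → Reduced (word g)
  word-reduced g = proj₁ (proj₂ (proj₂ (reduce (rep g))))

  ℓ : G → ℕ
  ℓ g = length (word g)

  ℓ-≤ : ∀ w {g} → eval w ≡ g → ℓ g ≤ length w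
  ℓ-≤ w {g} e = word-reduced g w (trans e (sym (eval-word g)))

  ℓ-reduced : ∀ {w} → Reduced w → ℓ (eval w) ≡ length w
  ℓ-reduced {w} red = ℕ.≤-antisym (ℓ-≤ w refl) (red _ (eval-word (eval w)))

  reduced-ℓ : ∀ {w} → length w ≤ ℓ (eval w) → Reduced w
  reduced-ℓ le w' e = ℕ.≤-trans le (ℓ-≤ w' e)

  N-down : ∀ g t → N g t ≡ true → ℓ (t ∙ g) < ℓ g
  N-down g t e with exchange (word g) t (trans (sym (N-eval (word g) t))
      (trans (cong (λ x → N x t) (eval-word g)) e))
  ... | u , s , v , ew , et = ℕ.≤-<-trans (ℓ-≤ (u ++ v)
          (trans (sym (deleteˡ u s v)) (cong₂ _∙_ (sym et) (trans (cong eval (sym ew)) (eval-word g)))))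
          (ℕ.≤-reflexive (trans (length-delete u s v) (cong length (sym ew))))

  N-up : ∀ g {t} → Refl t → N g t ≡ false → ℓ g < ℓ (t ∙ g)
  N-up g {t} r e = subst (λ x → ℓ x < ℓ (t ∙ g)) (grp (y₀ ⊙ (y₀ ⊙ x₀)) x₀ (g ∷ []) ((t , Refl² r) ∷ []) refl)
    (N-down (t ∙ g) t (trans (N-∙ t g t) (cong₂ _xor_ (trans (N≡ν⁻¹ t t)
      (trans (cong (λ x → ν x t) (Refl-⁻¹ r)) (ν-self r)))
      (trans (cong (N g) (grp (x₀ ⁱ ▸ x₀) x₀ (t ∷ []) [] refl)) e))))

  ℓ-⁻¹ : ∀ g → ℓ (g ⁻¹) ≡ ℓ g
  ℓ-⁻¹ g = ℕ.≤-antisym (half g) (subst (λ x → ℓ x ≤ ℓ (g ⁻¹)) (grp ((x₀ ⁱ) ⁱ) x₀ (g ∷ []) [] refl)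
      (half (g ⁻¹)))
    where
    half : ∀ g → ℓ (g ⁻¹) ≤ ℓ g
    half g = ℕ.≤-trans (ℓ-≤ (reverse (word g)) (trans (eval-reverse (word g)) (cong _⁻¹ (eval-word g))))
      (ℕ.≤-reflexive (length-reverse (word g)))

  ν-Refl : ∀ g t → ν g t ≡ true → Refl t
  ν-Refl g t e with exchange (rep (g ⁻¹)) t e
  ... | u , s , _ , _ , et = eval u , s , et

  ν-down : ∀ g t → ν g t ≡ true → ℓ (g ∙ t) < ℓ g
  ν-down g t e = subst₂ _<_ (trans (cong ℓ (trans (cong (_∙ (g ⁻¹)) (sym (Refl-⁻¹ (ν-Refl g t e))))
      (grp (x₀ ⁱ ⊙ x₁ ⁱ) ((x₁ ⊙ x₀) ⁱ) (t ∷ g ∷ []) [] refl))) (ℓ-⁻¹ (g ∙ t))) (ℓ-⁻¹ g) (N-down (g ⁻¹) t e)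

  ν-up : ∀ g {t} → Refl t → ν g t ≡ false → ℓ g < ℓ (g ∙ t)
  ν-up g {t} r e = subst (λ x → ℓ x < ℓ (g ∙ t)) (grp ((x₀ ⊙ y₀) ⊙ y₀) x₀ (g ∷ []) ((t , Refl² r) ∷ []) refl)
    (ν-down (g ∙ t) t (trans (ν-∙ g t t) (cong₂ _xor_ (ν-self r)
      (trans (cong (ν g) (grp (x₀ ▸ x₀) x₀ (t ∷ []) [] refl)) e))))

  ν-true : ∀ g {t} → Refl t → ℓ (g ∙ t) ≤ ℓ g → ν g t ≡ true
  ν-true g {t} r le with ν g t in e
  ... | true = refl
  ... | false = ⊥-elim (ℕ.<⇒≱ (ν-up g r e) le)

  ν-false : ∀ g {t} → ℓ g ≤ ℓ (g ∙ t) → ν g t ≡ false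
  ν-false g {t} le with ν g t in e
  ... | false = refl
  ... | true = ⊥-elim (ℕ.<⇒≱ (ν-down g t e) le)

  N-true : ∀ g {t} → Refl t → ℓ (t ∙ g) ≤ ℓ g → N g t ≡ true
  N-true g {t} r le with N g t in e
  ... | true = refl
  ... | false = ⊥-elim (ℕ.<⇒≱ (N-up g r e) le)

  reduced-∷ʳ : ∀ w s → Reduced w → ν (eval w) (gen s) ≡ false → Reduced (w ++ [ s ])
  reduced-∷ʳ w s red e = reduced-ℓ (subst (_≤ ℓ (eval (w ++ [ s ]))) (trans (cong suc (ℓ-reduced red))
      (sym (trans (length-++ w) (ℕ.+-comm (length w) 1))))
    (subst (λ x → ℓ (eval w) < ℓ x) (sym (eval-++ w [ s ])) (ν-up (eval w) (Refl-gen s) e)))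

  -- Parabolic subgroups and minimal coset representatives

  InW : (Fin n → Set) → G → Set
  InW P g = Σ Word λ w → (eval w ≡ g) × All P w

  module _ {P : Fin n → Set} where
    InW-1 : InW P 1g
    InW-1 = [] , refl , []

    InW-gen : ∀ {s} → P s → InW P (gen s)
    InW-gen p = [ _ ] , refl , p ∷ []

    InW-∙ : ∀ {g h} → InW P g → InW P h → InW P (g ∙ h)
    InW-∙ (u , refl , pu) (v , refl , pv) = u ++ v , eval-++ u v , All.++⁺ pu pv

    InW-⁻¹ : ∀ {g} → InW P g → InW P (g ⁻¹)
    InW-⁻¹ (u , refl , pu) = reverse u , eval-reverse u , All-reverse pu

    InW-▷ : ∀ {g t} → InW P g → InW P t → InW P (g ▷ t)
    InW-▷ pg pt = InW-∙ pg (InW-∙ pt (InW-⁻¹ pg))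

    InW-▷⁻ : ∀ {g t} → InW P g → InW P (g ▷ t) → InW P t
    InW-▷⁻ {g} {t} pg pt = subst (InW P) (▷-cancel g t) (InW-▷ (InW-⁻¹ pg) pt)

    -- An inversion is a letter conjugated by a prefix, both taken from the given word.
    InW-N : ∀ {g t} → InW P g → N g t ≡ true → InW P t
    InW-N {t = t} (w , refl , pw) e with exchange w t (trans (sym (N-eval w t)) e)
    ... | u , s , v , refl , refl = InW-▷ (u , refl , All.++⁻ˡ u pw) (InW-gen (All.head (All.++⁻ʳ u pw)))

    InW-ν : ∀ {g t} → InW P g → ν g t ≡ true → InW P t
    InW-ν pg e = InW-N (InW-⁻¹ pg) e

    InW-gen⁻ : ∀ {s} → InW P (gen s) → P s
    InW-gen⁻ {s} (w , e , pw) with reduce w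
    ... | r , er , red , sub = go r (trans er e) (red [ s ] (sym (trans er e))) (sub pw)
      where
      go : ∀ r → eval r ≡ gen s → length r ≤ 1 → All P r → P s
      go [] e _ _ = ⊥-elim (true≢false (trans (sym (trans (N-gen s (gen s)) (eqb-refl (gen s))))
        (trans (cong (λ x → N x (gen s)) (sym e)) (N-1 (gen s)))))
      go (k ∷ []) e _ (pk ∷ []) = subst P (gen-injective e) pk
      go (_ ∷ _ ∷ _) e (s≤s ()) _

    -- The first letter of a reduced word is an inversion, hence lies in the subgroup by `InW-N` and
    -- in `P` by `InW-gen⁻`; it can then be cancelled.
    reduced-All : ∀ {w} → Reduced w → InW P (eval w) → All P w
    reduced-All {[]} red pw = []
    reduced-All {s ∷ w} red pw = ps ∷ reduced-All red' pw'
      where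
      shorter : ℓ (gen s ∙ eval (s ∷ w)) ≤ length w
      shorter = ℓ-≤ w (trans (grp x₀ (y₀ ⊙ (y₀ ⊙ x₀)) (eval w ∷ []) (geni s ∷ []) refl)
          (cong (gen s ∙_) (sym (eval-∷ s w))))
      ps : P s
      ps = InW-gen⁻ (InW-N pw (N-true (eval (s ∷ w)) (Refl-gen s)
        (ℕ.≤-trans shorter (ℕ.≤-trans (ℕ.n≤1+n _) (ℕ.≤-reflexive (sym (ℓ-reduced red)))))))
      red' : Reduced w
      red' w' e = ℕ.≤-pred (red (s ∷ w') (trans (eval-∷ s w') (trans (cong (gen s ∙_) e) (sym (eval-∷ s w)))))
      pw' : InW P (eval w)
      pw' = subst (InW P) (trans (cong (gen s ∙_) (eval-∷ s w)) (grp (y₀ ⊙ (y₀ ⊙ x₀)) x₀ (eval w ∷ [])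
          (geni s ∷ []) refl))
              (InW-∙ (InW-gen ps) pw)

    -- By `reduced-All`, membership is decided by the letters of the single reduced word `word g`.
    -- Stability is what the classical arguments below rely on.
    InW-stable : Decidable P → ∀ {g} → ¬ ¬ InW P g → InW P g
    InW-stable P? {g} nn with All.all? P? (word g)
    ... | yes p = word g , eval-word g , p
    ... | no np = ⊥-elim (nn λ pg → np (reduced-All (word-reduced g) (subst (InW P) (sym (eval-word g)) pg)))

    private
      -- A minimal representative of the coset g W_P exists, up to double negation. The element `g`
      -- is offered as its own representative; a reflection of W_P that refutes this restarts the
      -- argument with the shorter g r.
      minimal : ∀ k g → ℓ g ≤ k → ((y p : G) → InW P p → g ≡ y ∙ p →
                (∀ r → Refl r → InW P r → ν y r ≡ false) → ⊥) → ⊥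
      minimal k g le K = K g 1g InW-1 (sym (idʳ g)) λ r rr pr → go k le r rr pr
        where
        go : ∀ k → ℓ g ≤ k → ∀ r → Refl r → InW P r → ν g r ≡ false
        go k le r rr pr with ν g r in e
        ... | false = refl
        go zero le r rr pr | true = ⊥-elim (ℕ.n≮0 (ℕ.<-≤-trans (ν-down g r e) le))
        go (suc k) le r rr pr | true = ⊥-elim (minimal k (g ∙ r) (ℕ.≤-pred (ℕ.≤-trans (ν-down g r e) le))
          λ y p pp eq min → K y (p ∙ r) (InW-∙ pp pr)
            (trans (grp x₀ ((x₀ ⊙ y₀) ⊙ y₀) (g ∷ []) ((r , Refl² rr) ∷ []) refl)
              (trans (cong (_∙ r) eq) (assoc y p r))) min)

    -- Write g = y p with `y` minimal. If `p` were not trivial, its last letter would be a descent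
    -- of `p`, and `y` would not change the sign, so `g` would have a simple descent in `P`.
    ν-minimal : ∀ g → (∀ l → P l → ν g (gen l) ≡ false) → ∀ r → Refl r → InW P r → ν g r ≡ false
    ν-minimal g noDesc r rr pr with ν g r in e
    ... | false = refl
    ... | true = ⊥-elim (minimal (ℓ g) g ℕ.≤-refl K)
      where
      K : (y p : G) → InW P p → g ≡ y ∙ p → (∀ r → Refl r → InW P r → ν y r ≡ false) → ⊥
      K y p pp eq min = go (word p) (word-reduced p) (eval-word p)
        where
        go : ∀ w → Reduced w → eval w ≡ p → ⊥
        go w red ew with initLast w
        ... | [] = true≢false (trans (sym e) (trans
            (cong (λ x → ν x r) (trans eq (trans (cong (y ∙_) (sym ew)) (idʳ y)))) (min r rr pr)))
        ... | w' ∷ʳ′ l = true≢false (trans (sym desc) (noDesc l pl))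
          where
          pl : P l
          pl = All.head (All.++⁻ʳ w' (reduced-All red (subst (InW P) (sym ew) pp)))
          pdesc : ν p (gen l) ≡ true
          pdesc = ν-true p (Refl-gen l) (ℕ.≤-trans (ℓ-≤ w'
              (trans (grp x₀ ((x₀ ⊙ y₀) ⊙ y₀) (eval w' ∷ []) (geni l ∷ []) refl)
              (cong (_∙ gen l) (trans (sym (eval-++ w' [ l ])) ew))))
            (ℕ.≤-trans (ℕ.m≤m+n (length w') 1) (ℕ.≤-reflexive (trans (sym (length-++ w'))
                (trans (sym (ℓ-reduced red)) (cong ℓ ew))))))
          desc : ν g (gen l) ≡ true
          desc = trans (cong (λ x → ν x (gen l)) eq) (trans (ν-∙ y p (gen l))
            (cong₂ _xor_ pdesc (min (p ▷ gen l) (Refl-▷ p (Refl-gen l)) (InW-▷ pp (InW-gen pl)))))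

  -- Dihedral reflection subgroups

  -- Conjugating by simple reflections preserves the hypotheses until a simple
  -- reflection is a member of D, and it inverts only itself.
  mutually-inverted : (D : G → Set) → (∀ {t u} → D t → D u → D (t ▷ u)) →
    (∀ {t u} → D t → D u → ν t u ≡ true) → ∀ w s {a b} → a ≡ eval w ▷ gen s → D a → D b → a ≡ b
  mutually-inverted D closed inverted [] s {a} {b} ea da db = trans a≡s (sym (only db))
    where
    a≡s : a ≡ gen s
    a≡s = trans ea (grp (ι ▸ y₀) y₀ [] (geni s ∷ []) refl)
    only : ∀ {t} → D t → t ≡ gen s
    only {t} dt = eqb-true (trans (sym (ν-gen s t)) (trans (cong (λ x → ν x t) (sym a≡s)) (inverted da dt)))
  mutually-inverted D closed inverted (l ∷ w) s {a} {b} ea da db with a ≟ b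
  ... | yes e = e
  ... | no a≢b = ▷-injective (gen l) (mutually-inverted D′ closed′ inverted′ w s
          (trans (cong (gen l ▷_) (trans ea (cong (_▷ gen s) (eval-∷ l w))))
            (grp (y₀ ▸ (y₀ ⊙ x₀) ▸ y₁) (x₀ ▸ y₁) (eval w ∷ []) (geni l ∷ geni s ∷ []) refl))
          (subst D (sym (gen-▷² l a)) da) (subst D (sym (gen-▷² l b)) db))
    where
    D′ : G → Set
    D′ t = D (gen l ▷ t)
    l∉D : ¬ D (gen l)
    l∉D dl = a≢b (trans (only da) (sym (only db)))
      where
      only : ∀ {t} → D t → t ≡ gen l
      only {t} dt = eqb-true (trans (sym (ν-gen l t)) (inverted dl dt))
    closed′ : ∀ {t u} → D′ t → D′ u → D′ (t ▷ u)
    closed′ {t} {u} dt du = subst D (grp ((y₀ ▸ x₀) ▸ y₀ ▸ x₁) (y₀ ▸ x₀ ▸ x₁) (t ∷ u ∷ []) (geni l ∷ []) refl)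
        (closed dt du)
    inverted′ : ∀ {t u} → D′ t → D′ u → ν t u ≡ true
    inverted′ {t} {u} dt du = trans
      (cong (λ x → ν x u) (grp x₀ (y₀ ⊙ ((y₀ ▸ x₀) ⊙ y₀)) (t ∷ []) (geni l ∷ []) refl))
      (trans (ν-∙ (gen l) (T ∙ gen l) u) (cong₂ _xor_
        (trans (ν-∙ T (gen l) u) (cong₂ _xor_
          (trans (ν-gen l u) (eqb-≢ {u} {gen l} λ { refl → l∉D (subst D (gen-▷-self l) du) }))
          (inverted dt du)))
        (trans (ν-gen l _) (eqb-≢ {_} {gen l} λ e → l∉D (subst D (trans (sym (▷-∙ T (gen l) u)) e)
            (closed dt du))))))
      where T = gen l ▷ t

  finite-order : (ρ : G) → Σ ℕ λ d → power ρ (suc d) ≡ 1g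
  finite-order ρ with pigeonhole (ℕ.n<1+n size) (λ i → power ρ (toℕ i))
  ... | i , j , i<j , e = d , ∙-cancelˡ (power ρ (toℕ i)) (trans (sym (power-+ ρ (toℕ i) (suc d)))
        (trans (cong (power ρ) (trans (ℕ.+-suc (toℕ i) d) (ℕ.m+[n∸m]≡n i<j))) (trans (sym e) (sym (idʳ _)))))
    where d = toℕ j ℕ.∸ suc (toℕ i)

  module Dihedral {a b : G} (ra : Refl a) (rb : Refl b) where
    ρ : G
    ρ = a ∙ b

    ai bi : Involution
    ai = a , Refl² ra
    bi = b , Refl² rb

    Z : G → Set
    Z x = Σ ℕ λ k → x ≡ power ρ k

    Z-∙ : ∀ {x y} → Z x → Z y → Z (x ∙ y)
    Z-∙ (j , refl) (k , refl) = j ℕ.+ k , sym (power-+ ρ j k)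

    Z-ρ : Z ρ
    Z-ρ = 1 , sym (idʳ ρ)

    -- Natural exponents are enough because `ρ` has finite order.
    Z-ρ⁻¹ : Z (ρ ⁻¹)
    Z-ρ⁻¹ with finite-order ρ
    ... | d , e = d , trans (sym (idʳ _)) (trans (cong (ρ ⁻¹ ∙_) (sym e))
                        (grp (x₀ ⁱ ⊙ (x₀ ⊙ x₁)) x₁ (ρ ∷ power ρ d ∷ []) [] refl))

    Z-⁻¹ : ∀ {x} → Z x → Z (x ⁻¹)
    Z-⁻¹ (zero , refl) = 0 , grp (ι ⁱ) ι [] [] refl
    Z-⁻¹ (suc k , refl) = subst Z (grp (x₁ ⁱ ⊙ x₀ ⁱ) ((x₀ ⊙ x₁) ⁱ) (ρ ∷ power ρ k ∷ []) [] refl)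
                            (Z-∙ (Z-⁻¹ (k , refl)) Z-ρ⁻¹)

    a-inverts : ∀ {x} → Z x → a ∙ (x ∙ a) ≡ x ⁻¹
    a-inverts (zero , refl) = grp (y₀ ⊙ (ι ⊙ y₀)) (ι ⁱ) [] (ai ∷ []) refl
    a-inverts (suc k , refl) = trans (grp (y₀ ⊙ (((y₀ ⊙ y₁) ⊙ x₀) ⊙ y₀)) ((y₁ ⊙ y₀) ⊙ (y₀ ⊙ (x₀ ⊙ y₀)))
        (power ρ k ∷ []) (ai ∷ bi ∷ []) refl)
      (trans (cong ((b ∙ a) ∙_) (a-inverts (k , refl)))
        (trans (grp ((y₁ ⊙ y₀) ⊙ x₀ ⁱ) ((x₀ ⊙ (y₀ ⊙ y₁)) ⁱ) (power ρ k ∷ []) (ai ∷ bi ∷ []) refl)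
          (cong _⁻¹ (trans (trans (cong (power ρ k ∙_) (sym (idʳ ρ))) (sym (power-+ ρ k 1)))
              (cong (power ρ) (ℕ.+-comm k 1))))))

    -- The reflections of the dihedral group ⟨a , b⟩, whose rotations form Z.
    D : G → Set
    D t = Z (a ∙ t)

    D-a : D a
    D-a = 0 , Refl² ra

    D-b : D b
    D-b = Z-ρ

    D-form : ∀ {t} (d : D t) → t ≡ a ∙ (a ∙ t)
    D-form {t} _ = grp x₀ (y₀ ⊙ (y₀ ⊙ x₀)) (t ∷ []) (ai ∷ []) refl

    -- Conjugation by b a raises the exponent by two, so both parities are reached from `a` and from
    -- a ρ = b.
    D-power : ∀ k → Refl (a ∙ power ρ k)
    D-power zero = subst Refl (sym (idʳ a)) ra
    D-power (suc zero) = subst Refl (grp y₁ (y₀ ⊙ ((y₀ ⊙ y₁) ⊙ ι)) [] (ai ∷ bi ∷ []) refl) rb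
    D-power (suc (suc k)) = subst Refl
      (trans (grp ((y₁ ⊙ y₀) ▸ (y₀ ⊙ x₀)) ((y₁ ⊙ x₀) ⊙ (y₀ ⊙ y₁)) (power ρ k ∷ []) (ai ∷ bi ∷ []) refl)
        (trans (assoc b (power ρ k) ρ) (trans (cong (b ∙_)
            (trans (trans (cong (power ρ k ∙_) (sym (idʳ ρ))) (sym (power-+ ρ k 1)))
            (cong (power ρ) (ℕ.+-comm k 1))))
          (grp (y₁ ⊙ ((y₀ ⊙ y₁) ⊙ x₀)) (y₀ ⊙ ((y₀ ⊙ y₁) ⊙ ((y₀ ⊙ y₁) ⊙ x₀))) (power ρ k ∷ []) (ai ∷ bi ∷ [])
              refl))))
      (Refl-▷ (b ∙ a) (D-power k))

    D-Refl : ∀ {t} → D t → Refl t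
    D-Refl d@(k , e) = subst Refl (trans (cong (a ∙_) (sym e)) (sym (D-form d))) (D-power k)

    Z∙D : ∀ {z t} → Z z → D t → D (z ∙ t)
    Z∙D {z} {t} zz dt = subst Z (trans (cong (_∙ (a ∙ t)) (sym (a-inverts zz)))
      (grp ((y₀ ⊙ (x₀ ⊙ y₀)) ⊙ (y₀ ⊙ x₁)) (y₀ ⊙ (x₀ ⊙ x₁)) (z ∷ t ∷ []) (ai ∷ []) refl)) (Z-∙ (Z-⁻¹ zz) dt)

    D∙Z : ∀ {z t} → D t → Z z → D (t ∙ z)
    D∙Z dt zz = subst Z (assoc _ _ _) (Z-∙ dt zz)

    Z▷D : ∀ {z t} → Z z → D t → D (z ▷ t)
    Z▷D zz dt = Z∙D zz (D∙Z dt (Z-⁻¹ zz))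

    D∙D : ∀ {t u} → D t → D u → Z (t ∙ u)
    D∙D {t} {u} dt du = subst Z (trans (cong (_∙ (a ∙ u)) (sym (a-inverts dt)))
      (grp ((y₀ ⊙ ((y₀ ⊙ x₀) ⊙ y₀)) ⊙ (y₀ ⊙ x₁)) (x₀ ⊙ x₁) (t ∷ u ∷ []) (ai ∷ []) refl)) (Z-∙ (Z-⁻¹ dt) du)

    D▷D : ∀ {t u} → D t → D u → D (t ▷ u)
    D▷D {t} {u} dt du = subst D (trans (assoc t u t) (cong (λ x → t ∙ (u ∙ x)) (sym (Refl-⁻¹ (D-Refl dt)))))
        (Z∙D (D∙D dt du) dt)

    -- The hypotheses make the rotations of ⟨a , b⟩ invert no member of D, hence the
    -- members of D invert each other.
    peak-impossible : ∀ x → ℓ x < ℓ (x ∙ a) → ℓ (x ∙ ρ) < ℓ (x ∙ a) →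
                      (∀ {t} → D t → ℓ (x ∙ a) ≤ ℓ (x ∙ t)) → a ≡ b
    peak-impossible x up down low = mutually-inverted D D▷D inverted (rep (proj₁ ra)) (proj₁ (proj₂ ra))
      (trans (proj₂ (proj₂ ra)) (cong (_▷ gen (proj₁ (proj₂ ra))) (sym (eval-rep (proj₁ ra))))) D-a D-b
      where
      ν-x : ∀ {t} → D t → ν x t ≡ false
      ν-x dt = ν-false x (ℕ.≤-trans (ℕ.<⇒≤ up) (low dt))
      ν-xρ : ∀ {t} → D t → ν (x ∙ ρ) t ≡ false
      ν-xρ {t} dt = ν-false (x ∙ ρ) (ℕ.≤-trans (ℕ.<⇒≤ down) (subst (λ y → ℓ (x ∙ a) ≤ ℓ y) (sym (assoc x ρ t))
          (low (Z∙D Z-ρ dt))))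
      ν-ρ : ∀ {t} → D t → ν ρ t ≡ false
      ν-ρ {t} dt = trans (sym (𝔹.xor-identityʳ _)) (trans (cong (ν ρ t xor_) (sym (ν-x (Z▷D Z-ρ dt))))
        (trans (sym (ν-∙ x ρ t)) (ν-xρ dt)))
      ν-Z : ∀ {z t} → Z z → D t → ν z t ≡ false
      ν-Z (zero , refl) dt = ν-1 _
      ν-Z (suc k , refl) dt = trans (ν-∙ ρ (power ρ k) _)
          (cong₂ _xor_ (ν-Z (k , refl) dt) (ν-ρ (Z▷D (k , refl) dt)))
      inverted : ∀ {t u} → D t → D u → ν t u ≡ true
      inverted {t} {u} dt du = trans (cong (λ y → ν y u) (grp x₀ ((x₀ ⊙ y₀) ⊙ y₀) (t ∷ [])
          ((u , Refl² (D-Refl du)) ∷ []) refl))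
        (trans (ν-∙ (t ∙ u) u u) (cong₂ _xor_ (ν-self (D-Refl du))
          (trans (cong (ν (t ∙ u)) (grp (x₀ ▸ x₀) x₀ (u ∷ []) [] refl)) (ν-Z (D∙D dt du) du))))

  -- Factorisations into reflections

  prod : List G → G
  prod [] = 1g
  prod (t ∷ ts) = t ∙ prod ts

  prod-++ : ∀ ts us → prod (ts ++ us) ≡ prod ts ∙ prod us
  prod-++ [] us = sym (idˡ _)
  prod-++ (t ∷ ts) us = trans (cong (t ∙_) (prod-++ ts us)) (sym (assoc _ _ _))

  -- The termination measure: the total length of the partial products. The `suc` for every factor
  -- makes the removal of a repeated pair a strict decrease.
  cost : G → List G → ℕ
  cost g [] = 0
  cost g (t ∷ ts) = suc (ℓ (g ∙ t) ℕ.+ cost (g ∙ t) ts)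

  Up : G → List G → Set
  Up g [] = ⊤
  Up g (t ∷ ts) = (ν g t ≡ false) × Up (g ∙ t) ts

  Up-∷ʳ : ∀ g ts t → Up g (ts ++ [ t ]) → Up g ts × (ν (g ∙ prod ts) t ≡ false)
  Up-∷ʳ g [] t (e , _) = tt , trans (cong (λ x → ν x t) (idʳ g)) e
  Up-∷ʳ g (t' ∷ ts) t (e , up) with Up-∷ʳ (g ∙ t') ts t up
  ... | up' , e' = (e , up') , trans (cong (λ x → ν x t) (sym (assoc g t' (prod ts)))) e'

  -- A path that begins upwards either keeps rising or, no later than at its first fall, has two
  -- equal neighbouring factors or a genuine peak. A path from the identity does begin upwards,
  -- since nothing is shorter.
  data Path (g : G) (ts : List G) : Set where
    increasing : Up g ts → Path g ts
    repeated   : ∀ p t q → ts ≡ p ++ t ∷ t ∷ q → Path g ts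
    peaked     : ∀ p a b q → ts ≡ p ++ a ∷ b ∷ q → a ≢ b → ν (g ∙ prod p) a ≡ false →
                 ν ((g ∙ prod p) ∙ a) b ≡ true → Path g ts

  path : ∀ g a ts → ν g a ≡ false → Path g (a ∷ ts)
  path g a [] e = increasing (e , tt)
  path g a (b ∷ ts) e with a ≟ b
  ... | yes refl = repeated [] a ts refl
  ... | no a≢b with ν (g ∙ a) b in e'
  ...   | true = peaked [] a b ts refl a≢b (trans (cong (λ x → ν x a) (idʳ g)) e)
      (trans (cong (λ x → ν (x ∙ a) b) (idʳ g)) e')
  ...   | false with path (g ∙ a) b ts e'
  ...     | increasing up = increasing (e , up)
  ...     | repeated p t q e″ = repeated (a ∷ p) t q (cong (a ∷_) e″)
  ...     | peaked p a' b' q e″ ne up down = peaked (a ∷ p) a' b' q (cong (a ∷_) e″) ne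
              (trans (cong (λ x → ν x a') (sym (assoc g a (prod p)))) up)
              (trans (cong (λ x → ν (x ∙ a') b') (sym (assoc g a (prod p)))) down)

  cost-lower : ∀ g p {a b r r'} q → r ∙ r' ≡ a ∙ b → ℓ ((g ∙ prod p) ∙ r) < ℓ ((g ∙ prod p) ∙ a) →
               cost g (p ++ r ∷ r' ∷ q) < cost g (p ++ a ∷ b ∷ q)
  cost-lower g [] {a} {b} {r} {r'} q e lt rewrite idʳ g = s≤s (ℕ.+-mono-<-≤ lt (ℕ.≤-reflexive
      (cong (λ x → suc (ℓ x ℕ.+ cost x q)) (trans (assoc g r r') (trans (cong (g ∙_) e) (sym (assoc g a b)))))))
  cost-lower g (t ∷ p) {a} {b} {r} {r'} q e lt = s≤s (ℕ.+-monoʳ-< (ℓ (g ∙ t)) (cost-lower (g ∙ t) p q e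
    (subst (λ x → ℓ (x ∙ r) < ℓ (x ∙ a)) (sym (assoc g t (prod p))) lt)))

  cost-cancel : ∀ g p t q → t ∙ t ≡ 1g → cost g (p ++ q) < cost g (p ++ t ∷ t ∷ q)
  cost-cancel g [] t q e = s≤s (ℕ.≤-trans (ℕ.≤-reflexive (cong (λ x → cost x q)
      (sym (trans (assoc g t t) (trans (cong (g ∙_) e) (idʳ g))))))
    (ℕ.≤-trans (ℕ.≤-trans (ℕ.m≤n+m _ _) (ℕ.n≤1+n _)) (ℕ.m≤n+m _ (ℓ (g ∙ t)))))
  cost-cancel g (x ∷ p) t q e = s≤s (ℕ.+-monoʳ-< (ℓ (g ∙ x)) (cost-cancel (g ∙ x) p t q e))

  Minimal : Word → List G → Set
  Minimal w ts = (length w ≤ length ts) × (length ts ≡ length w → All (InW (_∈ w)) ts)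

  eval-Unique-1 : ∀ w → Unique w → eval w ≡ 1g → w ≡ []
  eval-Unique-1 [] u e = refl
  eval-Unique-1 (s ∷ w) (s∉w ∷ u) e = ⊥-elim (All.lookup s∉w (InW-gen⁻ {_∈ w} (reverse w ,
    trans (eval-reverse w) (trans (sym (idˡ _)) (trans (cong (_∙ eval w ⁻¹) (trans (sym e) (eval-∷ s w)))
      (grp ((x₁ ⊙ x₀) ⊙ x₀ ⁱ) x₁ (eval w ∷ gen s ∷ []) [] refl))) , All-reverse (All.tabulate λ p → p))) refl)

  -- As the last step goes up, the product inverts the last factor `t`. So `t` lies in the subgroup
  -- of the letters, and right multiplication by `t` deletes a letter of `w`, which leaves the same
  -- problem for the shorter path.
  increasing-minimal : ∀ k ts w → length ts ≡ k → All Refl ts → Unique w → Up 1g ts → prod ts ≡ eval w → Minimal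
      w ts
  increasing-minimal k ts w len rs u up e with initLast ts
  ... | [] rewrite eval-Unique-1 w u (sym e) = z≤n , λ _ → []
  increasing-minimal zero .(ts ++ [ t ]) w len rs u up e | ts ∷ʳ′ t =
    ⊥-elim (ℕ.1+n≢0 (trans (trans (ℕ.+-comm 1 (length ts)) (sym (length-++ ts))) len))
  increasing-minimal (suc k) .(ts ++ [ t ]) w len rs u up e | ts ∷ʳ′ t
    with Up-∷ʳ 1g ts t up | All.++⁻ʳ ts rs
  ... | up' , νt | rt ∷ [] = go (exchangeʳ w t inverted)
    where
    factor : eval w ≡ prod ts ∙ t
    factor = trans (sym e) (trans (prod-++ ts [ t ]) (cong (prod ts ∙_) (idʳ t)))
    inverted : ν (eval w) t ≡ true
    inverted = trans (cong (λ x → ν x t) factor) (trans (ν-∙ (prod ts) t t) (cong₂ _xor_ (ν-self rt)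
      (trans (cong₂ ν (sym (idˡ (prod ts))) (grp (x₀ ▸ x₀) x₀ (t ∷ []) [] refl)) νt)))
    length-∷ʳ : length (ts ++ [ t ]) ≡ suc (length ts)
    length-∷ʳ = trans (length-++ ts) (ℕ.+-comm (length ts) 1)
    go : (Σ Word λ x → Σ (Fin n) λ s → Σ Word λ y → (w ≡ x ++ s ∷ y) × (t ≡ eval y ⁻¹ ▷ gen s)) →
         Minimal w (ts ++ [ t ])
    go (x , s , y , refl , et) = subst₂ _≤_ (length-delete x s y) (sym length-∷ʳ) (s≤s (proj₁ ih)) ,
      λ eq → All.++⁺ (All.map (λ { (v , ev , pv) → v , ev , All.map (∈-insert x) pv })
                (proj₂ ih (ℕ.suc-injective (trans (sym length-∷ʳ) (trans eq (sym (length-delete x s y)))))))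
              (InW-ν (x ++ s ∷ y , refl , All.tabulate λ p → p) inverted ∷ [])
      where
      ih : Minimal (x ++ y) ts
      ih = increasing-minimal k ts (x ++ y) (ℕ.suc-injective (trans (sym length-∷ʳ) len)) (All.++⁻ˡ ts rs)
        (Unique-delete x u) up' (trans (grp x₀ ((x₀ ⊙ y₀) ⊙ y₀) (prod ts ∷ []) ((t , Refl² rt) ∷ []) refl)
          (trans (cong (_∙ t) (sym factor)) (trans (cong (eval w ∙_) et) (deleteʳ x s y))))

  -- `peak-impossible` refutes that a peak is lowest without naming a lower reflection; stability of
  -- the conclusion makes this sufficient.
  Minimal-stable : ∀ w ts → ¬ ¬ Minimal w ts → Minimal w ts
  Minimal-stable w ts nn with length w ℕ.≤? length ts
  ... | no ¬p = ⊥-elim (nn λ (p , _) → ¬p p)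
  ... | yes p = p , λ eq → stable ts λ ¬all → nn λ (_ , all) → ¬all (all eq)
    where
    stable : ∀ ts → ¬ ¬ All (InW (_∈ w)) ts → All (InW (_∈ w)) ts
    stable [] nn = []
    stable (t ∷ ts) nn = InW-stable (λ r → DecMem._∈?_ _≟_ r w) (λ ¬t → nn λ { (pt ∷ _) → ¬t pt })
      ∷ stable ts λ ¬ts → nn λ { (_ ∷ pts) → ¬ts pts }

  minimal-factorisation′ : ∀ w → Unique w → ∀ k ts → cost 1g ts ≤ k → All Refl ts → prod ts ≡ eval w → Minimal w
      ts
  minimal-factorisation′ w u k [] le rs e = increasing-minimal 0 [] w refl rs u tt e
  minimal-factorisation′ w u (suc k) ts@(t₁ ∷ ts₁) le rs e with path 1g t₁ ts₁ (ν-1 t₁)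
  ... | increasing up = increasing-minimal _ ts w refl rs u up e
  ... | repeated p t q eq = subst (Minimal w) (sym eq) (remove p t q (subst (λ ts → cost 1g ts ≤ suc k) eq le)
      (subst (All Refl) eq rs) (trans (cong prod (sym eq)) e))
    where
    remove : ∀ p t q → cost 1g (p ++ t ∷ t ∷ q) ≤ suc k → All Refl (p ++ t ∷ t ∷ q) → prod (p ++ t ∷ t ∷ q) ≡
        eval w → Minimal w (p ++ t ∷ t ∷ q)
    remove p t q le rs e = ℕ.≤-trans (proj₁ ih) (ℕ.<⇒≤ shorter) ,
          λ eq → ⊥-elim (ℕ.<⇒≱ shorter (ℕ.≤-trans (ℕ.≤-reflexive eq) (proj₁ ih)))
      where
      rt : Refl t
      rt = All.head (All.++⁻ʳ p rs)
      shorter : length (p ++ q) < length (p ++ t ∷ t ∷ q)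
      shorter rewrite length-++ p {q} | length-++ p {t ∷ t ∷ q} = ℕ.+-monoʳ-< (length p) (s≤s (ℕ.n≤1+n _))
      ih : Minimal w (p ++ q)
      ih = minimal-factorisation′ w u k (p ++ q) (ℕ.≤-pred (ℕ.≤-trans (cost-cancel 1g p t q (Refl² rt)) le))
        (All.++⁺ (All.++⁻ˡ p rs) (All.tail (All.tail (All.++⁻ʳ p rs))))
        (trans (prod-++ p q) (trans (cong (prod p ∙_) (grp x₀ (y₀ ⊙ (y₀ ⊙ x₀)) (prod q ∷ [])
            ((t , Refl² rt) ∷ []) refl))
          (trans (sym (prod-++ p (t ∷ t ∷ q))) e)))
  ... | peaked p a b q eq a≢b up down = subst (Minimal w) (sym eq)
      (lower-peak p a b q (subst (λ ts → cost 1g ts ≤ suc k) eq le) (subst (All Refl) eq rs)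
      (trans (cong prod (sym eq)) e) a≢b up down)
    where
    lower-peak : ∀ p a b q → cost 1g (p ++ a ∷ b ∷ q) ≤ suc k → All Refl (p ++ a ∷ b ∷ q) → prod
        (p ++ a ∷ b ∷ q) ≡ eval w → a ≢ b → ν (1g ∙ prod p) a ≡ false → ν ((1g ∙ prod p) ∙ a) b ≡ true → Minimal
        w (p ++ a ∷ b ∷ q)
    -- If the claim failed, no reflection of the dihedral group could give a lower peak, because the
    -- claim for the cheaper factorisation would transfer back. A lowest peak forces a = b.
    lower-peak p a b q le rs e a≢b up down = Minimal-stable w (p ++ a ∷ b ∷ q) λ ¬min →
          a≢b (peak-impossible x (ν-up x ra up)
            (subst (λ y → ℓ y < ℓ (x ∙ a)) (assoc x a b) (ν-down (x ∙ a) b down))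
            λ {t} dt → ℕ.≮⇒≥ λ lower → ¬min (transfer dt (ih dt lower)))
      where
      x = 1g ∙ prod p
      ra : Refl a
      ra = All.head (All.++⁻ʳ p rs)
      rb : Refl b
      rb = All.head (All.tail (All.++⁻ʳ p rs))
      open Dihedral ra rb
      second : ∀ {t} → D t → t ∙ (t ∙ ρ) ≡ ρ
      second {t} dt = grp (y₀ ⊙ (y₀ ⊙ x₀)) x₀ (ρ ∷ []) ((t , Refl² (D-Refl dt)) ∷ []) refl
      ih : ∀ {t} → D t → ℓ (x ∙ t) < ℓ (x ∙ a) → Minimal w (p ++ t ∷ (t ∙ ρ) ∷ q)
      ih {t} dt lower = minimal-factorisation′ w u k _
        (ℕ.≤-pred (ℕ.≤-trans (cost-lower 1g p q (second dt) lower) le))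
        (All.++⁺ (All.++⁻ˡ p rs) (D-Refl dt ∷ D-Refl (D∙Z dt Z-ρ) ∷ All.tail (All.tail (All.++⁻ʳ p rs))))
        (trans (prod-++ p _) (trans (cong (prod p ∙_) (trans (sym (assoc _ _ _))
            (trans (cong (_∙ prod q) (second dt)) (assoc _ _ _))))
          (trans (sym (prod-++ p (a ∷ b ∷ q))) e)))
      -- The pairs a, b and t, t ρ have the same product `ρ` and generate the same dihedral group,
      -- so a parabolic subgroup that contains one pair contains the other.
      transfer : ∀ {t} → D t → Minimal w (p ++ t ∷ (t ∙ ρ) ∷ q) → Minimal w (p ++ a ∷ b ∷ q)
      transfer {t} dt (le , all) = subst (length w ≤_) same le , λ eq → transferAll (all (trans same eq))
        where
        same : length (p ++ t ∷ (t ∙ ρ) ∷ q) ≡ length (p ++ a ∷ b ∷ q)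
        same = trans (length-++ p) (sym (length-++ p))
        transferAll : All (InW (_∈ w)) (p ++ t ∷ (t ∙ ρ) ∷ q) → All (InW (_∈ w)) (p ++ a ∷ b ∷ q)
        transferAll pall with All.++⁻ʳ p pall
        ... | pt ∷ ptρ ∷ pq = All.++⁺ (All.++⁻ˡ p pall) (pa ∷ pb ∷ pq)
          where
          pρ : InW (_∈ w) ρ
          pρ = subst (InW (_∈ w)) (second dt) (InW-∙ pt ptρ)
          ppower : ∀ k → InW (_∈ w) (power ρ k)
          ppower zero = InW-1
          ppower (suc k) = InW-∙ pρ (ppower k)
          pa : InW (_∈ w) a
          pa = subst (InW (_∈ w)) (trans (cong (_∙ t) (sym (proj₂ dt)))
                 (grp ((y₀ ⊙ y₁) ⊙ y₁) y₀ [] (ai ∷ (t , Refl² (D-Refl dt)) ∷ []) refl))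
                     (InW-∙ (ppower (proj₁ dt)) pt)
          pb : InW (_∈ w) b
          pb = subst (InW (_∈ w)) (grp (y₀ ⊙ (y₀ ⊙ y₁)) y₁ [] (ai ∷ bi ∷ []) refl) (InW-∙ pa pρ)

  -- Hurwitz moves lower the peaks of the path of partial products until the path
  -- increases, and an increasing path deletes one letter of w per factor (cf. Dyer;
  -- Baumeister, Dyer, Stump and Wegener).
  minimal-factorisation : ∀ w → Unique w → ∀ ts → All Refl ts → prod ts ≡ eval w → Minimal w ts
  minimal-factorisation w u ts = minimal-factorisation′ w u _ ts ℕ.≤-refl

  -- Commuting generators and initial letters

  Comm : Fin n → Fin n → Set
  Comm s t = gen s ∙ gen t ≡ gen t ∙ gen s

  Comm? : ∀ s t → Dec (Comm s t)
  Comm? s t = _ ≟ _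

  ν-gen-≢ : ∀ {s t} → t ≢ gen s → ν (gen s) t ≡ false
  ν-gen-≢ {s} {t} ne = trans (ν-gen s t) (eqb-≢ {t} {gen s} ne)

  ν-gen-self : ∀ s → ν (gen s) (gen s) ≡ true
  ν-gen-self s = ν-self (Refl-gen s)

  ▷-Comm : ∀ {s a} → gen a ▷ gen s ≡ gen s → Comm s a
  ▷-Comm {s} {a} e = trans (cong (_∙ gen a) (sym e))
    (grp ((y₁ ▸ y₀) ⊙ y₁) (y₁ ⊙ y₀) [] (geni s ∷ geni a ∷ []) refl)

  -- Follow the root of `s`: `s` makes it negative, `a` keeps it negative, and the final `s` could
  -- restore the sign only if `a` fixed the reflection `s`.
  ν-conjugate : ∀ {s a} → ¬ Comm s a → ν (gen s ▷ gen a) (gen s) ≡ true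
  ν-conjugate {s} {a} nc = trans (ν-∙ (gen s) (gen a ∙ gen s ⁻¹) (gen s)) (cong₂ _xor_
    (trans (ν-∙ (gen a) (gen s ⁻¹) (gen s)) (cong₂ _xor_
      (trans (cong (λ x → ν x (gen s)) (⁻¹-gen s)) (ν-gen-self s))
      (trans (cong (ν (gen a)) (grp (y₀ ⁱ ▸ y₀) y₀ [] (geni s ∷ []) refl))
        (ν-gen-≢ λ e → nc (cong₂ _∙_ e (sym e))))))
    (trans (cong (ν (gen s)) (grp ((y₁ ⊙ y₀ ⁱ) ▸ y₀) (y₁ ▸ y₀) [] (geni s ∷ geni a ∷ []) refl))
      (ν-gen-≢ λ e → nc (▷-Comm e))))

  -- By `ν-minimal`, `g` keeps the positive roots of W_P positive, so conjugation by `g` transports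
  -- `ν-conjugate`. This produces all the contradictions with parabolic subgroups below.
  ν-conjugate-minimal : ∀ {P : Fin n → Set} g → (∀ l → P l → ν g (gen l) ≡ false) → ∀ {s a} → P s → P a →
    ¬ Comm s a → ν (g ▷ gen s ▷ gen a) (g ▷ gen s) ≡ true
  ν-conjugate-minimal {P} g noDesc {s} {a} ps pa nc =
    trans (ν-∙ g (h ∙ g ⁻¹) (g ▷ gen s)) (cong₂ _xor_
      (trans (ν-∙ h (g ⁻¹) (g ▷ gen s)) (cong₂ _xor_ (trans (ν-⁻¹ g (gen s)) (noDesc s ps))
        (trans (cong (ν h) (▷-cancel g (gen s))) (ν-conjugate nc))))
      (trans (cong (ν g) (grp ((x₁ ⊙ x₀ ⁱ) ▸ x₀ ▸ y₀) (x₁ ▸ y₀) (g ∷ h ∷ []) (geni s ∷ []) refl))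
        (ν-minimal {P} g noDesc (h ▷ gen s) (Refl-▷ h (Refl-gen s))
          (InW-▷ (InW-▷ (InW-gen ps) (InW-gen pa)) (InW-gen ps)))))
    where h = gen s ▷ gen a

  eval-commute : ∀ s u v → All (Comm s) u → eval (u ++ s ∷ v) ≡ eval (s ∷ u ++ v)
  eval-commute s [] v [] = refl
  eval-commute s (b ∷ u) v (c ∷ cs) = trans (eval-∷ b (u ++ s ∷ v))
      (trans (cong (gen b ∙_) (trans (eval-commute s u v cs) (eval-∷ s (u ++ v))))
    (trans (sym (assoc _ _ _)) (trans (cong (_∙ eval (u ++ v)) (sym c)) (trans (assoc _ _ _)
      (trans (cong (gen s ∙_) (sym (eval-∷ b (u ++ v)))) (sym (eval-∷ s (b ∷ u ++ v))))))))

  -- Take the last letter `b` of `u`. From u s = s u it follows that `u` inverts s b s, which then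
  -- lies in the subgroup of the letters of `u`. If `s` and `b` did not commute, s b s would invert
  -- `s` and put `s` itself there.
  commuting-letters : ∀ k u s → length u ≡ k → Unique u → s ∉ u → eval u ∙ gen s ≡ gen s ∙ eval u → All (Comm s)
      u
  commuting-letters k u s len uq s∉u e with initLast u
  ... | [] = []
  commuting-letters zero .(p ++ [ b ]) s len uq s∉u e | p ∷ʳ′ b =
    ⊥-elim (ℕ.1+n≢0 (trans (ℕ.+-comm 1 (length p)) (trans (sym (length-++ p)) len)))
  commuting-letters (suc k) .(p ++ [ b ]) s len uq s∉u e | p ∷ʳ′ b =
    All.++⁺ (commuting-letters k p s (ℕ.suc-injective (trans (ℕ.+-comm 1 (length p))
        (trans (sym (length-++ p)) len)))
              (Unique-++ˡ p uq) (λ s∈p → s∉u (∈-++⁺ˡ s∈p)) p-commutes)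
            (b-commutes ∷ [])
    where
    u = p ++ [ b ]
    s≢b : s ≢ b
    s≢b refl = s∉u (∈-middle p)
    g = eval u ∙ gen s
    g′ : g ≡ (gen s ∙ eval p) ∙ gen b
    g′ = trans e (trans (cong (gen s ∙_) (eval-++ p [ b ])) (sym (assoc _ _ _)))
    b-fixed : ν (gen s ∙ eval p) (gen b) ≡ false
    b-fixed with ν (gen s ∙ eval p) (gen b) in eq
    ... | false = refl
    ... | true with InW-gen⁻ {_∈ s ∷ p} (InW-ν (s ∷ p , eval-∷ s p , All.tabulate λ z → z) eq)
    ...   | here refl = ⊥-elim (s≢b refl)
    ...   | there b∈p = ⊥-elim (Unique-∉ p uq b∈p)
    b-inverted : ν g (gen b) ≡ true
    b-inverted = trans (cong (λ x → ν x (gen b)) g′) (trans (ν-∙ (gen s ∙ eval p) (gen b) (gen b))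
      (cong₂ _xor_ (ν-gen-self b) (trans (cong (ν (gen s ∙ eval p)) (gen-▷-self b)) b-fixed)))
    conj-inverted : ν (eval u) (gen s ▷ gen b) ≡ true
    conj-inverted = trans (cong (λ x → ν x (gen s ▷ gen b)) (grp x₀ ((x₀ ⊙ y₀) ⊙ y₀) (eval u ∷ []) (geni s ∷ [])
        refl))
      (trans (ν-∙ g (gen s) (gen s ▷ gen b)) (cong₂ _xor_
        (ν-gen-≢ λ eq → s≢b (gen-injective (sym (▷-injective (gen s) (trans eq (sym (gen-▷-self s)))))))
        (trans (cong (ν g) (gen-▷² s (gen b))) b-inverted)))
    b-commutes : Comm s b
    b-commutes with Comm? s b
    ... | yes c = c
    ... | no nc = ⊥-elim (s∉u (InW-gen⁻ {_∈ u} (InW-ν (InW-ν (u , refl , All.tabulate λ z → z) conj-inverted)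
        (ν-conjugate nc))))
    p-commutes : eval p ∙ gen s ≡ gen s ∙ eval p
    p-commutes = ∙-cancelʳ (gen b) (trans (assoc _ _ _) (trans (cong (eval p ∙_) b-commutes)
        (trans (sym (assoc _ _ _))
      (trans (cong (_∙ gen s) (sym (eval-++ p [ b ]))) g′))))

  InitialSplit : Fin n → Word → Set
  InitialSplit s w = Σ Word λ u → Σ Word λ v → (w ≡ u ++ s ∷ v) × All (Comm s) u

  -- Exchange gives s = u b u⁻¹ with a prefix `u` and the letter `b` after it. If s and b differed,
  -- supports would force s ∈ u and then b ∈ u, against distinctness; and if they agree, `u`
  -- commutes with `s`, hence letter by letter.
  initial-split : ∀ w s → Unique w → N (eval w) (gen s) ≡ true → InitialSplit s w
  initial-split w s uq e with exchange w (gen s) (trans (sym (N-eval w _)) e)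
  ... | u , b , v , refl , eb = go (s ≟ b)
    where
    go : Dec (s ≡ b) → InitialSplit s (u ++ b ∷ v)
    go (yes refl) = u , v , refl , commuting-letters _ u s refl (Unique-++ˡ u uq) (Unique-∉ u uq)
      (trans (cong (eval u ∙_) (grp y₀ (y₀ ⊙ (x₀ ⁱ ⊙ x₀)) (eval u ∷ []) (geni s ∷ []) refl))
        (trans (grp (x₀ ⊙ (y₀ ⊙ (x₀ ⁱ ⊙ x₀))) ((x₀ ▸ y₀) ⊙ x₀) (eval u ∷ []) (geni s ∷ []) refl)
            (cong (_∙ eval u) (sym eb))))
    go (no s≢b) = ⊥-elim (Unique-∉ u uq (InW-gen⁻ {_∈ u} (InW-▷⁻ (u , refl , All.tabulate λ z → z)
        (subst (InW (_∈ u)) eb (InW-gen s∈u)))))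
      where
      s∈ub : s ∈ b ∷ u
      s∈ub = InW-gen⁻ {_∈ b ∷ u} (subst (InW (_∈ b ∷ u)) (sym eb)
        (InW-▷ (u , refl , All.tabulate there) (InW-gen (here refl))))
      s∈u : s ∈ u
      s∈u with s∈ub
      ... | here s≡b = ⊥-elim (s≢b s≡b)
      ... | there p = p

  N-first : ∀ s w → s ∉ w → N (eval (s ∷ w)) (gen s) ≡ true
  N-first s w s∉w = trans (N-eval (s ∷ w) (gen s)) (cong₂ _xor_ (eqb-refl (gen s))
    (trans (cong (η w) (gen-▷-self s)) rest))
    where
    rest : η w (gen s) ≡ false
    rest with η w (gen s) in eq
    ... | false = refl
    ... | true = ⊥-elim (s∉w (InW-gen⁻ {_∈ w} (InW-N (w , refl , All.tabulate λ z → z)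
        (trans (N-eval w (gen s)) eq))))

  Reduced-++ˡ : ∀ u v → Reduced (u ++ v) → Reduced u
  Reduced-++ˡ u v red w e = ℕ.+-cancelʳ-≤ (length v) _ _ (subst₂ _≤_ (length-++ u) (length-++ w)
    (red (w ++ v) (trans (eval-++ w v) (trans (cong (_∙ eval v) e) (sym (eval-++ u v))))))

  Reduced-++ʳ : ∀ u v → Reduced (u ++ v) → Reduced v
  Reduced-++ʳ u v red w e = ℕ.+-cancelˡ-≤ (length u) _ _ (subst₂ _≤_ (length-++ u) (length-++ u)
    (red (u ++ w) (trans (eval-++ u w) (trans (cong (eval u ∙_) e) (sym (eval-++ u v))))))

  -- Alternating words for a Coxeter element

  -- Alt g A: every letter of A is initial in the Coxeter element obtained from g
  -- by conjugating with the preceding letters.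
  data Alt (g : G) : Word → Set where
    []  : Alt g []
    _∷_ : ∀ {s A} → N g (gen s) ≡ true → Alt (gen s ▷ g) A → Alt g (s ∷ A)

  after : ∀ g s A → eval A ⁻¹ ▷ gen s ▷ g ≡ eval (s ∷ A) ⁻¹ ▷ g
  after g s A = trans (grp (x₀ ⁱ ▸ y₀ ▸ x₁) ((y₀ ⊙ x₀) ⁱ ▸ x₁) (eval A ∷ g ∷ []) (geni s ∷ []) refl)
    (cong (λ x → x ⁻¹ ▷ g) (sym (eval-∷ s A)))

  1▷ : ∀ g → 1g ⁻¹ ▷ g ≡ g
  1▷ g = grp (ι ⁱ ▸ x₀) x₀ (g ∷ []) [] refl

  Alt-++⁺ : ∀ {g A B} → Alt g A → Alt (eval A ⁻¹ ▷ g) B → Alt g (A ++ B)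
  Alt-++⁺ {g} {[]} {B} [] bs = subst (λ x → Alt x B) (1▷ g) bs
  Alt-++⁺ {g} {s ∷ A} {B} (a ∷ as) bs = a ∷ Alt-++⁺ as (subst (λ x → Alt x B) (sym (after g s A)) bs)

  Alt-++⁻ˡ : ∀ {g} A {B} → Alt g (A ++ B) → Alt g A
  Alt-++⁻ˡ [] as = []
  Alt-++⁻ˡ (s ∷ A) (a ∷ as) = a ∷ Alt-++⁻ˡ A as

  Alt-++⁻ʳ : ∀ {g} A {B} → Alt g (A ++ B) → Alt (eval A ⁻¹ ▷ g) B
  Alt-++⁻ʳ {g} [] {B} as = subst (λ x → Alt x B) (sym (1▷ g)) as
  Alt-++⁻ʳ {g} (s ∷ A) {B} (a ∷ as) = subst (λ x → Alt x B) (after g s A) (Alt-++⁻ʳ A as)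

  eval-rotate : ∀ s w → eval (w ++ [ s ]) ≡ gen s ▷ eval (s ∷ w)
  eval-rotate s w = trans (eval-++ w [ s ]) (trans (grp (x₀ ⊙ y₀) (y₀ ▸ (y₀ ⊙ x₀)) (eval w ∷ []) (geni s ∷ [])
      refl)
    (cong (gen s ▷_) (sym (eval-∷ s w))))

  -- What remains of d₁ s d₂ a d₃ after Hurwitz moves have brought `s` and `a` to the front: the
  -- other letters, conjugated by the letters that passed them.
  pairFactors : Fin n → Fin n → Word → Word → Word → List G
  pairFactors s a d₁ d₂ d₃ = map (gen a ▷_) (map (gen s ▷_) (map gen d₁) ++ map gen d₂) ++ map gen d₃

  prod-gen : ∀ w → prod (map gen w) ≡ eval w
  prod-gen [] = refl
  prod-gen (s ∷ w) = trans (cong (gen s ∙_) (prod-gen w)) (sym (eval-∷ s w))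

  prod-▷ : ∀ g ts → prod (map (g ▷_) ts) ≡ g ▷ prod ts
  prod-▷ g [] = grp ι (x₀ ▸ ι) (g ∷ []) [] refl
  prod-▷ g (t ∷ ts) = trans (cong ((g ▷ t) ∙_) (prod-▷ g ts))
    (grp ((x₀ ▸ x₁) ⊙ (x₀ ▸ x₂)) (x₀ ▸ (x₁ ⊙ x₂)) (g ∷ t ∷ prod ts ∷ []) [] refl)

  prod-pairFactors : ∀ s a d₁ d₂ d₃ →
    gen s ∙ (gen a ∙ prod (pairFactors s a d₁ d₂ d₃)) ≡ eval (d₁ ++ s ∷ d₂ ++ a ∷ d₃)
  prod-pairFactors s a d₁ d₂ d₃ = trans
    (cong (λ x → gen s ∙ (gen a ∙ x)) (trans (prod-++ (map (gen a ▷_) (map (gen s ▷_) (map gen d₁) ++ map gen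
        d₂)) (map gen d₃))
      (cong₂ _∙_ (trans (prod-▷ (gen a) (map (gen s ▷_) (map gen d₁) ++ map gen d₂))
          (cong (gen a ▷_) (trans (prod-++ (map (gen s ▷_) (map gen d₁)) (map gen d₂))
          (cong₂ _∙_ (trans (prod-▷ (gen s) (map gen d₁)) (cong (gen s ▷_) (prod-gen d₁))) (prod-gen d₂)))))
        (prod-gen d₃))))
    (trans (grp (y₀ ⊙ (y₁ ⊙ ((y₁ ▸ ((y₀ ▸ x₀) ⊙ x₁)) ⊙ x₂))) (x₀ ⊙ (y₀ ⊙ (x₁ ⊙ (y₁ ⊙ x₂))))
        (eval d₁ ∷ eval d₂ ∷ eval d₃ ∷ []) (geni s ∷ geni a ∷ []) refl)
      (sym (trans (eval-split d₁ s (d₂ ++ a ∷ d₃)) (cong (λ x → eval d₁ ∙ (gen s ∙ x)) (eval-split d₂ a d₃)))))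

  All-Refl-▷ : ∀ g {ts} → All Refl ts → All Refl (map (g ▷_) ts)
  All-Refl-▷ g rs = All.map⁺ (All.map (Refl-▷ g) rs)

  All-Refl-gen : ∀ w → All Refl (map gen w)
  All-Refl-gen w = All.map⁺ (All.tabulate λ {s} _ → Refl-gen s)

  pairFactors-Refl : ∀ s a d₁ d₂ d₃ → All Refl (pairFactors s a d₁ d₂ d₃)
  pairFactors-Refl s a d₁ d₂ d₃ = All.++⁺ (All-Refl-▷ (gen a) (All.++⁺ (All-Refl-▷ (gen s) (All-Refl-gen d₁))
      (All-Refl-gen d₂))) (All-Refl-gen d₃)

  length-pairFactors : ∀ s a d₁ d₂ d₃ → suc (suc (length (pairFactors s a d₁ d₂ d₃))) ≡ length
      (d₁ ++ s ∷ d₂ ++ a ∷ d₃)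
  length-pairFactors s a d₁ d₂ d₃ = trans (cong (λ k → suc (suc k)) (trans
      (trans (length-++ (map (gen a ▷_) (map (gen s ▷_) (map gen d₁) ++ map gen d₂)))
        (cong₂ ℕ._+_ (trans (length-map _ (map (gen s ▷_) (map gen d₁) ++ map gen d₂))
            (trans (length-++ (map (gen s ▷_) (map gen d₁)))
            (cong₂ ℕ._+_ (trans (length-map _ (map gen d₁)) (length-map gen d₁)) (length-map gen d₂))))
          (length-map gen d₃)))
      (ℕ.+-assoc (length d₁) (length d₂) (length d₃))))
    (trans (cong suc (sym (trans (cong (length d₁ ℕ.+_) (ℕ.+-suc (length d₂) (length d₃)))
        (ℕ.+-suc (length d₁) _))))
      (trans (sym (ℕ.+-suc (length d₁) _)) (sym
          (trans (length-++ d₁) (cong (λ k → length d₁ ℕ.+ suc k) (length-++ d₂))))))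

  -- The generating set is a parameter because the same theory is applied to W and to the parabolic
  -- subgroup W_⟨s⟩, with the letters of `c₁` as `base`.
  module Base (base : Word) (base-unique : Unique base) where

    IsCox : G → Set
    IsCox g = Σ Word λ c → (c ↭ base) × (eval c ≡ g)

    unique : ∀ {c} → c ↭ base → Unique c
    unique p = Unique-resp (↭-sym p) base-unique

    first : ∀ {g} → IsCox g → ∀ s → N g (gen s) ≡ true → Σ Word λ c₁ → (s ∷ c₁ ↭ base) × (eval (s ∷ c₁) ≡ g)
    first (c , p , refl) s e with initial-split c s (unique p) e
    ... | u , v , refl , cs = u ++ v , ↭-trans (↭-sym (shift s u v)) p , sym (eval-commute s u v cs)

    ∉-rest : ∀ {s c₁} → s ∷ c₁ ↭ base → s ∉ c₁
    ∉-rest p s∈ with unique p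
    ... | s∉ ∷ _ = All.lookup s∉ s∈ refl

    first-N : ∀ {s c₁} → s ∷ c₁ ↭ base → N (eval (s ∷ c₁)) (gen s) ≡ true
    first-N {s} {c₁} p = N-first s c₁ (∉-rest p)

    rotate-↭ : ∀ {s c₁} → s ∷ c₁ ↭ base → c₁ ++ [ s ] ↭ base
    rotate-↭ {s} {c₁} p = ↭-trans (++-comm c₁ [ s ]) p

    IsCox-rotate : ∀ {g} s → IsCox g → N g (gen s) ≡ true → IsCox (gen s ▷ g)
    IsCox-rotate s cg e with first cg s e
    ... | c₁ , p , refl = c₁ ++ [ s ] , rotate-↭ p , eval-rotate s c₁

    IsCox-Alt : ∀ {g A} → IsCox g → Alt g A → IsCox (eval A ⁻¹ ▷ g)
    IsCox-Alt {g} cg [] = subst IsCox (sym (1▷ g)) cg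
    IsCox-Alt {g} {s ∷ A} cg (a ∷ as) = subst IsCox (after g s A) (IsCox-Alt (IsCox-rotate s cg a) as)

    two-initial : ∀ {g} → IsCox g → ∀ s a → N g (gen s) ≡ true → N g (gen a) ≡ true → s ≢ a →
                  Comm s a × (N (gen s ▷ g) (gen a) ≡ true)
    two-initial {g} cg s a es ea s≢a with first cg s es
    ... | c₁ , p , refl with initial-split (s ∷ c₁) a (unique p) ea
    ...   | [] , v , refl , cs = ⊥-elim (s≢a refl)
    ...   | .s ∷ u , v , refl , c ∷ cs = sym c ,
            trans (cong (λ x → N x (gen a)) (trans (sym (eval-rotate s (u ++ a ∷ v)))
                (trans (cong eval (++-assoc u (a ∷ v) [ s ])) (eval-commute a u (v ++ [ s ]) cs))))
              (first-N (↭-trans (↭-sym (shift a u (v ++ [ s ])))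
                  (↭-trans (↭-reflexive (sym (++-assoc u (a ∷ v) [ s ]))) (rotate-↭ p))))

    -- Cancelling `s` leaves exactly as many reflections as `c₁` has letters, which is the equality
    -- case of `minimal-factorisation`.
    suffix-parabolic : ∀ {s c₁} → s ∷ c₁ ↭ base → ∀ t ts → All Refl (t ∷ ts) → suc (suc (length ts)) ≡ length
        base →
      gen s ∙ (t ∙ prod ts) ≡ eval (s ∷ c₁) → InW (_∈ c₁) t
    suffix-parabolic {s} {c₁} p t ts rs len e with unique p
    ... | _ ∷ uq = All.head (proj₂ (minimal-factorisation c₁ uq (t ∷ ts) rs (∙-cancelˡ (gen s)
        (trans e (eval-∷ s c₁))))
                     (ℕ.suc-injective (trans len (sym (↭-length p)))))

    -- If a is not a descent, rotate to the moment when the reflection inverted by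
    -- the descent s was the first letter z: then the reflection of a lies in the
    -- parabolic subgroup avoiding z, although it inverts z.
    descent-propagates : ∀ {g} → IsCox g → ∀ {A} → Alt g A → Reduced A → ∀ d₁ s d₂ a d₃ →
      d₁ ++ s ∷ d₂ ++ a ∷ d₃ ↭ base → eval (d₁ ++ s ∷ d₂ ++ a ∷ d₃) ≡ eval A ⁻¹ ▷ g → ¬ Comm s a →
      ν (eval A) (gen s) ≡ true → ν (eval A) (gen a) ≡ true
    descent-propagates {g} cg {A} as red d₁ s d₂ a d₃ p ed nc νs
      with ν (eval A) (gen a) in νa
    ... | true = refl
    ... | false with exchangeʳ A (gen s) νs
    ...   | A₁ , z , A₂ , refl , es with Alt-++⁻ʳ A₁ as
    ...     | az ∷ as₂ with first (IsCox-Alt cg (Alt-++⁻ˡ A₁ as)) z az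
    ...       | c₁ , pz , ec = ⊥-elim (∉-rest pz (InW-gen⁻ {_∈ c₁} (InW-ν t∈ inverted)))
      where
      u = eval A₂
      us≡zu : u ▷ gen s ≡ gen z
      us≡zu = trans (cong (u ▷_) es) (▷-cancel′ u (gen z))
      û = gen z ∙ u
      t = û ▷ gen a
      L = pairFactors s a d₁ d₂ d₃
      û▷s : û ▷ gen s ≡ gen z
      û▷s = trans (▷-∙ (gen z) u (gen s)) (trans (cong (gen z ▷_) us≡zu) (gen-▷-self z))
      -- The factorisation s a L of the current Coxeter element, conjugated by `û`, becomes one of
      -- the Coxeter element at the moment when `z` was read, and its first factor is `z`.
      cox-eq : gen z ∙ (t ∙ prod (map (û ▷_) L)) ≡ eval (z ∷ c₁)
      cox-eq = trans (cong₂ (λ x y → x ∙ (t ∙ y)) (sym û▷s) (prod-▷ û L))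
        (trans (grp ((x₀ ▸ y₀) ⊙ ((x₀ ▸ y₁) ⊙ (x₀ ▸ x₁))) (x₀ ▸ (y₀ ⊙ (y₁ ⊙ x₁))) (û ∷ prod L ∷ [])
            (geni s ∷ geni a ∷ []) refl)
        (trans (cong (û ▷_) (trans (prod-pairFactors s a d₁ d₂ d₃) ed))
        (trans (cong (λ x → û ▷ x ⁻¹ ▷ g) (eval-split A₁ z A₂))
        (trans (grp ((y₀ ⊙ x₀) ▸ (x₁ ⊙ (y₀ ⊙ x₀)) ⁱ ▸ x₂) (x₁ ⁱ ▸ x₂) (u ∷ eval A₁ ∷ g ∷ []) (geni z ∷ []) refl)
            (sym ec)))))
      t∈ : InW (_∈ c₁) t
      t∈ = suffix-parabolic pz t (map (û ▷_) L)
        (Refl-▷ û (Refl-gen a) ∷ All-Refl-▷ û (pairFactors-Refl s a d₁ d₂ d₃))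
        (trans (cong (λ k → suc (suc k)) (length-map (û ▷_) L))
            (trans (length-pairFactors s a d₁ d₂ d₃) (↭-length p))) cox-eq
      redz : Reduced (z ∷ A₂)
      redz = Reduced-++ʳ A₁ (z ∷ A₂) red
      ν-us : ν u (gen s) ≡ false
      ν-us = ν-false u (ℕ.≤-trans (ℓ-≤ A₂ refl)
          (ℕ.≤-trans (ℕ.n≤1+n _) (ℕ.≤-trans (ℕ.≤-reflexive (sym (ℓ-reduced redz)))
        (ℕ.≤-reflexive (cong ℓ (trans (eval-∷ z A₂)
            (trans (cong (_∙ u) (sym us≡zu)) (grp ((x₀ ▸ y₀) ⊙ x₀) (x₀ ⊙ y₀) (u ∷ []) (geni s ∷ []) refl))))))))
      a≢s : gen a ≢ gen s
      a≢s e = nc (cong₂ _∙_ (sym e) e)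
      -- If `u` inverted `a`, then z u a would be shorter than z u, and so the whole word followed
      -- by `a` would be too short for `a` to be an ascent.
      ν-ua : ν u (gen a) ≡ false
      ν-ua with ν u (gen a) in eq
      ... | false = refl
      ... | true = ⊥-elim (ℕ.<⇒≱ (ν-down û (gen a) down) (ℕ.≤-trans (ℕ.≤-reflexive
          (trans (cong ℓ (sym (eval-∷ z A₂))) (ℓ-reduced redz)))
            (ℕ.+-cancelˡ-≤ (length A₁) _ _ (ℕ.≤-trans (ℕ.≤-reflexive
                (trans (sym (length-++ A₁)) (sym (ℓ-reduced red))))
              (ℕ.≤-trans (ℕ.<⇒≤ (ν-up (eval (A₁ ++ z ∷ A₂)) (Refl-gen a) νa))
                (ℕ.≤-trans (ℓ-≤ (A₁ ++ word (û ∙ gen a))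
                    (trans (eval-++ A₁ _) (trans (cong (eval A₁ ∙_) (eval-word _))
                   (sym (trans (cong (_∙ gen a) (eval-split A₁ z A₂)) (assoc _ _ _))))))
                  (ℕ.≤-reflexive (length-++ A₁))))))))
        where
        down : ν û (gen a) ≡ true
        down = trans (ν-∙ (gen z) u (gen a)) (cong₂ _xor_ eq
          (ν-gen-≢ λ e → a≢s (▷-injective u (trans e (sym us≡zu)))))
      noDesc : ∀ l → (l ≡ s) ⊎ (l ≡ a) → ν u (gen l) ≡ false
      noDesc l (inj₁ refl) = ν-us
      noDesc l (inj₂ refl) = ν-ua
      inverted : ν t (gen z) ≡ true
      inverted = trans (cong₂ ν (trans (cong (_▷ gen a)
          (sym (trans (grp (x₀ ⊙ y₀) ((x₀ ▸ y₀) ⊙ x₀) (u ∷ []) (geni s ∷ []) refl) (cong (_∙ u) us≡zu))))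
          (▷-∙ u (gen s) (gen a))) (sym us≡zu))
        (ν-conjugate-minimal {λ l → (l ≡ s) ⊎ (l ≡ a)} u noDesc (inj₁ refl) (inj₂ refl) nc)

    -- Let `b` be the first letter of the current Coxeter word that is not a descent. The letters
    -- before it are descents, so by `descent-propagates` each of them commutes with `b`; thus `b`
    -- is initial and may be appended.
    extend : ∀ {g} → IsCox g → ∀ {A} → Alt g A → Reduced A →
      (∀ s → s ∈ base → ν (eval A) (gen s) ≡ true) ⊎
      (Σ (Fin n) λ b → Alt g (A ++ [ b ]) × Reduced (A ++ [ b ]))
    extend {g} cg {A} as red with IsCox-Alt cg as
    ... | d , p , ed with firstUp d
      where
      firstUp : ∀ d → All (λ s → ν (eval A) (gen s) ≡ true) d ⊎
        (Σ Word λ D → Σ (Fin n) λ b → Σ Word λ R → (d ≡ D ++ b ∷ R) × All (λ s → ν (eval A) (gen s) ≡ true) D ×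
            (ν (eval A) (gen b) ≡ false))
      firstUp [] = inj₁ []
      firstUp (b ∷ d) with ν (eval A) (gen b) in eq | firstUp d
      ... | false | _ = inj₂ ([] , b , d , refl , [] , eq)
      ... | true | inj₁ all = inj₁ (eq ∷ all)
      ... | true | inj₂ (D , b' , R , refl , all , eq') = inj₂ (b ∷ D , b' , R , refl , eq ∷ all , eq')
    ...   | inj₁ all = inj₁ λ s s∈ → All.lookup all (∈-resp-↭ (↭-sym p) s∈)
    ...   | inj₂ (D , b , R , refl , all , νb) = inj₂ (b , Alt-++⁺ as (init ∷ []) , reduced-∷ʳ A b red νb)
      where
      commutes : All (Comm b) D
      commutes = All.tabulate λ {s} s∈D → go s (Comm? s b) (∈-∃++ s∈D) (All.lookup all s∈D)
        where
        go : ∀ s → Dec (Comm s b) → (Σ Word λ D₁ → Σ Word λ D₂ → D ≡ D₁ ++ [ s ] ++ D₂) → ν (eval A) (gen s) ≡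
            true → Comm b s
        go s (yes c) _ _ = sym c
        go s (no nc) (D₁ , D₂ , eD) νs = ⊥-elim (true≢false
            (trans (sym (descent-propagates cg as red D₁ s D₂ b R
            (↭-trans (↭-reflexive (sym eq)) p) (trans (cong eval (sym eq)) ed) nc νs)) νb))
          where
          eq : D ++ b ∷ R ≡ D₁ ++ s ∷ D₂ ++ b ∷ R
          eq = trans (cong (_++ b ∷ R) eD) (++-assoc D₁ (s ∷ D₂) (b ∷ R))
      init : N (eval A ⁻¹ ▷ g) (gen b) ≡ true
      init = trans (cong (λ x → N x (gen b)) (trans (sym ed) (eval-commute b D R commutes)))
        (first-N (↭-trans (↭-sym (shift b D R)) p))

  -- The longest element

  open Base (allFin n) (allFin⁺ n)

  B : ℕ
  B = proj₁ fin

  ℓ≤B : ∀ g → ℓ g ≤ B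
  ℓ≤B g with proj₂ fin (rep g)
  ... | w , e , short = ℕ.≤-trans (ℓ-≤ w (trans (eval-cong e) (eval-rep g))) short

  AllDescents : G → Set
  AllDescents w = ∀ s → ν w (gen s) ≡ true

  last-descent : ∀ x → (x ≡ 1g) ⊎ (Σ (Fin n) λ l → ν x (gen l) ≡ true)
  last-descent x = go (word x) (word-reduced x) (eval-word x)
    where
    go : ∀ w → Reduced w → eval w ≡ x → (x ≡ 1g) ⊎ (Σ (Fin n) λ l → ν x (gen l) ≡ true)
    go w red ew with initLast w
    ... | [] = inj₁ (sym ew)
    ... | w' ∷ʳ′ l = inj₂ (l , ν-true x (Refl-gen l) (ℕ.≤-trans
          (ℓ-≤ w' (trans (grp x₀ ((x₀ ⊙ y₀) ⊙ y₀) (eval w' ∷ []) (geni l ∷ []) refl)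
            (cong (_∙ gen l) (trans (sym (eval-++ w' [ l ])) ew))))
          (ℕ.≤-trans (ℕ.m≤m+n (length w') 1) (ℕ.≤-reflexive (trans (sym (length-++ w'))
              (trans (sym (ℓ-reduced red)) (cong ℓ ew)))))))

  private
    -- Some element inverts every reflection, up to double negation: a reflection that is not
    -- inverted leads to a longer element, and lengths are bounded by `B`.
    maximal : ∀ k g → B ℕ.∸ ℓ g ≤ k → ((y : G) → (∀ r → Refl r → ν y r ≡ true) → ⊥) → ⊥
    maximal k g le K = K g (go k le)
      where
      go : ∀ k → B ℕ.∸ ℓ g ≤ k → ∀ r → Refl r → ν g r ≡ true
      go k le r rr with ν g r in e
      ... | true = refl
      go zero le r rr | false = ⊥-elim (ℕ.<⇒≱ (ℕ.<-≤-trans (ν-up g rr e) (ℓ≤B (g ∙ r)))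
          (ℕ.m∸n≡0⇒m≤n (ℕ.n≤0⇒n≡0 le)))
      go (suc k) le r rr | false = ⊥-elim (maximal k (g ∙ r)
        (ℕ.≤-pred (ℕ.<-≤-trans (ℕ.∸-monoʳ-< (ν-up g rr e) (ℓ≤B (g ∙ r))) le)) K)

  -- Compare with an element `y` that inverts everything. A descent of y⁻¹ w would be inverted twice
  -- in y (y⁻¹ w) = w and not be a descent of `w`; so y⁻¹ w has none and is trivial.
  allDescents-inverts : ∀ {w} → AllDescents w → ∀ {r} → Refl r → ν w r ≡ true
  allDescents-inverts {w} desc {r} rr with ν w r in e
  ... | true = refl
  ... | false = ⊥-elim (maximal _ w ℕ.≤-refl K)
    where
    K : (y : G) → (∀ r → Refl r → ν y r ≡ true) → ⊥
    K y max with last-descent (y ⁻¹ ∙ w)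
    ... | inj₁ e1 = true≢false (trans (sym (max r rr)) (trans (cong (λ z → ν z r)
            (trans (grp x₀ (x₀ ⊙ ι) (y ∷ []) [] refl)
                (trans (cong (y ∙_) (sym e1)) (grp (x₀ ⊙ (x₀ ⁱ ⊙ x₁)) x₁ (y ∷ w ∷ []) [] refl)))) e))
    ... | inj₂ (l , d) = true≢false (trans (sym (desc l))
        (trans (cong (λ z → ν z (gen l)) (grp x₁ (x₀ ⊙ (x₀ ⁱ ⊙ x₁)) (y ∷ w ∷ []) [] refl))
            (trans (ν-∙ y (y ⁻¹ ∙ w) (gen l)) (cong₂ _xor_ d (max _ (Refl-▷ _ (Refl-gen l)))))))

  allDescents-unique : ∀ {w w'} → AllDescents w → AllDescents w' → w ≡ w'
  allDescents-unique {w} {w'} d d' with last-descent (w ⁻¹ ∙ w')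
  ... | inj₁ e = trans (sym (idʳ w)) (trans (cong (w ∙_) (sym e)) (grp (x₀ ⊙ (x₀ ⁱ ⊙ x₁)) x₁ (w ∷ w' ∷ []) []
      refl))
  ... | inj₂ (l , e) = ⊥-elim (true≢false (trans (sym (d' l))
      (trans (cong (λ z → ν z (gen l)) (grp x₁ (x₀ ⊙ (x₀ ⁱ ⊙ x₁)) (w ∷ w' ∷ []) [] refl))
          (trans (ν-∙ w (w ⁻¹ ∙ w') (gen l)) (cong₂ _xor_ e (allDescents-inverts d (Refl-▷ _ (Refl-gen l))))))))

  ℓ-gen : ∀ g s → ℓ g ≤ suc (ℓ (g ∙ gen s))
  ℓ-gen g s = ℕ.≤-trans (ℓ-≤ (word (g ∙ gen s) ++ [ s ]) (trans (eval-++ _ [ s ])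
      (trans (cong (_∙ gen s) (eval-word _))
      (grp ((x₀ ⊙ y₀) ⊙ y₀) x₀ (g ∷ []) (geni s ∷ []) refl))))
    (ℕ.≤-reflexive (trans (length-++ (word (g ∙ gen s))) (ℕ.+-comm _ 1)))

  descent-length : ∀ g s → ν g (gen s) ≡ true → suc (ℓ (g ∙ gen s)) ≡ ℓ g
  descent-length g s e = ℕ.≤-antisym (ν-down g (gen s) e) (ℓ-gen g s)

  ℓ-complement : ∀ {w} → AllDescents w → ∀ u → Reduced u → ℓ (w ∙ eval (reverse u)) ℕ.+ length u ≡ ℓ w
  ℓ-complement {w} d [] red = trans (ℕ.+-identityʳ _) (cong ℓ (idʳ w))
  ℓ-complement {w} d (s ∷ u) red = trans (ℕ.+-suc _ (length u)) (trans (cong (ℕ._+ length u)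
      (trans (cong (λ x → suc (ℓ x)) (trans (cong (w ∙_) (trans (eval-reverse (s ∷ u))
          (trans (cong _⁻¹ (eval-∷ s u))
             (trans (grp ((y₀ ⊙ x₀) ⁱ) (x₀ ⁱ ⊙ y₀) (eval u ∷ []) (geni s ∷ []) refl)
                 (cong (_∙ gen s) (sym (eval-reverse u))))))) (sym (assoc _ _ _))))
        (descent-length (w ∙ eval (reverse u)) s inverted)))
    (ℓ-complement d u red'))
    where
    red' : Reduced u
    red' = Reduced-++ʳ [ s ] u red
    up : ν (eval (reverse u)) (gen s) ≡ false
    up = ν-false _ (ℕ.≤-trans (ℓ-≤ (reverse u) refl) (ℕ.≤-trans (ℕ.≤-reflexive (length-reverse u))
      (ℕ.≤-trans (ℕ.n≤1+n _) (ℕ.≤-reflexive (trans (sym (ℓ-reduced red)) (trans (sym (ℓ-⁻¹ _)) (cong ℓ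
        (trans (cong _⁻¹ (eval-∷ s u)) (trans (grp ((y₀ ⊙ x₀) ⁱ) (x₀ ⁱ ⊙ y₀) (eval u ∷ []) (geni s ∷ []) refl)
            (cong (_∙ gen s) (sym (eval-reverse u))))))))))))
    inverted : ν (w ∙ eval (reverse u)) (gen s) ≡ true
    inverted = trans (ν-∙ w (eval (reverse u)) (gen s))
        (cong₂ _xor_ up (allDescents-inverts d (Refl-▷ _ (Refl-gen s))))

  allDescents-ℓ : ∀ {w} → AllDescents w → ∀ x → ℓ (w ∙ x) ℕ.+ ℓ x ≡ ℓ w
  allDescents-ℓ {w} d x = trans (cong₂ ℕ._+_ (cong (λ y → ℓ (w ∙ y)) (sym
      (trans (eval-reverse _) (trans (cong _⁻¹ (eval-word (x ⁻¹))) (grp ((x₀ ⁱ) ⁱ) x₀ (x ∷ []) [] refl)))))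
      (sym (ℓ-⁻¹ x))) (ℓ-complement d (word (x ⁻¹)) (word-reduced _))

  allDescents-⁻¹ : ∀ {w} → AllDescents w → w ⁻¹ ≡ w
  allDescents-⁻¹ {w} d = allDescents-unique (λ s → trans (cong (ν (w ⁻¹)) (sym (▷-cancel′ w (gen s))))
    (trans (ν-⁻¹ w (w ⁻¹ ▷ gen s)) (allDescents-inverts d (Refl-▷ _ (Refl-gen s))))) d

  IsReduced⇒Reduced : ∀ {w} → IsReduced w → Reduced w
  IsReduced⇒Reduced red w' e = red w' (eval-sound e)

  Reduced⇒IsReduced : ∀ {w} → Reduced w → IsReduced w
  Reduced⇒IsReduced red w' e = red w' (eval-cong e)

  longest⇒allDescents : ∀ {w} → IsLongest w → AllDescents (eval w)
  longest⇒allDescents {w} (red , max) s with ν (eval w) (gen s) in e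
  ... | true = refl
  ... | false = ⊥-elim (ℕ.<⇒≱ (ℕ.≤-reflexive (trans (ℕ.+-comm 1 (length w)) (sym (length-++ w))))
        (max (w ++ [ s ]) (Reduced⇒IsReduced (reduced-∷ʳ w s (IsReduced⇒Reduced red) e))))

  allDescents⇒longest : ∀ {w} → Reduced w → AllDescents (eval w) → IsLongest w
  allDescents⇒longest {w} red d = Reduced⇒IsReduced red , λ u ru → ℕ.≤-trans
      (ℕ.≤-reflexive (sym (ℓ-reduced (IsReduced⇒Reduced ru))))
    (ℕ.≤-trans (ℕ.m≤n+m _ _) (ℕ.≤-reflexive (trans (allDescents-ℓ d (eval u)) (ℓ-reduced red))))

  -- Apply ℓ(w x) = ℓ(w) - ℓ(x) to x = s w, whose length is ℓ(w) - 1: the conjugate of `s` has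
  -- length one.
  opposite : ∀ {w} → AllDescents w → ∀ s → Σ (Fin n) λ t → gen t ≡ w ▷ gen s
  opposite {w} d s = go (word (w ▷ gen s)) (eval-word _) one
    where
    shorter : suc (ℓ (gen s ∙ w)) ≡ ℓ w
    shorter = trans (cong suc (trans (sym (ℓ-⁻¹ _))
        (cong ℓ (trans (grp ((y₀ ⊙ x₀) ⁱ) (x₀ ⁱ ⊙ y₀) (w ∷ []) (geni s ∷ []) refl)
        (cong (_∙ gen s) (allDescents-⁻¹ d))))))
      (descent-length w s (d s))
    one : ℓ (w ▷ gen s) ≡ 1
    one = ℕ.+-cancelʳ-≡ (ℓ (gen s ∙ w)) (ℓ (w ▷ gen s)) 1 (trans
      (trans (cong (λ x → ℓ (w ∙ (gen s ∙ x)) ℕ.+ ℓ (gen s ∙ w)) (allDescents-⁻¹ d))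
          (allDescents-ℓ d (gen s ∙ w))) (sym shorter))
    go : ∀ u → eval u ≡ w ▷ gen s → length u ≡ 1 → Σ (Fin n) λ t → gen t ≡ w ▷ gen s
    go (t ∷ []) e _ = t , e

  longest-Alt : ∀ {g} → IsCox g → Σ Word λ A → Alt g A × Reduced A × AllDescents (eval A)
  longest-Alt {g} cg = go (suc B) [] [] (λ _ _ → z≤n) (ℕ.≤-refl)
    where
    go : ∀ k A → Alt g A → Reduced A → B < length A ℕ.+ k → Σ Word λ A → Alt g A × Reduced A × AllDescents
        (eval A)
    go zero A as red lt = ⊥-elim (ℕ.<⇒≱ (subst (B <_) (ℕ.+-identityʳ _) lt)
        (ℕ.≤-trans (ℕ.≤-reflexive (sym (ℓ-reduced red))) (ℓ≤B _)))
    go (suc k) A as red lt with extend cg as red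
    ... | inj₁ d = A , as , red , λ s → d s (∈-allFin s)
    ... | inj₂ (b , as' , red') = go k (A ++ [ b ]) as' red' (subst (B <_)
          (trans (ℕ.+-suc _ k) (trans (cong (ℕ._+ k) (ℕ.+-comm 1 (length A)))
              (cong (ℕ._+ k) (sym (length-++ A))))) lt)

  -- The two factors `w` each flip the sign once. Hence conjugation by w∘ preserves initial letters
  -- and takes alternating words to alternating words.
  N-▷-longest : ∀ {w} → AllDescents w → ∀ g s → N (w ▷ g) (w ▷ gen s) ≡ N g (gen s)
  N-▷-longest {w} d g s = trans (N-∙ w (g ∙ w ⁻¹) (w ▷ gen s)) (trans (cong₂ _xor_ (trans (N-▷ w (gen s)) (d s))
      (trans (cong (N (g ∙ w ⁻¹)) (▷-cancel w (gen s))) (trans (N-∙ g (w ⁻¹) (gen s))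
        (cong (N g (gen s) xor_) (allDescents-inverts d (Refl-▷ _ (Refl-gen s)))))))
    (lemma (N g (gen s))))
    where
    lemma : ∀ b → true xor (b xor true) ≡ b
    lemma true = refl
    lemma false = refl

  Alt-▷ : ∀ {w} → AllDescents w → ∀ {σ} → (∀ s → gen (σ s) ≡ w ▷ gen s) → ∀ {g A} → Alt g A → Alt (w ▷ g)
      (map σ A)
  Alt-▷ d eσ [] = []
  Alt-▷ {w} d {σ} eσ {g} {s ∷ A} (a ∷ as) = trans (cong (N (w ▷ g)) (eσ s)) (trans (N-▷-longest d g s) a) ∷
    subst (λ x → Alt x (map σ A)) (trans (grp (x₀ ▸ (y₀ ▸ x₁)) ((x₀ ▸ y₀) ▸ (x₀ ▸ x₁)) (w ∷ g ∷ [])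
        (geni s ∷ []) refl) (cong (_▷ w ▷ g) (sym (eσ s)))) (Alt-▷ d eσ as)

  -- Commutation classes of words

  infix 4 _∼_
  data _∼_ : Word → Word → Set where
    ∼-refl  : ∀ {w} → w ∼ w
    ∼-swap  : ∀ {a b} w → Comm a b → a ∷ b ∷ w ∼ b ∷ a ∷ w
    ∼-cons  : ∀ s {w w'} → w ∼ w' → s ∷ w ∼ s ∷ w'
    ∼-trans : ∀ {u v w} → u ∼ v → v ∼ w → u ∼ w

  ∼-sym : ∀ {u v} → u ∼ v → v ∼ u
  ∼-sym ∼-refl = ∼-refl
  ∼-sym (∼-swap w c) = ∼-swap w (sym c)
  ∼-sym (∼-cons s e) = ∼-cons s (∼-sym e)
  ∼-sym (∼-trans e f) = ∼-trans (∼-sym f) (∼-sym e)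

  ∼-++ʳ : ∀ {u v} w → u ∼ v → u ++ w ∼ v ++ w
  ∼-++ʳ w ∼-refl = ∼-refl
  ∼-++ʳ w (∼-swap u c) = ∼-swap (u ++ w) c
  ∼-++ʳ w (∼-cons s e) = ∼-cons s (∼-++ʳ w e)
  ∼-++ʳ w (∼-trans e f) = ∼-trans (∼-++ʳ w e) (∼-++ʳ w f)

  ∼-++ˡ : ∀ u {v w} → v ∼ w → u ++ v ∼ u ++ w
  ∼-++ˡ [] e = e
  ∼-++ˡ (s ∷ u) e = ∼-cons s (∼-++ˡ u e)

  ∼-eval : ∀ {u v} → u ∼ v → eval u ≡ eval v
  ∼-eval ∼-refl = refl
  ∼-eval (∼-swap {a} {b} w c) = eval-commute b [ a ] w (sym c ∷ [])
  ∼-eval (∼-cons s {w} {w'} e) = trans (eval-∷ s w) (trans (cong (gen s ∙_) (∼-eval e)) (sym (eval-∷ s w')))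
  ∼-eval (∼-trans e f) = trans (∼-eval e) (∼-eval f)

  ∼-length : ∀ {u v} → u ∼ v → length u ≡ length v
  ∼-length ∼-refl = refl
  ∼-length (∼-swap w c) = refl
  ∼-length (∼-cons s e) = cong suc (∼-length e)
  ∼-length (∼-trans e f) = trans (∼-length e) (∼-length f)

  ∼-front : ∀ s u v → All (Comm s) u → u ++ s ∷ v ∼ s ∷ u ++ v
  ∼-front s [] v [] = ∼-refl
  ∼-front s (b ∷ u) v (c ∷ cs) = ∼-trans (∼-cons b (∼-front s u v cs)) (∼-swap (u ++ v) (sym c))

  Unique-∼ : ∀ {u v} → Unique u → Unique v → eval u ≡ eval v → u ∼ v
  Unique-∼ {[]} uq uq' e rewrite eval-Unique-1 _ uq' (sym e) = ∼-refl
  Unique-∼ {s ∷ u} {v} (s∉u ∷ uq) uq' e with initial-split v s uq'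
      (trans (cong (λ x → N x (gen s)) (sym e)) (N-first s u (λ p → All.lookup s∉u p refl)))
  ... | x , y , refl , cs = ∼-trans (∼-cons s (Unique-∼ uq (Unique-delete x uq')
          (∙-cancelˡ (gen s) (trans (sym (eval-∷ s u))
              (trans e (trans (eval-commute s x y cs) (eval-∷ s (x ++ y))))))))
        (∼-sym (∼-front s x y cs))

  ▷-swap : ∀ {s a} g → Comm s a → gen s ▷ gen a ▷ g ≡ gen a ▷ gen s ▷ g
  ▷-swap {s} {a} g c = trans (sym (▷-∙ (gen s) (gen a) g)) (trans (cong (_▷ g) c) (▷-∙ (gen a) (gen s) g))

  -- As long as `s` has not been read it stays initial, and two initial letters commute, so the
  -- first occurrence of `s` can move past everything before it.
  Alt-front : ∀ {g} → IsCox g → ∀ {s A} → Alt g A → N g (gen s) ≡ true → s ∈ A → Σ Word λ A₁ → (A ∼ s ∷ A₁) ×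
      Alt (gen s ▷ g) A₁
  Alt-front {g} cg {s} {a ∷ A} (ea ∷ as) es s∈ with s ≟ a
  ... | yes refl = A , ∼-refl , as
  Alt-front cg {s} (ea ∷ as) es (here s≡a) | no s≢a = ⊥-elim (s≢a s≡a)
  Alt-front {g} cg {s} {a ∷ A} (ea ∷ as) es (there s∈) | no s≢a
    with two-initial cg s a es ea s≢a | two-initial cg a s ea es (λ e → s≢a (sym e))
  ... | c , ea' | _ , es' with Alt-front (IsCox-rotate a cg ea) as es' s∈
  ...   | A₁ , e , as₁ = a ∷ A₁ , ∼-trans (∼-cons a e) (∼-swap A₁ (sym c)) ,
          ea' ∷ subst (λ x → Alt x A₁) (▷-swap g c) as₁

  -- An initial letter that is never used blocks all its neighbours.
  Alt-absent : ∀ {g} → IsCox g → ∀ {s A} → Alt g A → N g (gen s) ≡ true → s ∉ A → Alt (gen s ▷ g) A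
  Alt-absent cg [] es s∉ = []
  Alt-absent {g} cg {s} {a ∷ A} (ea ∷ as) es s∉
    with two-initial cg s a es ea (λ e → s∉ (here e)) | two-initial cg a s ea es (λ e → s∉ (here (sym e)))
  ... | c , ea' | _ , es' = ea' ∷ subst (λ x → Alt x A) (▷-swap g c) (Alt-absent (IsCox-rotate a cg ea) as es'
      (λ p → s∉ (there p)))

  -- The lexicographically first subword w∘(c)

  CycAt⇒Cyc : ∀ c p t → CycAt c p t → Cyc c p t
  CycAt⇒Cyc c p t (R , i , refl , e) = subst (λ X → X) (sym (trans (Cyc-period c R (toℕ i) t)
    (trans (cong (λ c' → Cyc c' (toℕ i) t) (sym (++-identityʳ c))) (Cyc-lookup [] c i t)))) e

  Cyc⇒CycAt : ∀ c p t → Cyc c p t → CycAt c p t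
  Cyc⇒CycAt (x ∷ c₁) p t e = p / L , i , eq , subst (λ X → X) (trans (trans (cong (λ q → Cyc c q t) eq)
      (Cyc-period c (p / L) (toℕ i) t)) (trans (cong (λ c' → Cyc c' (toℕ i) t) (sym (++-identityʳ c)))
          (Cyc-lookup [] c i t))) e
    where
    c = x ∷ c₁
    L = length c
    i = Fin.fromℕ< (m%n<n p L)
    eq : p ≡ p / L ℕ.* L ℕ.+ toℕ i
    eq = trans (m≡m%n+[m/n]*n p L) (trans (ℕ.+-comm (p % L) _)
        (cong (p / L ℕ.* L ℕ.+_) (sym (toℕ-fromℕ< (m%n<n p L)))))

  Cyc-functional : ∀ (c : Word) p {t t'} → Cyc c p t → Cyc c p t' → t ≡ t'
  Cyc-functional (s ∷ c) zero refl refl = refl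
  Cyc-functional (s ∷ c) (suc p) e e' = Cyc-functional (c ++ [ s ]) p e e'

  module _ (At : ℕ → Fin n → Set) where
    Sub : ℕ → G → List ℕ → Word → Set
    Sub k x ps q = Linked _<_ ps × All (k ≤_) ps × Pointwise At ps q × Reduced q × (eval q ≡ x)

    First : ℕ → Word → Set
    First k A = Σ (List ℕ) λ ps → Σ Word λ q → Sub k (eval A) ps q × (q ∼ A) ×
      (∀ ps' q' → Sub k (eval A) ps' q' → (ps ≡ ps') ⊎ LexLt ps ps')

    first-empty : ∀ k → First k []
    first-empty k = [] , [] , ([] , [] , [] , (λ _ _ → z≤n) , refl) , ∼-refl , only
      where
      only : ∀ ps' q' → Sub k (eval []) ps' q' → ([] ≡ ps') ⊎ LexLt [] ps'
      only .[] .[] (_ , _ , [] , _) = inj₁ refl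
      only .(_ ∷ _) .(_ ∷ _) (_ , _ , (_ ∷ _) , red , e) = ⊥-elim (ℕ.n≮0 (red [] (sym e)))

    -- A competitor that skips position `k` is lexicographically larger at once; one that uses it
    -- also starts with `s`, and the comparison passes to the tails.
    first-take : ∀ k s A A₁ → At k s → (∀ {t} → At k t → t ≡ s) → Reduced A → A ∼ s ∷ A₁ → First (suc k)
        A₁ → First k A
    first-take k s A A₁ at only red A∼ (ps , q , (lk , ge , pt , rq , eq) , q∼ , least) =
      k ∷ ps , s ∷ q , (linked lk ge , ℕ.≤-refl ∷ All.map ℕ.<⇒≤ ge , at ∷ pt , red' , ev) , sq∼A , least'
      where
      sq∼A : s ∷ q ∼ A
      sq∼A = ∼-trans (∼-cons s q∼) (∼-sym A∼)
      ev : eval (s ∷ q) ≡ eval A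
      ev = ∼-eval sq∼A
      red' : Reduced (s ∷ q)
      red' w' e = subst (_≤ length w') (sym (∼-length sq∼A)) (red w' (trans e ev))
      linked : ∀ {ps} → Linked _<_ ps → All (suc k ≤_) ps → Linked _<_ (k ∷ ps)
      linked [] [] = [-]
      linked [-] (p ∷ []) = p ∷ [-]
      linked (x ∷ lk) (p ∷ ps) = p ∷ x ∷ lk
      least' : ∀ ps' q' → Sub k (eval A) ps' q' → (k ∷ ps ≡ ps') ⊎ LexLt (k ∷ ps) ps'
      least' .[] .[] (_ , _ , [] , _ , e) = ⊥-elim (ℕ.n≮0 (subst (_≤ 0) (∼-length A∼) (red [] e)))
      least' (p ∷ ps') (t ∷ q') (lk' , ge' ∷ _ , at' ∷ pt' , rq' , e') with ℕ.m≤n⇒m<n∨m≡n ge'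
      ... | inj₁ k<p = inj₂ (inj₁ k<p)
      ... | inj₂ refl with only at'
      ...   | refl with least ps' q' (Linked.tail lk' , above , pt' , Reduced-++ʳ [ s ] q' rq' ,
                (∙-cancelˡ (gen s) (trans (sym (eval-∷ s q')) (trans e' (trans (∼-eval A∼) (eval-∷ s A₁))))))
        where
        above : All (suc k ≤_) ps'
        above with Linked⇒AllPairs ℕ.<-trans lk'
        ... | a ∷ _ = a
      ...     | inj₁ refl = inj₁ refl
      ...     | inj₂ lt = inj₂ (inj₂ (refl , lt))

    -- A reduced competitor using position `k` would have `s` as an inversion, which forces `s` into
    -- the support of `A`.
    first-skip : ∀ k s A → (∀ {t} → At k t → t ≡ s) → s ∉ A → First (suc k) A → First k A
    first-skip k s A only s∉A (ps , q , (lk , ge , rest) , q∼ , least) =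
      ps , q , (lk , All.map ℕ.<⇒≤ ge , rest) , q∼ , λ ps' q' sub → least ps' q' (above sub)
      where
      above : ∀ {ps' q'} → Sub k (eval A) ps' q' → Sub (suc k) (eval A) ps' q'
      above (lk' , [] , [] , rest') = lk' , [] , [] , rest'
      above {p ∷ ps'} {t ∷ q'} (lk' , ge' ∷ _ , at' ∷ pt' , rq' , e') with ℕ.m≤n⇒m<n∨m≡n ge'
      ... | inj₁ k<p = lk' , k<p ∷ above' , at' ∷ pt' , rq' , e'
        where
        above' : All (suc k ≤_) ps'
        above' with Linked⇒AllPairs ℕ.<-trans lk'
        ... | a ∷ _ = All.map (λ p<x → ℕ.<-trans k<p p<x) a
      ... | inj₂ refl with only at'
      ...   | refl = ⊥-elim (s∉A (InW-gen⁻ {_∈ A} (InW-N (A , refl , All.tabulate λ z → z)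
              (trans (cong (λ x → N x (gen s)) (sym e')) (N-true (eval (s ∷ q')) (Refl-gen s)
                (ℕ.≤-trans (ℓ-≤ q' (trans (grp x₀ (y₀ ⊙ (y₀ ⊙ x₀)) (eval q' ∷ []) (geni s ∷ []) refl)
                    (cong (gen s ∙_) (sym (eval-∷ s q')))))
                  (ℕ.≤-trans (ℕ.n≤1+n _) (ℕ.≤-reflexive (sym (ℓ-reduced rq'))))))))))

    Reads : ℕ → Word → Set
    Reads k c = ∀ j t → (At (k ℕ.+ j) t → Cyc c j t) × (Cyc c j t → At (k ℕ.+ j) t)

    reads-next : ∀ {k s c} → Reads k (s ∷ c) → Reads (suc k) (c ++ [ s ])
    reads-next {k} r j t = (λ a → proj₁ (r (suc j) t) (subst (λ p → At p t) (sym (ℕ.+-suc k j)) a)) ,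
                           (λ e → subst (λ p → At p t) (ℕ.+-suc k j) (proj₂ (r (suc j) t) e))

    reads-here : ∀ {k s c} → Reads k (s ∷ c) → At k s × (∀ {t} → At k t → t ≡ s)
    reads-here {k} {s} r = subst (λ p → At p s) (ℕ.+-identityʳ k) (proj₂ (r 0 s) refl) ,
      λ {t} a → sym (proj₁ (r 0 t) (subst (λ p → At p t) (sym (ℕ.+-identityʳ k)) a))

    -- Reading the letters of c cyclically, the greedy subword for eval A is A up
    -- to commutations: a letter is skipped exactly when A does not contain it.
    Greedy : ℕ → Set
    Greedy L = ∀ A k c → length A ≡ L → Reads k c → c ↭ allFin n → Alt (eval c) A → Reduced A → First k A

    -- `pre` lists the letters to be read before the head `b` of the alternating word; skipping
    -- shortens `pre`, so a letter is taken at `b` at the latest.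
    greedy-step : ∀ L → Greedy L → ∀ pre {b A} k post → length (b ∷ A) ≡ suc L → Reads k (pre ++ b ∷ post) →
      pre ++ b ∷ post ↭ allFin n → Alt (eval (pre ++ b ∷ post)) (b ∷ A) → Reduced (b ∷ A) → First k (b ∷ A)
    greedy-step L rec [] {b} {A} k post len r p (_ ∷ as) red =
      first-take k b (b ∷ A) A (proj₁ (reads-here r)) (proj₂ (reads-here r)) red ∼-refl
        (rec A (suc k) (post ++ [ b ]) (ℕ.suc-injective len) (reads-next r) (rotate-↭ p)
          (subst (λ g → Alt g A) (sym (eval-rotate b post)) as) (Reduced-++ʳ [ b ] A red))
    greedy-step L rec (s ∷ pre) {b} {A} k post len r p as red with DecMem._∈?_ _≟_ s (b ∷ A)
    ... | no s∉ = first-skip k s (b ∷ A) (proj₂ (reads-here r)) s∉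
          (greedy-step L rec pre (suc k) (post ++ [ s ]) len (subst (Reads (suc k)) e (reads-next r))
            (↭-trans (↭-reflexive (sym e)) (rotate-↭ p))
            (subst (λ g → Alt g (b ∷ A)) (trans (sym (eval-rotate s (pre ++ b ∷ post))) (cong eval e))
              (Alt-absent (_ , p , refl) as (first-N p) s∉)) red)
      where
      e : (pre ++ b ∷ post) ++ [ s ] ≡ pre ++ b ∷ post ++ [ s ]
      e = ++-assoc pre (b ∷ post) [ s ]
    ... | yes s∈ with Alt-front (_ , p , refl) as (first-N p) s∈
    ...   | A₁ , A∼ , as₁ = first-take k s (b ∷ A) A₁ (proj₁ (reads-here r)) (proj₂ (reads-here r)) red A∼
            (rec A₁ (suc k) ((pre ++ b ∷ post) ++ [ s ]) (ℕ.suc-injective (trans (sym (∼-length A∼)) len))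
                (reads-next r) (rotate-↭ p)
              (subst (λ g → Alt g A₁) (sym (eval-rotate s (pre ++ b ∷ post))) as₁) red₁)
      where
      red₁ : Reduced A₁
      red₁ = Reduced-++ʳ [ s ] A₁ (λ w' e → subst (_≤ length w') (∼-length A∼) (red w'
          (trans e (sym (∼-eval A∼)))))

    greedy : ∀ L → Greedy L
    greedy zero [] k c len r p as red = first-empty k
    greedy (suc L) (b ∷ A) k c len r p as red with ∈-∃++ (∈-resp-↭ (↭-sym p) (∈-allFin b))
    ... | pre , post , refl = greedy-step L (greedy L) pre k post len r p as red

  W0c-exists : ∀ {c} → CoxWord c → ∀ {A} → Alt (eval c) A → Reduced A → ∀ {w0} → eval w0 ≡ eval A →
               Σ Word λ q → W0c c w0 q × (q ∼ A)
  W0c-exists {c} p {A} as red {w0} e with greedy (CycAt c) _ A 0 c refl (λ j t → CycAt⇒Cyc c j t , Cyc⇒CycAt c j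
      t) p as red
  ... | ps , q , (lk , _ , pt , rq , eq) , q∼ , least = q ,
        (ps , (lk , pt , Reduced⇒IsReduced rq , eval-sound (trans eq (sym e))) ,
         λ ps' q' (lk' , pt' , rq' , e') → least ps' q' (lk' , All.tabulate (λ _ → z≤n) , pt' ,
             IsReduced⇒Reduced rq' , trans (eval-cong e') e)) , q∼

  -- Each position list competes with the other, so asymmetry of the lexicographic order makes them
  -- equal, and positions determine the letters.
  W0c-unique : ∀ {c w0 w0' q q'} → w0 ≈ w0' → W0c c w0 q → W0c c w0' q' → q ≡ q'
  W0c-unique {c} e (ps , v@(_ , pt , _) , least) (ps' , v'@(_ , pt' , _) , least') =
    same pt (subst (λ ps → Pointwise (CycAt c) ps _) (sym (positions (least ps' _ (move (≈-sym e) v'))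
        (least' ps _ (move e v)))) pt')
    where
    move : ∀ {w w' ps q} → w ≈ w' → ValidSub c w ps q → ValidSub c w' ps q
    move e (a , b , r , eq) = a , b , r , ≈-trans eq e
    same : ∀ {ps q q'} → Pointwise (CycAt c) ps q → Pointwise (CycAt c) ps q' → q ≡ q'
    same [] [] = refl
    same {p ∷ _} (a ∷ as) (b ∷ bs) = cong₂ _∷_ (Cyc-functional c p (CycAt⇒Cyc c p _ a) (CycAt⇒Cyc c p _ b))
        (same as bs)
    positions : ∀ {ps ps'} → (ps ≡ ps') ⊎ LexLt ps ps' → (ps' ≡ ps) ⊎ LexLt ps' ps → ps ≡ ps'
    positions (inj₁ e) _ = e
    positions (inj₂ _) (inj₁ e) = sym e
    positions (inj₂ p) (inj₂ q) = ⊥-elim (LexLt-asym p q)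

  -- Coloured roots and labels of positions

  Root : Set
  Root = G × ℕ

  act : Fin n → Root → Root
  act s (t , k) with t ≟ gen s
  ... | yes _ = gen s , suc k
  ... | no _ = gen s ▷ t , k

  act-self : ∀ s k → act s (gen s , k) ≡ (gen s , suc k)
  act-self s k with gen s ≟ gen s
  ... | yes _ = refl
  ... | no ne = ⊥-elim (ne refl)

  act-other : ∀ s t k → t ≢ gen s → act s (t , k) ≡ (gen s ▷ t , k)
  act-other s t k ne with t ≟ gen s
  ... | yes e = ⊥-elim (ne e)
  ... | no _ = refl

  act-▷ : ∀ s x → proj₁ (act s x) ≡ gen s ▷ proj₁ x
  act-▷ s (t , k) with t ≟ gen s
  ... | yes refl = sym (gen-▷-self s)
  ... | no _ = refl

  apply : Word → Root → Root
  apply [] x = x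
  apply (s ∷ u) x = act s (apply u x)

  apply-▷ : ∀ u x → proj₁ (apply u x) ≡ eval u ▷ proj₁ x
  apply-▷ [] (t , k) = grp x₀ (ι ▸ x₀) (t ∷ []) [] refl
  apply-▷ (s ∷ u) x = trans (act-▷ s (apply u x)) (trans (cong (gen s ▷_) (apply-▷ u x))
    (trans (sym (▷-∙ (gen s) (eval u) (proj₁ x))) (cong (_▷ proj₁ x) (sym (eval-∷ s u)))))

  apply-++ : ∀ u v x → apply (u ++ v) x ≡ apply u (apply v x)
  apply-++ [] v x = refl
  apply-++ (s ∷ u) v x = cong (act s) (apply-++ u v x)

  bump : Bool → ℕ → ℕ
  bump true k = suc k
  bump false k = k

  -- The colour rises whenever the root equals the acting simple root, that is, when its sign
  -- changes. Along a reduced word this happens at most once, and exactly when `u` inverts `t`.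
  apply-reduced : ∀ u → Reduced u → ∀ t k → apply u (t , k) ≡ (eval u ▷ t , bump (ν (eval u) t) k)
  apply-reduced [] red t k = cong₂ _,_ (grp x₀ (ι ▸ x₀) (t ∷ []) [] refl) (cong (λ b → bump b k) (sym (ν-1 t)))
  apply-reduced (s ∷ u) red t k = trans (cong (act s) (apply-reduced u red' t k))
      (trans (go (eval u ▷ t ≟ gen s))
      (cong (λ x → (x ▷ t , bump (ν x t) k)) (sym (eval-∷ s u))))
    where
    red' : Reduced u
    red' = Reduced-++ʳ [ s ] u red
    go : Dec (eval u ▷ t ≡ gen s) → act s (eval u ▷ t , bump (ν (eval u) t) k) ≡ ((gen s ∙ eval u) ▷ t , bump
        (ν (gen s ∙ eval u) t) k)
    go (yes e) = trans (cong (λ x → act s (x , bump (ν (eval u) t) k)) e) (trans (act-self s _)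
      (cong₂ _,_ (trans (sym (gen-▷-self s)) (trans (cong (gen s ▷_) (sym e)) (sym (▷-∙ (gen s) (eval u) t))))
        (trans (cong (λ b → suc (bump b k)) positive)
            (cong (λ b → bump b k) (sym (trans (ν-∙ (gen s) (eval u) t)
          (cong₂ _xor_ positive (trans (cong (ν (gen s)) e) (ν-gen-self s)))))))))
      where
      positive : ν (eval u) t ≡ false
      positive with ν (eval u) t in eq
      ... | false = refl
      ... | true = ⊥-elim (ℕ.<⇒≱ (ℕ.<-≤-trans (N-down (eval u) (gen s) (trans (cong (N (eval u)) (sym e))
          (trans (N-▷ (eval u) t) eq)))
              (ℓ-≤ u refl)) (ℕ.≤-trans (ℕ.n≤1+n _) (ℕ.≤-reflexive (trans (sym (ℓ-reduced red))
                  (cong ℓ (eval-∷ s u))))))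
    go (no ne) = trans (act-other s _ _ ne) (cong₂ _,_ (sym (▷-∙ (gen s) (eval u) t))
      (cong (λ b → bump b k) (sym (trans (ν-∙ (gen s) (eval u) t)
          (trans (cong (ν (eval u) t xor_) (ν-gen-≢ ne)) (𝔹.xor-identityʳ _))))))

  labelsC : Word → List Root
  labelsC = map (λ s → gen s , m)

  labelsQ : Word → List Root
  labelsQ [] = []
  labelsQ (t ∷ Q) = (gen t , 0) ∷ map (act t) (labelsQ Q)

  labels : Word → Word → List Root
  labels c Q = labelsC c ++ labelsQ Q

  labelsQ-++ : ∀ u v → labelsQ (u ++ v) ≡ labelsQ u ++ map (apply u) (labelsQ v)
  labelsQ-++ [] v = sym (map-id (labelsQ v))
  labelsQ-++ (t ∷ u) v = cong ((gen t , 0) ∷_) (trans (cong (map (act t)) (labelsQ-++ u v))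
    (trans (map-++ (act t) (labelsQ u) _) (cong (map (act t) (labelsQ u) ++_) (sym (map-∘ (labelsQ v))))))

  ∈-labelsQ : ∀ Q {x} → x ∈ labelsQ Q → Σ Word λ u → Σ (Fin n) λ r → Σ Word λ v → (Q ≡ u ++ r ∷ v) ×
      (x ≡ apply u (gen r , 0))
  ∈-labelsQ (t ∷ Q) (here refl) = [] , t , Q , refl , refl
  ∈-labelsQ (t ∷ Q) (there p) with ∈-map⁻ (act t) p
  ... | y , y∈ , refl with ∈-labelsQ Q y∈
  ...   | u , r , v , refl , refl = t ∷ u , r , v , refl , refl

  -- Faces under commutations

  data Marked : List Root → List Bool → Root → Set where
    here  : ∀ {x ls I} → Marked (x ∷ ls) (true ∷ I) x
    there : ∀ {x y b ls I} → Marked ls I x → Marked (y ∷ ls) (b ∷ I) x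

  Marked-map⁺ : ∀ (f : Root → Root) {ls I x} → Marked ls I x → Marked (map f ls) I (f x)
  Marked-map⁺ f here = here
  Marked-map⁺ f (there p) = there (Marked-map⁺ f p)

  Marked-map⁻ : ∀ (f : Root → Root) ls {I x} → Marked (map f ls) I x → Σ Root λ y → (x ≡ f y) × Marked ls I y
  Marked-map⁻ f (y ∷ ls) here = y , refl , here
  Marked-map⁻ f (y ∷ ls) (there p) with Marked-map⁻ f ls p
  ... | z , e , q = z , e , there q

  Marked-∈ : ∀ {ls I x} → Marked ls I x → x ∈ ls
  Marked-∈ here = here refl
  Marked-∈ (there p) = there (Marked-∈ p)

  -- Commutations permute the positions but leave each label with its letter. A face depends only on
  -- what is preserved here: the length and the product of the complement, and the marked labels.
  record Transport (F : Word) (L : List Root) (F' : Word) (L' : List Root) : Set where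
    field
      move : ∀ I → length I ≡ length F → Σ (List Bool) λ I' → (length I' ≡ length F') ×
        (length (outside F' I') ≡ length (outside F I)) × (eval (outside F' I') ≡ eval (outside F I)) ×
        (∀ {x} → Marked L I x → Marked L' I' x)

  open Transport public

  transport-refl : ∀ {F L} → Transport F L F L
  transport-refl .move I len = I , len , refl , refl , λ p → p

  transport-trans : ∀ {F L F' L' F″ L″} → Transport F L F' L' → Transport F' L' F″ L″ → Transport F L F″ L″
  transport-trans f g .move I len with move f I len
  ... | I' , len' , o , e , mk₁ with move g I' len'
  ...   | I″ , len″ , o' , e' , mk₂ = I″ , len″ , trans o' o , trans e' e , λ p → mk₂ (mk₁ p)

  transport-cons : ∀ s {x F L F' L'} → Transport F L F' L' → Transport (s ∷ F) (x ∷ L) (s ∷ F') (x ∷ L')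
  transport-cons s {F = F} {F' = F'} f .move (true ∷ I) len with move f I (ℕ.suc-injective len)
  ... | I' , len' , o , e , mk₁ = true ∷ I' , cong suc len' , o , e , λ { here → here ; (there p) → there
      (mk₁ p) }
  transport-cons s {F = F} {F' = F'} f .move (false ∷ I) len with move f I (ℕ.suc-injective len)
  ... | I' , len' , o , e , mk₁ = false ∷ I' , cong suc len' , cong suc o ,
        trans (eval-∷ s (outside F' I')) (trans (cong (gen s ∙_) e) (sym (eval-∷ s (outside F I)))) ,
        λ { (there p) → there (mk₁ p) }

  transport-map : ∀ (f : Root → Root) {F L F' L'} → Transport F L F' L' → Transport F (map f L) F' (map f L')
  transport-map f {L = L} {L' = L'} tr .move I len with move tr I len
  ... | I' , len' , o , e , mk₁ = I' , len' , o , e , λ p → marked (Marked-map⁻ f L p)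
    where
    marked : ∀ {x} → (Σ Root λ y → (x ≡ f y) × Marked L I y) → Marked (map f L') I' x
    marked (y , refl , q) = Marked-map⁺ f (mk₁ q)

  transport-swap : ∀ {a b} → Comm a b → ∀ {x y F L} → Transport (a ∷ b ∷ F) (x ∷ y ∷ L) (b ∷ a ∷ F) (y ∷ x ∷ L)
  transport-swap {a} {b} c {F = F} .move (i ∷ j ∷ I) len = j ∷ i ∷ I , len , proj₁ (out i j) , proj₂ (out i j) ,
    λ { here → there here ; (there here) → here ; (there (there p)) → there (there p) }
    where
    out : ∀ i j → (length (outside (b ∷ a ∷ F) (j ∷ i ∷ I)) ≡ length (outside (a ∷ b ∷ F) (i ∷ j ∷ I))) ×
                  (eval (outside (b ∷ a ∷ F) (j ∷ i ∷ I)) ≡ eval (outside (a ∷ b ∷ F) (i ∷ j ∷ I)))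
    out true true = refl , refl
    out true false = refl , refl
    out false true = refl , refl
    out false false = refl , sym (∼-eval (∼-swap (outside F I) c))

  act-comm : ∀ {a b} → a ≢ b → Comm a b → ∀ x → act a (act b x) ≡ act b (act a x)
  act-comm {a} {b} a≢b c (t , k) = go (t ≟ gen a) (t ≟ gen b)
    where
    ga≢gb : gen a ≢ gen b
    ga≢gb e = a≢b (gen-injective e)
    fix : ∀ {a b} → Comm a b → gen a ▷ gen b ≡ gen b
    fix {a} {b} c = trans (sym (assoc _ _ _)) (trans
        (cong (_∙ gen a ⁻¹) c) (grp ((y₁ ⊙ y₀) ⊙ y₀ ⁱ) y₁ [] (geni a ∷ geni b ∷ []) refl))
    go : Dec (t ≡ gen a) → Dec (t ≡ gen b) → act a (act b (t , k)) ≡ act b (act a (t , k))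
    go (yes refl) _ = trans (cong (act a) (trans (act-other b (gen a) k ga≢gb) (cong (_, k) (fix (sym c)))))
      (trans (act-self a k) (sym (trans (cong (act b) (act-self a k)) (trans (act-other b (gen a) (suc k) ga≢gb)
          (cong (_, suc k) (fix (sym c)))))))
    go (no _) (yes refl) = trans (cong (act a) (act-self b k))
        (trans (act-other a (gen b) (suc k) (λ e → ga≢gb (sym e)))
      (trans (cong (_, suc k) (fix c)) (sym (trans
          (cong (act b) (trans (act-other a (gen b) k (λ e → ga≢gb (sym e))) (cong (_, k) (fix c))))
          (act-self b k)))))
    go (no t≢a) (no t≢b) = trans (cong (act a) (act-other b t k t≢b)) (trans (act-other a _ k
        (λ e → t≢a (▷-injective (gen b) (trans e (sym (fix (sym c)))))))
      (trans (cong (_, k) (▷-swap t c)) (sym (trans (cong (act b) (act-other a t k t≢a)) (act-other b _ k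
        (λ e → t≢b (▷-injective (gen a) (trans e (sym (fix c))))))))))

  act-gen : ∀ {a b} → a ≢ b → Comm a b → act a (gen b , 0) ≡ (gen b , 0)
  act-gen {a} {b} a≢b c = trans (act-other a (gen b) 0 (λ e → a≢b (gen-injective (sym e)))) (cong (_, 0)
    (trans (sym (assoc _ _ _)) (trans (cong (_∙ gen a ⁻¹) c) (grp ((y₁ ⊙ y₀) ⊙ y₀ ⁱ) y₁ []
        (geni a ∷ geni b ∷ []) refl))))

  -- Swapping distinct commuting letters keeps their labels, since neither acts on the simple root
  -- of the other, and keeps all later labels, since the two actions commute.
  transportQ : ∀ {Q Q'} → Q ∼ Q' → Transport Q (labelsQ Q) Q' (labelsQ Q')
  transportQ ∼-refl = transport-refl
  transportQ (∼-swap {a} {b} w c) with a ≟ b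
  ... | yes refl = transport-refl
  ... | no a≢b = subst₂ (λ L L' → Transport (a ∷ b ∷ w) L (b ∷ a ∷ w) L')
      (cong ((gen a , 0) ∷_) (cong₂ _∷_ (sym (act-gen a≢b c)) refl))
      (cong₂ (λ y L → (gen b , 0) ∷ y ∷ L) (sym (act-gen (λ e → a≢b (sym e)) (sym c)))
        (trans (sym (map-∘ (labelsQ w))) (trans (map-cong (act-comm a≢b c) (labelsQ w)) (map-∘ (labelsQ w)))))
      (transport-swap c)
  transportQ (∼-cons s e) = transport-cons s (transport-map (act s) (transportQ e))
  transportQ (∼-trans e f) = transport-trans (transportQ e) (transportQ f)

  transportC : ∀ {c c'} → c ∼ c' → ∀ {F L} → Transport (c ++ F) (labelsC c ++ L) (c' ++ F) (labelsC c' ++ L)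
  transportC ∼-refl = transport-refl
  transportC (∼-swap w c) = transport-swap c
  transportC (∼-cons s e) = transport-cons s (transportC e)
  transportC (∼-trans e f) = transport-trans (transportC e) (transportC f)

  transport-++ : ∀ c {F L F' L'} → Transport F L F' L' → Transport (c ++ F) (labelsC c ++ L) (c ++ F')
      (labelsC c ++ L')
  transport-++ [] tr = tr
  transport-++ (s ∷ c) tr = transport-cons s (transport-++ c tr)

  transport : ∀ {c c' Q Q'} → c ∼ c' → Q ∼ Q' → Transport (c ++ Q) (labels c Q) (c' ++ Q') (labels c' Q')
  transport {c' = c'} e f = transport-trans (transportC e) (transport-++ c' (transportQ f))

  -- The map τ_s and the rotation of faces

  lower : ℕ → ℕ
  lower zero = m
  lower (suc k) = k

  τ : Fin n → Root → Root
  τ s (t , k) with t ≟ gen s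
  ... | yes _ = gen s , lower k
  ... | no _ with k ℕ.≟ m
  ...   | yes _ = t , k
  ...   | no _ = gen s ▷ t , k

  τ-zero : ∀ s → τ s (gen s , 0) ≡ (gen s , m)
  τ-zero s with gen s ≟ gen s
  ... | yes _ = refl
  ... | no ne = ⊥-elim (ne refl)

  τ-suc : ∀ s k → τ s (gen s , suc k) ≡ (gen s , k)
  τ-suc s k with gen s ≟ gen s
  ... | yes _ = refl
  ... | no ne = ⊥-elim (ne refl)

  τ-top : ∀ s t → t ≢ gen s → τ s (t , m) ≡ (t , m)
  τ-top s t ne with t ≟ gen s
  ... | yes e = ⊥-elim (ne e)
  ... | no _ with m ℕ.≟ m
  ...   | yes _ = refl
  ...   | no nm = ⊥-elim (nm refl)

  τ-low : ∀ s t k → t ≢ gen s → k ≢ m → τ s (t , k) ≡ (gen s ▷ t , k)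
  τ-low s t k ne nk with t ≟ gen s
  ... | yes e = ⊥-elim (ne e)
  ... | no _ with k ℕ.≟ m
  ...   | yes e = ⊥-elim (nk e)
  ...   | no _ = refl

  ▷≢gen : ∀ s {t} → t ≢ gen s → gen s ▷ t ≢ gen s
  ▷≢gen s ne e = ne (▷-injective (gen s) (trans e (sym (gen-▷-self s))))

  τ-act : ∀ s x → proj₂ (act s x) < m → τ s (act s x) ≡ x
  τ-act s (t , k) lt with t ≟ gen s
  ... | yes refl = τ-suc s k
  ... | no ne = trans (τ-low s (gen s ▷ t) k (▷≢gen s ne) (ℕ.<⇒≢ lt)) (cong (_, k) (gen-▷² s t))

  -- The colour bounds exclude m + 1, which `lower` sends to `m` just as it does 0.
  τ-injective : ∀ s {x y} → proj₂ x ≤ m → proj₂ y ≤ m → τ s x ≡ τ s y → x ≡ y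
  τ-injective s {t , k} {t' , k'} le le' e = go (t ≟ gen s) (t' ≟ gen s) k k' le le' e
    where
    low-color : ∀ t k → t ≢ gen s → proj₂ (τ s (t , k)) ≡ k
    low-color t k ne with k ℕ.≟ m
    ... | yes refl = cong proj₂ (τ-top s t ne)
    ... | no nk = cong proj₂ (τ-low s t k ne nk)
    low-root : ∀ t k → t ≢ gen s → proj₁ (τ s (t , k)) ≢ gen s
    low-root t k ne with k ℕ.≟ m
    ... | yes refl = λ e → ne (trans (sym (cong proj₁ (τ-top s t ne))) e)
    ... | no nk = λ e → ▷≢gen s ne (trans (sym (cong proj₁ (τ-low s t k ne nk))) e)
    high-root : ∀ k → proj₁ (τ s (gen s , k)) ≡ gen s
    high-root zero = cong proj₁ (τ-zero s)
    high-root (suc k) = cong proj₁ (τ-suc s k)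
    go : Dec (t ≡ gen s) → Dec (t' ≡ gen s) → ∀ k k' → k ≤ m → k' ≤ m → τ s (t , k) ≡ τ s (t' , k') → (t , k) ≡
        (t' , k')
    go (yes refl) (yes refl) zero zero le le' e = refl
    go (yes refl) (yes refl) zero (suc k') le le' e =
      ⊥-elim (ℕ.<-irrefl (sym (trans (sym (cong proj₂ (τ-zero s)))
          (trans (cong proj₂ e) (cong proj₂ (τ-suc s k'))))) le')
    go (yes refl) (yes refl) (suc k) zero le le' e =
      ⊥-elim (ℕ.<-irrefl (trans (sym (cong proj₂ (τ-suc s k))) (trans (cong proj₂ e) (cong proj₂ (τ-zero s))))
          le)
    go (yes refl) (yes refl) (suc k) (suc k') le le' e =
      cong (λ j → gen s , suc j) (trans (sym (cong proj₂ (τ-suc s k)))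
          (trans (cong proj₂ e) (cong proj₂ (τ-suc s k'))))
    go (yes refl) (no ne) k k' le le' e = ⊥-elim (low-root t' k' ne (trans (cong proj₁ (sym e)) (high-root k)))
    go (no ne) (yes refl) k k' le le' e = ⊥-elim (low-root t k ne (trans (cong proj₁ e) (high-root k')))
    go (no ne) (no ne') k k' le le' e with trans (sym (low-color t k ne))
        (trans (cong proj₂ e) (low-color t' k' ne'))
    ... | refl with k ℕ.≟ m
    ...   | yes refl = cong (_, k) (trans (sym (cong proj₁ (τ-top s t ne)))
        (trans (cong proj₁ e) (cong proj₁ (τ-top s t' ne'))))
    ...   | no nk = cong (_, k) (▷-injective (gen s) (trans (sym (cong proj₁ (τ-low s t k ne nk)))
        (trans (cong proj₁ e) (cong proj₁ (τ-low s t' k ne' nk)))))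

  Face : Word → List Root → ℕ → G → Root → Root → Set
  Face F L K x a b = Σ (List Bool) λ I → (length I ≡ length F) × (length (outside F I) ≡ K) ×
    (eval (outside F I) ≡ x) × Marked L I a × Marked L I b

  face-transport : ∀ {F L F' L' K x a b} → Transport F L F' L' → Face F L K x a b → Face F' L' K x a b
  face-transport tr (I , len , o , e , ma , mb) with move tr I len
  ... | I' , len' , o' , e' , mk' = I' , len' , trans o' o , trans e' e , mk' ma , mk' mb

  outside-∷ʳ : ∀ F I (s : Fin n) b → length I ≡ length F → outside (F ++ [ s ]) (I ++ [ b ]) ≡ outside F I ++
      outside [ s ] [ b ]
  outside-∷ʳ [] [] s b len = refl
  outside-∷ʳ (a ∷ F) (true ∷ I) s b len = outside-∷ʳ F I s b (ℕ.suc-injective len)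
  outside-∷ʳ (a ∷ F) (false ∷ I) s b len = cong (a ∷_) (outside-∷ʳ F I s b (ℕ.suc-injective len))

  Marked-∷ʳ⁺ : ∀ {L I x} l b → length I ≡ length L → Marked L I x → Marked (L ++ [ l ]) (I ++ [ b ]) x
  Marked-∷ʳ⁺ l b len here = here
  Marked-∷ʳ⁺ l b len (there p) = there (Marked-∷ʳ⁺ l b (ℕ.suc-injective len) p)

  Marked-∷ʳ-last : ∀ {L I} l → length I ≡ length L → Marked (L ++ [ l ]) (I ++ [ true ]) l
  Marked-∷ʳ-last {[]} {[]} l len = here
  Marked-∷ʳ-last {x ∷ L} {b ∷ I} l len = there (Marked-∷ʳ-last l (ℕ.suc-injective len))

  Marked-∷ʳ⁻ : ∀ L I {l b x} → length I ≡ length L → Marked (L ++ [ l ]) (I ++ [ b ]) x → Marked (l ∷ L) (b ∷ I)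
      x
  Marked-∷ʳ⁻ [] [] len here = here
  Marked-∷ʳ⁻ (x ∷ L) (true ∷ I) len here = there here
  Marked-∷ʳ⁻ (x ∷ L) (c ∷ I) len (there p) with Marked-∷ʳ⁻ L I (ℕ.suc-injective len) p
  ... | here = here
  ... | there q = there (there q)

  length-∷ʳ : ∀ {A : Set} (xs : List A) x → length (xs ++ [ x ]) ≡ suc (length xs)
  length-∷ʳ xs x = trans (length-++ xs) (ℕ.+-comm (length xs) 1)

  -- If the moved letter belongs to the complement, its product changes from s y to y s'. Both equal
  -- `x` at the same time exactly because x s' = s x.
  outside-rotate : ∀ F I s s' b {x} → length I ≡ length F → x ∙ gen s' ≡ gen s ∙ x →
    (length (outside (F ++ [ s' ]) (I ++ [ b ])) ≡ length (outside (s ∷ F) (b ∷ I))) ×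
    (eval (outside (s ∷ F) (b ∷ I)) ≡ x → eval (outside (F ++ [ s' ]) (I ++ [ b ])) ≡ x) ×
    (eval (outside (F ++ [ s' ]) (I ++ [ b ])) ≡ x → eval (outside (s ∷ F) (b ∷ I)) ≡ x)
  outside-rotate F I s s' true len c rewrite outside-∷ʳ F I s' true len | ++-identityʳ (outside F I) =
    refl , (λ e → e) , (λ e → e)
  outside-rotate F I s s' false {x} len c rewrite outside-∷ʳ F I s' false len =
    length-∷ʳ (outside F I) s' ,
    (λ e → trans (eval-++ O [ s' ]) (trans (grp (x₀ ⊙ x₁) ((y₀ ⊙ (y₀ ⊙ x₀)) ⊙ x₁) (eval O ∷ gen s' ∷ [])
        (geni s ∷ []) refl)
      (trans (cong (λ y → (gen s ∙ y) ∙ gen s') (trans (sym (eval-∷ s O)) e))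
          (trans (assoc _ _ _) (trans (cong (gen s ∙_) c)
        (grp (y₀ ⊙ (y₀ ⊙ x₀)) x₀ (x ∷ []) (geni s ∷ []) refl)))))) ,
    (λ e → trans (eval-∷ s O) (∙-cancelʳ (gen s')
        (trans (assoc _ _ _) (trans (cong (gen s ∙_) (trans (sym (eval-++ O [ s' ])) e)) (sym c)))))
    where O = outside F I

  rotate-face : ∀ {F L s s' l K x a b} (f : Root → Root) → length L ≡ length F → x ∙ gen s' ≡ gen s ∙ x →
    Face (s ∷ F) (l ∷ L) K x a b → Face (F ++ [ s' ]) (map f L ++ [ f l ]) K x (f a) (f b)
  rotate-face {F} {L} {s} {s'} {l} f lenL c (b ∷ I , len , o , e , ma , mb) with outside-rotate F I s s' b
      (ℕ.suc-injective len) c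
  ... | lo , onward , _ = I ++ [ b ] , trans (length-∷ʳ I b) (trans len (sym (length-∷ʳ F s'))) , trans lo o ,
      onward e , marked ma , marked mb
    where
    lenI : length I ≡ length (map f L)
    lenI = trans (ℕ.suc-injective len) (trans (sym lenL) (sym (length-map f L)))
    marked : ∀ {y} → Marked (l ∷ L) (b ∷ I) y → Marked (map f L ++ [ f l ]) (I ++ [ b ]) (f y)
    marked here = Marked-∷ʳ-last (f l) lenI
    marked (there p) = Marked-∷ʳ⁺ (f l) b lenI (Marked-map⁺ f p)

  unrotate-face : ∀ {F L s s' l K x a b} (f : Root → Root) → length L ≡ length F → x ∙ gen s' ≡ gen s ∙ x →
    Face (F ++ [ s' ]) (map f L ++ [ f l ]) K x a b →
    Σ Root λ a' → Σ Root λ b' → (a ≡ f a') × (b ≡ f b') × Face (s ∷ F) (l ∷ L) K x a' b'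
  unrotate-face {F} {L} {s} {s'} {l} {K} {x} {a} {b} f lenL c (I , len , rest) with initLast I
  ... | [] = ⊥-elim (ℕ.0≢1+n (trans len (length-∷ʳ F s')))
  unrotate-face {F} {L} {s} {s'} {l} {K} {x} {a} {b} f lenL c (.(I ++ [ i ]) , len , o , e , ma , mb) | I ∷ʳ′ i
    with outside-rotate F I s s' i len' c
    where
    len' : length I ≡ length F
    len' = ℕ.suc-injective (trans (sym (length-∷ʳ I i)) (trans len (length-∷ʳ F s')))
  ... | lo , _ , backward with marked ma | marked mb
    where
    len' : length I ≡ length F
    len' = ℕ.suc-injective (trans (sym (length-∷ʳ I i)) (trans len (length-∷ʳ F s')))
    marked : ∀ {y} → Marked (map f L ++ [ f l ]) (I ++ [ i ]) y → Σ Root λ y' → (y ≡ f y') × Marked (l ∷ L)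
        (i ∷ I) y'
    marked p = Marked-map⁻ f (l ∷ L) (Marked-∷ʳ⁻ (map f L) I
        (trans len' (trans (sym lenL) (sym (length-map f L)))) p)
  ... | a' , ea , ma' | b' , eb , mb' = a' , b' , ea , eb , i ∷ I ,
        trans (sym (length-∷ʳ I i)) (trans len (length-∷ʳ F s')) , trans (sym lo) o , backward e , ma' , mb'

  length-labelsQ : ∀ Q → length (labelsQ Q) ≡ length Q
  length-labelsQ [] = refl
  length-labelsQ (t ∷ Q) = cong suc (trans (length-map (act t) (labelsQ Q)) (length-labelsQ Q))

  length-labels : ∀ c Q → length (labels c Q) ≡ length (c ++ Q)
  length-labels c Q = trans (length-++ (labelsC c)) (trans (cong₂ ℕ._+_ (length-map _ c) (length-labelsQ Q))
      (sym (length-++ c)))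

  -- The word s c s Q becomes c s Q s'. Labels of `c` have colour `m` and are fixed; the second `s`
  -- goes from colour 0 to `m` and joins the Coxeter word; the later labels lose one `act s`; and
  -- α_s⁽ᵐ⁾ turns into the label of the new last letter `s'`.
  labels-rotate : ∀ s c Q s' → s ∉ c → All (λ x → proj₂ x < m) (labelsQ (s ∷ Q)) → apply (s ∷ Q) (gen s' , 0) ≡
      (gen s , m) →
    1 ≤ m → map (τ s) (labels c (s ∷ Q)) ++ [ τ s (gen s , m) ] ≡ labels (c ++ [ s ]) (Q ++ [ s' ])
  labels-rotate s c Q s' s∉c (_ ∷ low) last 1≤m =
    trans (cong (_++ [ τ s (gen s , m) ]) (map-++ (τ s) (labelsC c) (labelsQ (s ∷ Q))))
    (trans (++-assoc (map (τ s) (labelsC c)) _ _)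
    (trans (cong₂ _++_ top (cong₂ _∷_ (τ-zero s) (cong₂ _++_ (rest (labelsQ Q) low) (cong [_] final))))
    (trans (sym (++-assoc (labelsC c) [ gen s , m ] (labelsQ Q ++ [ apply Q (gen s' , 0) ])))
      (cong₂ _++_ (sym (map-++ _ c [ s ])) (sym (labelsQ-++ Q [ s' ]))))))
    where
    top : map (τ s) (labelsC c) ≡ labelsC c
    top = go c s∉c
      where
      go : ∀ c → s ∉ c → map (τ s) (labelsC c) ≡ labelsC c
      go [] _ = refl
      go (r ∷ c) s∉ = cong₂ _∷_ (τ-top s (gen r) (λ e → s∉ (here (sym (gen-injective e)))))
          (go c (λ p → s∉ (there p)))
    rest : ∀ L → All (λ x → proj₂ x < m) (map (act s) L) → map (τ s) (map (act s) L) ≡ L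
    rest [] _ = refl
    rest (x ∷ L) (lt ∷ lts) = cong₂ _∷_ (τ-act s x lt) (rest L lts)
    before : ∀ y → act s y ≡ (gen s , m) → τ s (gen s , m) ≡ y
    before (t , k) e = go (t ≟ gen s)
      where
      go : Dec (t ≡ gen s) → τ s (gen s , m) ≡ (t , k)
      go (yes refl) = trans (cong (τ s) (trans (sym e) (act-self s k))) (τ-suc s k)
      go (no ne) = ⊥-elim (▷≢gen s ne (cong proj₁ (trans (sym (act-other s t k ne)) e)))
    final : τ s (gen s , m) ≡ apply Q (gen s' , 0)
    final = before (apply Q (gen s' , 0)) last

  -- The blocks of w∘ᵐ(c) and their rotation

  module Twist {w : G} (d : AllDescents w) (σ : Fin n → Fin n) (eσ : ∀ s → gen (σ s) ≡ w ▷ gen s) where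
    w² : w ∙ w ≡ 1g
    w² = trans (cong (w ∙_) (sym (allDescents-⁻¹ d))) (invʳ w)

    wi : Involution
    wi = w , w²

    eval-map : ∀ u → eval (map σ u) ≡ w ▷ eval u
    eval-map [] = grp ι (y₀ ▸ ι) [] (wi ∷ []) refl
    eval-map (s ∷ u) = trans (eval-∷ (σ s) (map σ u)) (trans (cong₂ _∙_ (eσ s) (eval-map u))
      (trans (grp ((y₀ ▸ y₁) ⊙ (y₀ ▸ x₀)) (y₀ ▸ (y₁ ⊙ x₀)) (eval u ∷ []) (wi ∷ geni s ∷ []) refl)
          (cong (w ▷_) (sym (eval-∷ s u)))))

    record Block (q : Word) : Set where
      constructor block
      field
        reduced : Reduced q
        longest : eval q ≡ w

    open Block public

    Block-map : ∀ {q} → Block q → Block (map σ q)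
    Block-map {q} (block red e) = block
      (λ w' e' → subst₂ _≤_ (sym (length-map σ q)) (length-map σ w') (red (map σ w')
        (trans (eval-map w') (trans (cong (w ▷_) (trans e' (eval-map q))) (grp (y₀ ▸ y₀ ▸ x₀) x₀ (eval q ∷ [])
            (wi ∷ []) refl)))))
      (trans (eval-map q) (trans (cong (w ▷_) e) (grp (y₀ ▸ y₀) y₀ [] (wi ∷ []) refl)))

    -- w∘ inverts every reflection, so by `apply-reduced` a block raises every colour by exactly
    -- one.
    apply-block : ∀ {q} → Block q → ∀ {t} → Refl t → ∀ k → apply q (t , k) ≡ (w ▷ t , suc k)
    apply-block {q} bl {t} r k = trans (apply-reduced q (reduced bl) t k)
      (trans (cong (λ x → (x ▷ t , bump (ν x t) k)) (longest bl))
          (cong (λ b → (w ▷ t , bump b k)) (allDescents-inverts d r)))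

    block-label : ∀ {q} → Block q → ∀ {x} → x ∈ labelsQ q → Refl (proj₁ x) × (proj₂ x ≡ 0)
    block-label {q} bl x∈ with ∈-labelsQ q x∈
    ... | u , r , v , refl , refl rewrite apply-reduced u (Reduced-++ˡ u (r ∷ v) (reduced bl)) (gen r) 0 =
          Refl-▷ (eval u) (Refl-gen r) , cong (λ b → bump b 0) up
      where
      redr : Reduced (u ++ [ r ])
      redr = Reduced-++ˡ (u ++ [ r ]) v (subst Reduced (sym (++-assoc u [ r ] v)) (reduced bl))
      up : ν (eval u) (gen r) ≡ false
      up = ν-false (eval u) (ℕ.≤-trans (ℓ-≤ u refl)
          (ℕ.≤-trans (ℕ.≤-trans (ℕ.n≤1+n _) (ℕ.≤-reflexive (sym (length-∷ʳ u r))))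
        (ℕ.≤-reflexive (trans (sym (ℓ-reduced redr)) (cong ℓ (eval-++ u [ r ]))))))

    pow-label : ∀ k {q} → Block q → ∀ {x} → x ∈ labelsQ (pow k σ q) → Refl (proj₁ x) × (proj₂ x < k)
    pow-label (suc k) {q} bl {x} x∈ = either (∈-++⁻ (labelsQ q) (subst (x ∈_) (labelsQ-++ q R) x∈))
      where
      R = pow k σ (map σ q)
      in-rest : ∀ y → y ∈ labelsQ R → Refl (proj₁ (apply q y)) × (proj₂ (apply q y) < suc k)
      in-rest (t , j) y∈ = subst (λ z → Refl (proj₁ z) × (proj₂ z < suc k)) (sym (apply-block bl (proj₁ ih) j))
          (Refl-▷ w (proj₁ ih) , s≤s (proj₂ ih))
        where
        ih : Refl t × (j < k)
        ih = pow-label k (Block-map bl) y∈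
      image : (Σ Root λ y → (y ∈ labelsQ R) × (x ≡ apply q y)) → Refl (proj₁ x) × (proj₂ x < suc k)
      image (y , y∈ , e) = subst (λ z → Refl (proj₁ z) × (proj₂ z < suc k)) (sym e) (in-rest y y∈)
      in-block : Refl (proj₁ x) × (proj₂ x ≡ 0) → Refl (proj₁ x) × (proj₂ x < suc k)
      in-block (r , e) = r , s≤s (subst (_≤ k) (sym e) z≤n)
      either : (x ∈ labelsQ q) ⊎ (x ∈ map (apply q) (labelsQ R)) → Refl (proj₁ x) × (proj₂ x < suc k)
      either (inj₁ x∈q) = in-block (block-label bl x∈q)
      either (inj₂ x∈R) = image (∈-map⁻ (apply q) x∈R)

    pow-apply : ∀ k {q} → Block q → ∀ {t} → Refl t → apply (pow k σ q) (t , 0) ≡ (power w k ▷ t , k)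
    pow-apply zero bl {t} r = cong (_, 0) (grp x₀ (ι ▸ x₀) (t ∷ []) [] refl)
    pow-apply (suc k) {q} bl {t} r = trans (apply-++ q (pow k σ (map σ q)) (t , 0))
        (trans (cong (apply q) (pow-apply k (Block-map bl) r))
      (trans (apply-block bl (Refl-▷ (power w k) r) k) (cong (_, suc k) (sym (▷-∙ w (power w k) t)))))

    pow-eval : ∀ k {q} → Block q → eval (pow k σ q) ≡ power w k
    pow-eval zero bl = refl
    pow-eval (suc k) {q} bl = trans (eval-++ q _) (cong₂ _∙_ (longest bl) (pow-eval k (Block-map bl)))

    pow-Alt : ∀ k {q g} → Block q → Alt g q → Alt g (pow k σ q)
    pow-Alt zero bl as = []
    pow-Alt (suc k) {q} {g} bl as = Alt-++⁺ as (subst (λ x → Alt x (pow k σ (map σ q)))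
      (cong (_▷ g) (trans (sym (allDescents-⁻¹ d)) (cong _⁻¹ (sym (longest bl))))) (pow-Alt k (Block-map bl)
          (Alt-▷ d eσ as)))

    Occurs : Word → Root → Set
    Occurs Q x = Σ Word λ u → Σ (Fin n) λ r → Σ Word λ v → (Q ≡ u ++ r ∷ v) × (apply u (gen r , 0) ≡ x)

    block-label⁻ : ∀ {q} → Block q → ∀ {t} → Refl t → Occurs q (t , 0)
    block-label⁻ {q} bl {t} rt = found (exchange q t (trans (sym (N-eval q t)) inverted))
      where
      inverted : N (eval q) t ≡ true
      inverted = trans (cong (λ x → N x t) (longest bl)) (trans (N≡ν⁻¹ w t)
        (trans (cong (λ x → ν x t) (allDescents-⁻¹ d)) (allDescents-inverts d rt)))
      found : (Σ Word λ u → Σ (Fin n) λ s → Σ Word λ v → (q ≡ u ++ s ∷ v) × (t ≡ eval u ▷ gen s)) → Occurs q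
          (t , 0)
      found (u , a , v , e , et) = u , a , v , e , cong₂ _,_ (trans (apply-▷ u (gen a , 0)) (sym et))
        (proj₂ (block-label bl (subst (λ Q → apply u (gen a , 0) ∈ labelsQ Q) (sym e)
          (subst (apply u (gen a , 0) ∈_) (sym (labelsQ-++ u (a ∷ v))) (∈-++⁺ʳ (labelsQ u) (here refl))))))

    -- Colour 0 occurs in the first block, because w∘ has every reflection as an inversion; by
    -- `apply-block` a higher colour of `t` comes from the next lower colour of w∘ t w∘ in the
    -- remaining blocks.
    pow-label⁻ : ∀ k {q} → Block q → ∀ {t j} → Refl t → j < k → Occurs (pow k σ q) (t , j)
    pow-label⁻ (suc k) {q} bl {t} {zero} rt lt = extended (block-label⁻ bl rt)
      where
      extended : Occurs q (t , 0) → Occurs (pow (suc k) σ q) (t , 0)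
      extended (u , a , v , e , el) = u , a , v ++ pow k σ (map σ q) ,
        trans (cong (_++ pow k σ (map σ q)) e) (++-assoc u (a ∷ v) _) , el
    pow-label⁻ (suc k) {q} bl {t} {suc j} rt (s≤s lt) = shifted (pow-label⁻ k (Block-map bl) (Refl-▷ w rt) lt)
      where
      shifted : Occurs (pow k σ (map σ q)) (w ▷ t , j) → Occurs (pow (suc k) σ q) (t , suc j)
      shifted (u , a , v , e , el) = q ++ u , a , v , trans (cong (q ++_) e) (sym (++-assoc q u (a ∷ v))) ,
          trans (apply-++ q u (gen a , 0)) (trans (cong (apply q) el) (trans (apply-block bl (Refl-▷ w rt) j)
            (cong (_, suc j) (grp (y₀ ▸ y₀ ▸ x₀) x₀ (t ∷ []) (wi ∷ []) refl))))

    iterate : ℕ → Fin n → Fin n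
    iterate zero s = s
    iterate (suc k) s = iterate k (σ s)

    power-iterate : ∀ k s → power w k ∙ gen (iterate k s) ≡ gen s ∙ power w k
    power-iterate zero s = grp (ι ⊙ x₀) (x₀ ⊙ ι) (gen s ∷ []) [] refl
    power-iterate (suc k) s = trans (assoc _ _ _) (trans (cong (w ∙_) (power-iterate k (σ s)))
        (trans (cong (λ x → w ∙ (x ∙ power w k)) (eσ s))
      (grp (y₀ ⊙ ((y₀ ▸ y₁) ⊙ x₀)) (y₁ ⊙ (y₀ ⊙ x₀)) (power w k ∷ []) (wi ∷ geni s ∷ []) refl)))

    -- The letter that opens each block becomes the last letter of the block before it; only the
    -- very first and the very last letter of the whole word change places with the outside.
    pow-rotate : ∀ k s A → pow k σ (s ∷ A) ++ [ iterate k s ] ≡ s ∷ pow k σ (A ++ [ σ s ])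
    pow-rotate zero s A = refl
    pow-rotate (suc k) s A = cong (s ∷_) (trans (++-assoc A _ _)
        (trans (cong (A ++_) (pow-rotate k (σ s) (map σ A)))
      (trans (cong (λ X → A ++ σ s ∷ pow k σ X) (sym (map-++ σ A [ σ s ]))) (sym (++-assoc A [ σ s ] _)))))

    map-∼ : ∀ {u v} → u ∼ v → map σ u ∼ map σ v
    map-∼ ∼-refl = ∼-refl
    map-∼ (∼-swap {a} {b} u c) = ∼-swap (map σ u) (trans (cong₂ _∙_ (eσ a) (eσ b)) (trans
      (grp ((x₀ ▸ x₁) ⊙ (x₀ ▸ x₂)) (x₀ ▸ (x₁ ⊙ x₂)) (w ∷ gen a ∷ gen b ∷ []) [] refl) (trans (cong (w ▷_) c)
        (trans (grp (x₀ ▸ (x₁ ⊙ x₂)) ((x₀ ▸ x₁) ⊙ (x₀ ▸ x₂)) (w ∷ gen b ∷ gen a ∷ []) [] refl)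
            (cong₂ _∙_ (sym (eσ b)) (sym (eσ a)))))))
    map-∼ (∼-cons s e) = ∼-cons (σ s) (map-∼ e)
    map-∼ (∼-trans e f) = ∼-trans (map-∼ e) (map-∼ f)

    pow-∼ : ∀ k {q q'} → q ∼ q' → pow k σ q ∼ pow k σ q'
    pow-∼ zero e = ∼-refl
    pow-∼ (suc k) {q} {q'} e = ∼-trans (∼-++ʳ _ e) (∼-++ˡ q' (pow-∼ k (map-∼ e)))

    Block-∼ : ∀ {q q'} → q ∼ q' → Block q → Block q'
    Block-∼ e (block red ew) = block (λ w' e' → subst (_≤ length w') (∼-length e) (red w'
        (trans e' (sym (∼-eval e))))) (trans (sym (∼-eval e)) ew)

    FaceOf : Word → Word → ℕ → Root → Root → Set
    FaceOf c q K = Face (c ++ pow m σ q) (labels c (pow m σ q)) K (power w m)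

    face-∼ : ∀ {c c' q q' K x y} → c ∼ c' → q ∼ q' → FaceOf c q K x y → FaceOf c' q' K x y
    face-∼ e f = face-transport (transport e (pow-∼ m f))

    pow-head : ∀ k s A → 1 ≤ k → Σ Word λ Q → pow k σ (s ∷ A) ≡ s ∷ Q
    pow-head (suc k) s A _ = _ , refl

    module _ (1≤m : 1 ≤ m) {s c A} (s∉c : s ∉ c) (bl : Block (s ∷ A)) where
      private
        Q = proj₁ (pow-head m s A 1≤m)
        eQ : pow m σ (s ∷ A) ≡ s ∷ Q
        eQ = proj₂ (pow-head m s A 1≤m)
        s' = iterate m s
        eQ' : pow m σ (A ++ [ σ s ]) ≡ Q ++ [ s' ]
        eQ' = ∷-injectiveʳ (trans (sym (pow-rotate m s A)) (cong (_++ [ s' ]) eQ))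
        low : All (λ x → proj₂ x < m) (labelsQ (s ∷ Q))
        low = All.tabulate λ {x} x∈ → proj₂ (pow-label m bl (subst (λ X → x ∈ labelsQ X) (sym eQ) x∈))
        last : apply (s ∷ Q) (gen s' , 0) ≡ (gen s , m)
        last = trans (cong (λ X → apply X (gen s' , 0)) (sym eQ)) (trans (pow-apply m bl (Refl-gen s'))
            (cong (_, m)
          (trans (sym (assoc _ _ _)) (trans (cong (_∙ power w m ⁻¹) (power-iterate m s))
              (grp ((x₀ ⊙ x₁) ⊙ x₁ ⁱ) x₀ (gen s ∷ power w m ∷ []) [] refl)))))
        e = labels-rotate s c Q s' s∉c low last 1≤m
        F≡ : (c ++ s ∷ Q) ++ [ s' ] ≡ (c ++ [ s ]) ++ (Q ++ [ s' ])
        F≡ = trans (++-assoc c (s ∷ Q) [ s' ]) (sym (++-assoc c [ s ] (Q ++ [ s' ])))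

      face-rotate : ∀ {K x y} → FaceOf (s ∷ c) (s ∷ A) K x y → FaceOf (c ++ [ s ]) (A ++ [ σ s ]) K (τ s x)
          (τ s y)
      face-rotate {K} {x} {y} f = subst (λ X → Face ((c ++ [ s ]) ++ X) (labels (c ++ [ s ]) X) K (power w m)
          (τ s x) (τ s y)) (sym eQ')
        (subst₂ (λ F L → Face F L K (power w m) (τ s x) (τ s y)) F≡ e
          (rotate-face {c ++ s ∷ Q} {labels c (s ∷ Q)} {s} {s'} {gen s , m} (τ s) (length-labels c (s ∷ Q))
              (power-iterate m s)
            (subst (λ X → Face (s ∷ c ++ X) (labels (s ∷ c) X) K (power w m) x y) eQ f)))

      face-unrotate : ∀ {K x y} → FaceOf (c ++ [ s ]) (A ++ [ σ s ]) K x y →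
        Σ Root λ x' → Σ Root λ y' → (x ≡ τ s x') × (y ≡ τ s y') × FaceOf (s ∷ c) (s ∷ A) K x' y'
      face-unrotate {K} {x} {y} f = restore (unrotate-face {c ++ s ∷ Q} {labels c (s ∷ Q)} {s} {s'} {gen s , m}
          (τ s) (length-labels c (s ∷ Q)) (power-iterate m s)
          (subst₂ (λ F L → Face F L K (power w m) x y) (sym F≡) (sym e)
            (subst (λ X → Face ((c ++ [ s ]) ++ X) (labels (c ++ [ s ]) X) K (power w m) x y) eQ' f)))
        where
        restore : (Σ Root λ x' → Σ Root λ y' → (x ≡ τ s x') × (y ≡ τ s y') × Face (s ∷ c ++ s ∷ Q)
            (labels (s ∷ c) (s ∷ Q)) K (power w m) x' y') →
          Σ Root λ x' → Σ Root λ y' → (x ≡ τ s x') × (y ≡ τ s y') × FaceOf (s ∷ c) (s ∷ A) K x' y'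
        restore (x' , y' , ex , ey , f') = x' , y' , ex , ey ,
          subst (λ X → Face (s ∷ c ++ X) (labels (s ∷ c) X) K (power w m) x' y') (sym eQ) f'

    face-color : ∀ {c q K x y} → Block q → FaceOf c q K x y → (proj₂ x ≤ m) × (proj₂ y ≤ m)
    face-color {c} {q} bl (I , _ , _ , _ , mx , my) = color mx , color my
      where
      color : ∀ {x} → Marked (labels c (pow m σ q)) I x → proj₂ x ≤ m
      color p with ∈-++⁻ (labelsC c) (Marked-∈ p)
      ... | inj₁ x∈ with ∈-map⁻ _ x∈
      ...   | _ , _ , refl = ℕ.≤-refl
      color p | inj₂ x∈ = ℕ.<⇒≤ (proj₂ (pow-label m bl x∈))

    -- The words w∘(c) and w∘(scs) differ by moving s from the front to the end.
    record Rotation (c c' : Word) (s : Fin n) (w0 : Word) : Set where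
      field
        {q q'}   : Word
        sorted   : W0c c w0 q
        sorted'  : W0c c' w0 q'
        onward   : ∀ {K x y} → FaceOf c q K x y → FaceOf c' q' K (τ s x) (τ s y)
        backward : ∀ {K x y} → proj₂ x ≤ m → proj₂ y ≤ m → FaceOf c' q' K (τ s x) (τ s y) → FaceOf c q K x y

    rotation : 1 ≤ m → ∀ {c c' s w0} → CoxWord c → CoxWord c' → N (eval c) (gen s) ≡ true → eval c' ≡ gen s ▷
        eval c → eval w0 ≡ w →
      Rotation c c' s w0
    rotation 1≤m {c} {c'} {s} {w0} pc pc' es ec' ew0 with longest-Alt (c , pc , refl) | initial-split c s
        (unique pc) es
    ... | A , as , red , dA | u , v , refl , cs with Alt-front (_ , pc , refl) as es s∈A
      where
      eA : eval A ≡ w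
      eA = allDescents-unique dA d
      s∈A : s ∈ A
      s∈A = InW-gen⁻ {_∈ A} (InW-ν (A , refl , All.tabulate λ z → z) (dA s))
    ...   | A₁ , A∼ , as₁ = record
            { sorted = proj₁ (proj₂ E)
            ; sorted' = proj₁ (proj₂ E')
            ; onward = λ {K} {x} {y} f → face-∼ {c₁ ++ [ s ]} {c'} {A'} {q'} c'∼ (∼-sym q'∼)
                (face-rotate 1≤m s∉ bl (face-∼ {u ++ s ∷ v} {s ∷ c₁} {q} {s ∷ A₁} c∼ q∼ f))
            ; backward = λ {K} {x} {y} lx ly f → back {K} {x} {y} lx ly
                (face-unrotate 1≤m s∉ bl (face-∼ {c'} {c₁ ++ [ s ]} {q'} {A'} (∼-sym c'∼) q'∼ f)) }
      where
      eA : eval A ≡ w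
      eA = allDescents-unique dA d
      c₁ = u ++ v
      c∼ : u ++ s ∷ v ∼ s ∷ c₁
      c∼ = ∼-front s u v cs
      p₁ : s ∷ c₁ ↭ allFin n
      p₁ = ↭-trans (↭-sym (shift s u v)) pc
      s∉ : s ∉ c₁
      s∉ = ∉-rest p₁
      c'∼ : c₁ ++ [ s ] ∼ c'
      c'∼ = Unique-∼ (unique (rotate-↭ p₁)) (unique pc') (trans (eval-rotate s c₁)
          (trans (cong (gen s ▷_) (sym (∼-eval c∼))) (sym ec')))
      bl : Block (s ∷ A₁)
      bl = Block-∼ A∼ (block red eA)
      A' = A₁ ++ [ σ s ]
      eA' : eval A' ≡ w
      eA' = trans (eval-++ A₁ [ σ s ]) (trans (cong₂ _∙_ (grp x₀ (y₀ ⊙ (y₀ ⊙ x₀)) (eval A₁ ∷ []) (geni s ∷ [])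
          refl) (eσ s))
        (trans (cong (λ x → (gen s ∙ x) ∙ (w ▷ gen s)) (trans (sym (eval-∷ s A₁)) (longest bl)))
          (grp ((y₁ ⊙ y₀) ⊙ (y₀ ▸ y₁)) y₀ [] (wi ∷ geni s ∷ []) refl)))
      red' : Reduced A'
      red' w' e = subst (_≤ length w') (sym (length-∷ʳ A₁ (σ s))) (reduced bl w'
          (trans e (trans eA' (sym (longest bl)))))
      -- Once s A₁ = w∘ has been read, the current Coxeter element is w∘ c w∘, and there σ s is
      -- initial because `s` is initial in `c`.
      as' : Alt (eval c') A'
      as' = subst (λ g → Alt g A') (sym ec') (Alt-++⁺ as₁
          (trans (cong₂ N (trans (after (eval (u ++ s ∷ v)) s A₁)
          (cong (_▷ eval (u ++ s ∷ v)) (trans (cong _⁻¹ (longest bl)) (allDescents-⁻¹ d)))) (eσ s))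
              (trans (N-▷-longest d (eval (u ++ s ∷ v)) s) es) ∷ []))
      E = W0c-exists pc as red {w0} (trans ew0 (sym eA))
      E' = W0c-exists pc' as' red' {w0} (trans ew0 (sym eA'))
      q = proj₁ E
      q' = proj₁ E'
      q∼ : q ∼ s ∷ A₁
      q∼ = ∼-trans (proj₂ (proj₂ E)) A∼
      q'∼ : q' ∼ A'
      q'∼ = proj₂ (proj₂ E')
      back : ∀ {K x y} → proj₂ x ≤ m → proj₂ y ≤ m →
        (Σ Root λ x' → Σ Root λ y' → (τ s x ≡ τ s x') × (τ s y ≡ τ s y') × FaceOf (s ∷ c₁) (s ∷ A₁) K x' y') →
            FaceOf (u ++ s ∷ v) q K x y
      back {K} lx ly (x' , y' , ex , ey , f) = subst₂ (FaceOf (u ++ s ∷ v) q K)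
        (sym (τ-injective s lx (proj₁ (face-color bl f)) ex)) (sym (τ-injective s ly (proj₂ (face-color bl f))
            ey))
        (face-∼ {s ∷ c₁} {u ++ s ∷ v} {s ∷ A₁} {q} (∼-sym c∼) (∼-sym q∼) f)

  -- Facets as factorisations into reflections

  split-at : ∀ (I : List Bool) k (F : Word) → length I ≡ k ℕ.+ length F →
    Σ (List Bool) λ I₁ → Σ (List Bool) λ I₂ → (I ≡ I₁ ++ I₂) × (length I₁ ≡ k) × (length I₂ ≡ length F)
  split-at I zero F len = [] , I , refl , refl , len
  split-at (b ∷ I) (suc k) F len with split-at I k F (ℕ.suc-injective len)
  ... | I₁ , I₂ , refl , l₁ , l₂ = b ∷ I₁ , I₂ , refl , cong suc l₁ , l₂

  outside-++ : ∀ F {F'} I {I'} → length I ≡ length F → outside (F ++ F') (I ++ I') ≡ outside F I ++ outside F'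
      I'
  outside-++ [] [] len = refl
  outside-++ (a ∷ F) (true ∷ I) len = outside-++ F I (ℕ.suc-injective len)
  outside-++ (a ∷ F) (false ∷ I) len = cong (a ∷_) (outside-++ F I (ℕ.suc-injective len))

  outside-none : ∀ F → outside F (replicate (length F) false) ≡ F
  outside-none [] = refl
  outside-none (a ∷ F) = cong (a ∷_) (outside-none F)

  outside-all : ∀ F → outside F (replicate (length F) true) ≡ []
  outside-all [] = refl
  outside-all (a ∷ F) = outside-all F

  outside-All : ∀ {P : Fin n → Set} F I → All P F → All P (outside F I)
  outside-All [] I [] = []
  outside-All (a ∷ F) [] ps = []
  outside-All (a ∷ F) (true ∷ I) (p ∷ ps) = outside-All F I ps
  outside-All (a ∷ F) (false ∷ I) (p ∷ ps) = p ∷ outside-All F I ps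

  -- The reflections of the marked positions, last position first.
  deleted : Word → List Bool → List G
  deleted [] I = []
  deleted (a ∷ F) [] = []
  deleted (a ∷ F) (true ∷ I) = map (gen a ▷_) (deleted F I) ++ [ gen a ]
  deleted (a ∷ F) (false ∷ I) = map (gen a ▷_) (deleted F I)

  deleted-Refl : ∀ F I → All Refl (deleted F I)
  deleted-Refl [] I = []
  deleted-Refl (a ∷ F) [] = []
  deleted-Refl (a ∷ F) (true ∷ I) = All.++⁺ (All-Refl-▷ (gen a) (deleted-Refl F I)) (Refl-gen a ∷ [])
  deleted-Refl (a ∷ F) (false ∷ I) = All-Refl-▷ (gen a) (deleted-Refl F I)

  deleted-eval : ∀ F I → length I ≡ length F → eval F ≡ prod (deleted F I) ∙ eval (outside F I)
  deleted-eval [] [] len = sym (idˡ _)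
  deleted-eval (a ∷ F) (true ∷ I) len = trans (eval-∷ a F)
      (trans (cong (gen a ∙_) (deleted-eval F I (ℕ.suc-injective len)))
    (trans (grp (y₀ ⊙ (x₀ ⊙ x₁)) (((y₀ ▸ x₀) ⊙ (y₀ ⊙ ι)) ⊙ x₁) (prod (deleted F I) ∷ eval (outside F I) ∷ [])
        (geni a ∷ []) refl)
      (cong (_∙ eval (outside F I)) (sym (trans (prod-++ (map (gen a ▷_) (deleted F I)) [ gen a ])
          (cong (_∙ (gen a ∙ 1g)) (prod-▷ (gen a) (deleted F I))))))))
  deleted-eval (a ∷ F) (false ∷ I) len = trans (eval-∷ a F)
      (trans (cong (gen a ∙_) (deleted-eval F I (ℕ.suc-injective len)))
    (trans (grp (y₀ ⊙ (x₀ ⊙ x₁)) ((y₀ ▸ x₀) ⊙ (y₀ ⊙ x₁)) (prod (deleted F I) ∷ eval (outside F I) ∷ [])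
        (geni a ∷ []) refl)
      (cong₂ _∙_ (sym (prod-▷ (gen a) (deleted F I))) (sym (eval-∷ a (outside F I))))))

  deleted-length : ∀ F I → length I ≡ length F → length (deleted F I) ℕ.+ length (outside F I) ≡ length F
  deleted-length [] [] len = refl
  deleted-length (a ∷ F) (true ∷ I) len = trans (cong (ℕ._+ length (outside F I))
      (trans (length-∷ʳ (map (gen a ▷_) (deleted F I)) (gen a)) (cong suc (length-map _ (deleted F I)))))
    (cong suc (deleted-length F I (ℕ.suc-injective len)))
  deleted-length (a ∷ F) (false ∷ I) len = trans (ℕ.+-suc _ _)
      (cong suc (trans (cong (ℕ._+ length (outside F I)) (length-map _ (deleted F I)))
      (deleted-length F I (ℕ.suc-injective len))))

  deleted-∷ : ∀ a F b I {t} → t ∈ deleted F I → gen a ▷ t ∈ deleted (a ∷ F) (b ∷ I)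
  deleted-∷ a F true I t∈ = ∈-++⁺ˡ (∈-map⁺ (gen a ▷_) t∈)
  deleted-∷ a F false I t∈ = ∈-map⁺ (gen a ▷_) t∈

  Marked-deletedQ : ∀ Q {I x} → Marked (labelsQ Q) I x → proj₁ x ∈ deleted Q I
  Marked-deletedQ (a ∷ Q) {I = true ∷ I} here = ∈-++⁺ʳ (map (gen a ▷_) (deleted Q I)) (here refl)
  Marked-deletedQ (a ∷ Q) {I = b ∷ I} (there p) with Marked-map⁻ (act a) (labelsQ Q) p
  ... | y , refl , q = subst (_∈ deleted (a ∷ Q) (b ∷ I)) (sym (act-▷ a y))
      (deleted-∷ a Q b I (Marked-deletedQ Q q))

  -- Labels are computed from the start of `Q`, deleted reflections from the start of the whole
  -- word, hence the conjugation by `eval c`.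
  Marked-deleted : ∀ c Q {I x} → Marked (labels c Q) I x → (x ∈ labelsC c) ⊎ (eval c ▷ proj₁ x ∈ deleted
      (c ++ Q) I)
  Marked-deleted [] Q {I} {x} p = inj₂ (subst (_∈ deleted Q I) (grp x₀ (ι ▸ x₀) (proj₁ x ∷ []) [] refl)
      (Marked-deletedQ Q p))
  Marked-deleted (a ∷ c) Q here = inj₁ (here refl)
  Marked-deleted (a ∷ c) Q {b ∷ I} {x} (there p) with Marked-deleted c Q p
  ... | inj₁ x∈ = inj₁ (there x∈)
  ... | inj₂ t∈ = inj₂ (subst (_∈ deleted (a ∷ c ++ Q) (b ∷ I)) (trans (sym (▷-∙ (gen a) (eval c) (proj₁ x)))
      (cong (_▷ proj₁ x) (sym (eval-∷ a c))))
        (deleted-∷ a (c ++ Q) b I t∈))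

  length-pow : ∀ k (σ : Fin n → Fin n) q → length (pow k σ q) ≡ k ℕ.* length q
  length-pow zero σ q = refl
  length-pow (suc k) σ q = trans (length-++ q) (cong (length q ℕ.+_) (trans (length-pow k σ (map σ q))
      (cong (k ℕ.*_) (length-map σ q))))

  Marked-++ʳ : ∀ {L I L' I' x} → length I ≡ length L → Marked L' I' x → Marked (L ++ L') (I ++ I') x
  Marked-++ʳ {[]} {[]} len p = p
  Marked-++ʳ {_ ∷ L} {_ ∷ I} len p = there (Marked-++ʳ (ℕ.suc-injective len) p)

  -- Faces containing α_s⁽ᵐ⁾

  module _ {s : Fin n} {c₁ : Word} (p₁ : s ∷ c₁ ↭ allFin n) where
    J : Fin n → Set
    J r = r ≢ s

    J⇒∈ : ∀ {r} → J r → r ∈ c₁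
    J⇒∈ {r} ne with ∈-resp-↭ (↭-sym p₁) (∈-allFin r)
    ... | here e = ⊥-elim (ne e)
    ... | there r∈ = r∈

    ∈⇒J : ∀ {r} → r ∈ c₁ → J r
    ∈⇒J r∈ refl = ∉-rest p₁ r∈

    c₁-unique : Unique c₁
    c₁-unique with unique p₁
    ... | _ ∷ uq = uq

    module C₁ = Base c₁ c₁-unique

    -- Once the first letter is deleted, the complement has product w∘ᵐ while the remaining word c₁
    -- w∘ᵐ(c) has product c₁ w∘ᵐ. So the other deleted reflections multiply to c₁, and counting
    -- gives one for each of its letters.
    face-parabolic : ∀ {w} (d : AllDescents w) σ (eσ : ∀ r → gen (σ r) ≡ w ▷ gen r) → ∀ {q} → Twist.Block d σ eσ
        q → ∀ {y} →
      (gen s , m) ≢ y → Twist.FaceOf d σ eσ (s ∷ c₁) q (m ℕ.* length q) (gen s , m) y → InW J (proj₁ y)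
    face-parabolic {w} d σ eσ {q} bl {y} ne (i ∷ I , len , o , e , ms , my) = go i my e o (first-marked i ms)
      where
      open Twist d σ eσ
      Q = pow m σ q
      -- Only the first position carries this label: the other letters of `c` belong to other
      -- generators, and the labels of `Q` have colours below `m`.
      first-marked : ∀ i → Marked (labels (s ∷ c₁) Q) (i ∷ I) (gen s , m) → i ≡ true
      first-marked true _ = refl
      first-marked false (there p) with ∈-++⁻ (labelsC c₁) (Marked-∈ p)
      ... | inj₂ x∈ = ⊥-elim (ℕ.<-irrefl refl (proj₂ (pow-label m bl x∈)))
      ... | inj₁ x∈ with ∈-map⁻ _ x∈
      ...   | r , r∈ , er = ⊥-elim (∈⇒J r∈ (sym (gen-injective (cong proj₁ er))))
      go : ∀ i → Marked (labels (s ∷ c₁) Q) (i ∷ I) y → eval (outside (s ∷ c₁ ++ Q) (i ∷ I)) ≡ power w m →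
           length (outside (s ∷ c₁ ++ Q) (i ∷ I)) ≡ m ℕ.* length q → i ≡ true → InW J (proj₁ y)
      go .true here e o refl = ⊥-elim (ne refl)
      go .true (there p) e o refl with Marked-deleted c₁ Q p
      ... | inj₁ x∈ with ∈-map⁻ _ x∈
      ...   | r , r∈ , refl = InW-gen (∈⇒J r∈)
      go .true (there p) e o refl | inj₂ t∈ = InW-▷⁻ (c₁ , refl , All.tabulate ∈⇒J)
          (weaken (All.lookup (proj₂ (minimal-factorisation c₁ c₁-unique (deleted (c₁ ++ Q) I)
              (deleted-Refl (c₁ ++ Q) I) product) count) t∈))
        where
        weaken : ∀ {t} → InW (_∈ c₁) t → InW J t
        weaken (u , eu , pu) = u , eu , All.map ∈⇒J pu
        product : prod (deleted (c₁ ++ Q) I) ≡ eval c₁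
        product = ∙-cancelʳ (power w m) (trans (cong (prod (deleted (c₁ ++ Q) I) ∙_) (sym e))
          (trans (sym (deleted-eval (c₁ ++ Q) I (ℕ.suc-injective len)))
              (trans (eval-++ c₁ Q) (cong (eval c₁ ∙_) (pow-eval m bl)))))
        count : length (deleted (c₁ ++ Q) I) ≡ length c₁
        count = ℕ.+-cancelʳ-≡ (m ℕ.* length q) (length (deleted (c₁ ++ Q) I)) (length c₁)
            (trans (cong (length (deleted (c₁ ++ Q) I) ℕ.+_) (sym o))
          (trans (deleted-length (c₁ ++ Q) I (ℕ.suc-injective len))
              (trans (length-++ c₁) (cong (length c₁ ℕ.+_) (length-pow m σ q)))))

    -- The walk through the cosets of W_J: letters that stay in the same coset
    -- are recorded as letters of J.
    data Walk (x : G) : Word → Word → G → Set where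
      done : Walk x [] [] x
      stay : ∀ {l r U Y xᵉ} → x ▷ gen l ≡ gen r → Walk x U Y xᵉ → Walk x (l ∷ U) (r ∷ Y) xᵉ
      leave : ∀ {l U Y xᵉ} → Walk (x ∙ gen l) U Y xᵉ → Walk x (l ∷ U) Y xᵉ

    stay-swap : ∀ {x l r} → x ▷ gen l ≡ gen r → x ∙ gen l ≡ gen r ∙ x
    stay-swap {x} {l} {r} e = trans (grp (x₀ ⊙ y₀) ((x₀ ▸ y₀) ⊙ x₀) (x ∷ []) (geni l ∷ []) refl) (cong (_∙ x) e)

    -- A mask on the recorded letters becomes a mask on `U` by never deleting a letter that leaves
    -- its coset. For a staying letter, x l = r x moves the coset representative past it.
    walk-lift : ∀ {x U Y xᵉ} → Walk x U Y xᵉ → ∀ I → length I ≡ length Y → Σ (List Bool)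
        λ I' → (length I' ≡ length U) ×
      (x ∙ eval (outside U I') ≡ eval (outside Y I) ∙ xᵉ) × (length (outside U I') ℕ.+ length Y ≡ length
          (outside Y I) ℕ.+ length U)
    walk-lift {x} done [] len = [] , refl , grp (x₀ ⊙ ι) (ι ⊙ x₀) (x ∷ []) [] refl , refl
    walk-lift {x} {l ∷ U} {r ∷ Y} {xᵉ} (stay e wk) (true ∷ I) len with walk-lift wk I (ℕ.suc-injective len)
    ... | I' , len' , ev , lo = true ∷ I' , cong suc len' , ev , trans (ℕ.+-suc _ _)
        (trans (cong suc lo) (sym (ℕ.+-suc _ _)))
    walk-lift {x} {l ∷ U} {r ∷ Y} {xᵉ} (stay e wk) (false ∷ I) len with walk-lift wk I (ℕ.suc-injective len)
    ... | I' , len' , ev , lo = false ∷ I' , cong suc len' , trans (cong (x ∙_) (eval-∷ l (outside U I')))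
        (trans (sym (assoc _ _ _)) (trans (cong (_∙ eval (outside U I')) (stay-swap e))
          (trans (assoc _ _ _) (trans (cong (gen r ∙_) ev) (trans (sym (assoc _ _ _))
              (cong (_∙ xᵉ) (sym (eval-∷ r (outside Y I))))))))) ,
          cong suc (trans (ℕ.+-suc _ _) (trans (cong suc lo) (sym (ℕ.+-suc _ _))))
    walk-lift {x} {l ∷ U} {Y} (leave wk) I len with walk-lift wk I len
    ... | I' , len' , ev , lo = false ∷ I' , cong suc len' , trans (cong (x ∙_) (eval-∷ l (outside U I')))
        (trans (sym (assoc _ _ _)) ev) ,
          trans (cong suc lo) (sym (ℕ.+-suc _ _))

    walk-eval : ∀ {x U Y xᵉ} → Walk x U Y xᵉ → x ∙ eval U ≡ eval Y ∙ xᵉ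
    walk-eval {x} done = grp (x₀ ⊙ ι) (ι ⊙ x₀) (x ∷ []) [] refl
    walk-eval {x} {l ∷ U} {r ∷ Y} {xᵉ} (stay e wk) = trans (cong (x ∙_) (eval-∷ l U)) (trans (sym (assoc _ _ _))
        (trans (cong (_∙ eval U) (stay-swap e))
      (trans (assoc _ _ _) (trans (cong (gen r ∙_) (walk-eval wk)) (trans (sym (assoc _ _ _))
          (cong (_∙ xᵉ) (sym (eval-∷ r Y))))))))
    walk-eval {x} {l ∷ U} (leave wk) = trans (cong (x ∙_) (eval-∷ l U))
        (trans (sym (assoc _ _ _)) (walk-eval wk))

    Minimalˡ : G → Set
    Minimalˡ x = ∀ j → J j → N x (gen j) ≡ false

    minimal-⁻¹ : ∀ {x} → Minimalˡ x → ∀ j → J j → ν (x ⁻¹) (gen j) ≡ false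
    minimal-⁻¹ {x} min j Jj = trans (sym (N≡ν⁻¹ x (gen j))) (min j Jj)

    -- The nontrivial half of Deodhar's lemma: x l can acquire a left descent `j` in J only through
    -- x l x⁻¹ = j, which is the case of staying.
    moved-minimal : ∀ {x} l → Minimalˡ x → (∀ j → J j → x ▷ gen l ≢ gen j) → Minimalˡ (x ∙ gen l)
    moved-minimal {x} l min ne j Jj = trans (N-∙ x (gen l) (gen j)) (cong₂ _xor_ (min j Jj) (trans (N-gen l _)
      (eqb-≢ {_} {gen l} λ e → ne j Jj (trans (cong (x ▷_) (sym e)) (▷-cancel′ x (gen j))))))

    stays? : ∀ x l → Dec (Σ (Fin n) λ j → J j × (x ▷ gen l ≡ gen j))
    stays? x l = any? λ j → (¬? (j ≟ s)) ×-dec (x ▷ gen l ≟ gen j)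

    -- As in descent-propagates: a letter q preceding r that does not commute with r
    -- would give a reflection avoiding l that inverts l.
    stay-initial : ∀ {x d e l r t₀} → IsCox d → N d (gen l) ≡ true → C₁.IsCox e → Refl t₀ → x ▷ d ≡ e ∙
        t₀ → Minimalˡ x →
      J r → x ▷ gen l ≡ gen r → N e (gen r) ≡ true
    stay-initial {x} {d} {e} {l} {r} {t₀} cd al (f , pf , refl) rt eq₀ min Jr er with ∈-∃++
        (∈-resp-↭ (↭-sym pf) (J⇒∈ Jr)) | first cd l al
    ... | f₁ , f₂ , refl | c₂ , p₂ , ed = trans (cong (λ y → N y (gen r)) (eval-commute r f₁ f₂ commutes))
          (N-first r (f₁ ++ f₂) (C₁.∉-rest (↭-trans (↭-sym (shift r f₁ f₂)) pf)))
      where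
      g = x ⁻¹
      g▷r : g ▷ gen r ≡ gen l
      g▷r = trans (cong (g ▷_) (sym er)) (▷-cancel x (gen l))
      commutes : All (Comm r) f₁
      commutes = All.tabulate λ {q} q∈ → go q (Comm? r q) (∈-∃++ q∈)
        where
        go : ∀ q → Dec (Comm r q) → (Σ Word λ D₁ → Σ Word λ D₂ → f₁ ≡ D₁ ++ [ q ] ++ D₂) → Comm r q
        go q (yes c) _ = c
        go q (no nc) (D₁ , D₂ , ef) = ⊥-elim (∉-rest p₂ (InW-gen⁻ {_∈ c₂} (InW-ν y∈ inverted)))
          where
          eq : f₁ ++ r ∷ f₂ ≡ D₁ ++ q ∷ D₂ ++ r ∷ f₂
          eq = trans (cong (_++ r ∷ f₂) ef) (++-assoc D₁ (q ∷ D₂) (r ∷ f₂))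
          Jq : J q
          Jq = ∈⇒J (∈-resp-↭ pf (subst (q ∈_) (sym eq) (∈-middle D₁)))
          y = g ▷ gen r ▷ gen q
          L = pairFactors q r D₁ D₂ f₂
          ts = map (g ▷_) L ++ [ g ▷ t₀ ]
          inverted : ν y (gen l) ≡ true
          inverted = trans (cong (ν y) (sym g▷r)) (ν-conjugate-minimal {J} g (minimal-⁻¹ min) Jr Jq nc)
          -- Conjugating the equation for e t₀ back by x⁻¹ gives a factorisation of the current
          -- Coxeter element of W into n reflections that starts with `l`, as `suffix-parabolic`
          -- requires.
          product : gen l ∙ (y ∙ prod ts) ≡ eval (l ∷ c₂)
          product = trans (cong₂ (λ a b → a ∙ (y ∙ b)) (sym g▷r) (trans (prod-++ (map (g ▷_) L) [ g ▷ t₀ ])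
              (cong (_∙ ((g ▷ t₀) ∙ 1g)) (prod-▷ g L))))
            (trans (grp ((x₀ ▸ y₀) ⊙ ((x₀ ▸ y₀ ▸ y₁) ⊙ ((x₀ ▸ x₁) ⊙ ((x₀ ▸ x₂) ⊙ ι))))
                (x₀ ▸ ((y₁ ⊙ (y₀ ⊙ x₁)) ⊙ x₂)) (g ∷ prod L ∷ t₀ ∷ []) (geni r ∷ geni q ∷ []) refl)
            (trans (cong (λ a → g ▷ (a ∙ t₀)) (trans (prod-pairFactors q r D₁ D₂ f₂) (cong eval (sym eq))))
            (trans (cong (g ▷_) (sym eq₀)) (trans (▷-cancel x d) (sym ed)))))
          y∈ : InW (_∈ c₂) y
          y∈ = suffix-parabolic p₂ y ts (Refl-▷ g (Refl-▷ (gen r) (Refl-gen q)) ∷ All.++⁺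
              (All-Refl-▷ g (pairFactors-Refl q r D₁ D₂ f₂)) (Refl-▷ g rt ∷ []))
            (trans (cong (λ k → suc (suc k)) (trans (length-∷ʳ (map (g ▷_) L) (g ▷ t₀))
                (cong suc (length-map (g ▷_) L))))
              (trans (cong suc (trans (length-pairFactors q r D₁ D₂ f₂)
                  (trans (cong length (sym eq)) (↭-length pf)))) (↭-length p₁))) product

    -- The invariant is x d x⁻¹ = e t₀ with `e` a Coxeter element of W_⟨s⟩ and `t₀` a reflection. A
    -- leaving letter changes `x` and `d` only; a staying letter rotates `d` and, by its image in J,
    -- also `e`. So the recorded word is alternating for `e`.
    walk : ∀ U {x d e t₀ l} → IsCox d → Alt d (U ++ [ l ]) → C₁.IsCox e → Refl t₀ → x ▷ d ≡ e ∙ t₀ → Minimalˡ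
        x →
      InW J ((x ∙ eval U) ▷ gen l) → Σ Word λ Y → Σ G λ xᵉ → Σ (Fin n) λ r → Walk x U Y xᵉ × Alt e
          (Y ++ [ r ]) × (xᵉ ▷ gen l ≡ gen r)
    walk [] {x} {d} {e} {t₀} {l} cd (al ∷ _) ce rt eq₀ min target with stays? x l
    ... | yes (r , Jr , er) = [] , x , r , done , stay-initial cd al ce rt eq₀ min Jr er ∷ [] , er
    -- If the last letter left its coset, x l would be a minimal representative and yet invert x l
    -- x⁻¹, a reflection of W_⟨s⟩.
    ... | no none = ⊥-elim (true≢false (trans (sym crossing) (trans (N≡ν⁻¹ (x ∙ gen l) (x ▷ gen l))
          (ν-minimal {J} _ (minimal-⁻¹ (moved-minimal l min λ j Jj e → none (j , Jj , e))) (x ▷ gen l)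
              (Refl-▷ x (Refl-gen l)) target'))))
      where
      target' : InW J (x ▷ gen l)
      target' = subst (InW J) (cong (_▷ gen l) (idʳ x)) target
      crossing : N (x ∙ gen l) (x ▷ gen l) ≡ true
      crossing = trans (N-∙ x (gen l) (x ▷ gen l)) (cong₂ _xor_
        (trans (N≡ν⁻¹ x _) (ν-minimal {J} _ (minimal-⁻¹ min) (x ▷ gen l) (Refl-▷ x (Refl-gen l)) target'))
        (trans (cong (N (gen l)) (▷-cancel x (gen l))) (trans (N-gen l (gen l)) (eqb-refl (gen l)))))
    walk (a ∷ U) {x} {d} {e} {t₀} {l} cd (aa ∷ as) ce rt eq₀ min target with stays? x a
    ... | yes (b , Jb , eb) with walk U (IsCox-rotate a cd aa) as (C₁.IsCox-rotate b ce ib) (Refl-▷ (gen b) rt)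
        eq₁ min target'
      where
      ib : N e (gen b) ≡ true
      ib = stay-initial cd aa ce rt eq₀ min Jb eb
      eq₁ : x ▷ gen a ▷ d ≡ (gen b ▷ e) ∙ (gen b ▷ t₀)
      eq₁ = trans (sym (▷-∙ x (gen a) d)) (trans (cong (_▷ d) (stay-swap eb)) (trans (▷-∙ (gen b) x d)
          (trans (cong (gen b ▷_) eq₀)
        (grp (x₀ ▸ (x₁ ⊙ x₂)) ((x₀ ▸ x₁) ⊙ (x₀ ▸ x₂)) (gen b ∷ e ∷ t₀ ∷ []) [] refl))))
      target' : InW J ((x ∙ eval U) ▷ gen l)
      target' = InW-▷⁻ (InW-gen Jb) (subst (InW J)
          (trans (cong (_▷ gen l) (trans (cong (x ∙_) (eval-∷ a U)) (trans (sym (assoc _ _ _))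
        (trans (cong (_∙ eval U) (stay-swap eb)) (assoc _ _ _))))) (▷-∙ (gen b) (x ∙ eval U) (gen l))) target)
    ...   | Y , xᵉ , r , wk , as' , er = b ∷ Y , xᵉ , r , stay eb wk , stay-initial cd aa ce rt eq₀ min Jb eb ∷
        as' , er
    walk (a ∷ U) {x} {d} {e} {t₀} {l} cd (aa ∷ as) ce rt eq₀ min target | no none
      with walk U {x ∙ gen a} (IsCox-rotate a cd aa) as ce rt
          (trans (grp ((x₀ ⊙ y₀) ▸ (y₀ ▸ x₁)) (x₀ ▸ x₁) (x ∷ d ∷ []) (geni a ∷ []) refl) eq₀)
             (moved-minimal a min λ j Jj e → none (j , Jj , e)) (subst (λ y → InW J (y ▷ gen l))
                 (trans (cong (x ∙_) (eval-∷ a U)) (sym (assoc _ _ _))) target)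
    ... | Y , xᵉ , r , wk , as' , er = Y , xᵉ , r , leave wk , as' , er

    -- The facet of the first |f| letters, moved along the alternating word Z until
    -- it ends with r.
    window : ∀ Z r f → f ↭ c₁ → Alt (eval f) (Z ++ [ r ]) → Σ (List Bool) λ I → (length I ≡ length (f ++ Z)) ×
      (eval (outside (f ++ Z) I) ≡ eval (Z ++ [ r ])) × (length (outside (f ++ Z) I) ≡ suc (length Z))
    window [] r f pf (ar ∷ _) with initial-split f r (C₁.unique pf) ar
    ... | u , v , refl , _ = replicate (length u) true ++ false ∷ replicate (length v) true ,
          trans (length-++ (replicate (length u) true))
              (trans (cong₂ (λ a b → a ℕ.+ suc b) (length-replicate (length u)) (length-replicate (length v)))
            (trans (sym (length-++ u {r ∷ v})) (cong length (sym (++-identityʳ (u ++ r ∷ v)))))) ,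
          cong eval out , cong length out
      where
      out : outside ((u ++ r ∷ v) ++ []) (replicate (length u) true ++ false ∷ replicate (length v) true) ≡ [ r
          ]
      out rewrite ++-identityʳ (u ++ r ∷ v) | outside-++ u {r ∷ v} (replicate (length u) true)
          {false ∷ replicate (length v) true} (length-replicate (length u))
                | outside-all u | outside-all v = refl
    window (z ∷ Z) r f pf (az ∷ as) with initial-split f z (C₁.unique pf) az
    ... | u , v , refl , cs with window Z r ((u ++ v) ++ [ z ]) (C₁.rotate-↭ (↭-trans (↭-sym (shift z u v)) pf))
            (subst (λ g → Alt g (Z ++ [ r ])) (trans (cong (gen z ▷_) (eval-commute z u v cs))
                (sym (eval-rotate z (u ++ v)))) as)
    ...   | I , len , ev , lo with split-at I (length u) (v ++ z ∷ Z)
        (trans len (trans (cong length eqF) (length-++ u)))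
      where
      eqF : ((u ++ v) ++ [ z ]) ++ Z ≡ u ++ v ++ z ∷ Z
      eqF = trans (++-assoc (u ++ v) [ z ] Z) (++-assoc u v (z ∷ Z))
    ...     | Iu , Iv , refl , lu , lv = Iu ++ false ∷ Iv ,
              trans (length-++ Iu) (trans (cong₂ (λ a b → a ℕ.+ suc b) lu lv) (trans (sym (length-++ u))
                  (cong length (sym eqF')))) ,
              trans (cong eval out') (trans (eval-commute z O₁ O₂ (outside-All u Iu cs))
                  (trans (eval-∷ z (O₁ ++ O₂))
                (trans (cong (gen z ∙_) (trans (cong eval (sym out)) ev)) (sym (eval-∷ z (Z ++ [ r ])))))) ,
              trans (cong length out') (trans (sym (length-delete O₁ z O₂))
                  (cong suc (trans (cong length (sym out)) lo)))
      where
      O₁ = outside u Iu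
      O₂ = outside (v ++ z ∷ Z) Iv
      eqF : ((u ++ v) ++ [ z ]) ++ Z ≡ u ++ v ++ z ∷ Z
      eqF = trans (++-assoc (u ++ v) [ z ] Z) (++-assoc u v (z ∷ Z))
      eqF' : (u ++ z ∷ v) ++ z ∷ Z ≡ u ++ z ∷ v ++ z ∷ Z
      eqF' = ++-assoc u (z ∷ v) (z ∷ Z)
      out : outside (((u ++ v) ++ [ z ]) ++ Z) (Iu ++ Iv) ≡ O₁ ++ O₂
      out = trans (cong (λ F → outside F (Iu ++ Iv)) eqF) (outside-++ u Iu lu)
      out' : outside ((u ++ z ∷ v) ++ z ∷ Z) (Iu ++ false ∷ Iv) ≡ O₁ ++ z ∷ O₂
      out' = trans (cong (λ F → outside F (Iu ++ false ∷ Iv)) eqF') (outside-++ u Iu lu)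

    parabolic-face-top : ∀ {w} (d : AllDescents w) σ (eσ : ∀ r → gen (σ r) ≡ w ▷ gen r) → ∀ {q} → Twist.Block d
        σ eσ q → ∀ {r} → J r →
      Twist.FaceOf d σ eσ (s ∷ c₁) q (m ℕ.* length q) (gen s , m) (gen r , m)
    parabolic-face-top {w} d σ eσ {q} bl {r} Jr = I , len ,
        trans (cong length out) (length-pow m σ q) , trans (cong eval out) (pow-eval m bl) , here , there
            (marked c₁ (J⇒∈ Jr))
      where
      open Twist d σ eσ
      Q = pow m σ q
      I = replicate (length (s ∷ c₁)) true ++ replicate (length Q) false
      len : length I ≡ length ((s ∷ c₁) ++ Q)
      len = trans (length-++ (replicate (length (s ∷ c₁)) true))
          (trans (cong₂ ℕ._+_ (length-replicate (length (s ∷ c₁))) (length-replicate (length Q)))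
          (sym (length-++ (s ∷ c₁))))
      out : outside ((s ∷ c₁) ++ Q) I ≡ Q
      out = trans (outside-++ (s ∷ c₁) (replicate (length (s ∷ c₁)) true) (length-replicate (length (s ∷ c₁))))
          (cong₂ _++_ (outside-all (s ∷ c₁)) (outside-none Q))
      marked : ∀ c {L} → r ∈ c → Marked (labelsC c ++ L) (replicate (length c) true ++ replicate (length Q)
          false) (gen r , m)
      marked (a ∷ c) (here refl) = here
      marked (a ∷ c) (there r∈) = there (marked c r∈)

    -- Let U l be the part of w∘ᵐ(c) up to the position labelled β⁽ᵏ⁾. The walk turns it into an
    -- alternating word Y r for c₁; `window` gives a mask on c₁ Y whose complement multiplies to Y
    -- r; lifted to c₁ U, it allows `s` and `l` to be deleted.
    parabolic-face : ∀ {w} (d : AllDescents w) σ (eσ : ∀ r → gen (σ r) ≡ w ▷ gen r) → ∀ {A} → Twist.Block d σ eσ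
        A → Alt (eval (s ∷ c₁)) A →
      ∀ {β k} → Refl β → InW J β → k < m → Twist.FaceOf d σ eσ (s ∷ c₁) A (m ℕ.* length A) (gen s , m) (β , k)
    parabolic-face {w} d σ eσ {A} bl as {β} {k} rβ Jβ k<m with Twist.pow-label⁻ d σ eσ m bl rβ k<m
    ... | U , l , V , eQ , el with walk U {1g} {eval (s ∷ c₁)} {eval c₁} {eval c₁ ⁻¹ ▷ gen s} {l}
        (s ∷ c₁ , p₁ , refl) altU (c₁ , ↭-refl , refl)
            (Refl-▷ _ (Refl-gen s)) start (λ j _ → N-1 (gen j)) target
      where
      open Twist d σ eσ
      altU : Alt (eval (s ∷ c₁)) (U ++ [ l ])
      altU = Alt-++⁻ˡ (U ++ [ l ]) (subst (Alt (eval (s ∷ c₁))) (trans eQ (sym (++-assoc U [ l ] V)))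
          (pow-Alt m bl as))
      start : 1g ▷ eval (s ∷ c₁) ≡ eval c₁ ∙ (eval c₁ ⁻¹ ▷ gen s)
      start = trans (cong (1g ▷_) (eval-∷ s c₁)) (grp (ι ▸ (y₀ ⊙ x₀)) (x₀ ⊙ (x₀ ⁱ ▸ y₀)) (eval c₁ ∷ [])
          (geni s ∷ []) refl)
      target : InW J ((1g ∙ eval U) ▷ gen l)
      target = subst (InW J) (trans (sym (cong proj₁ el)) (trans (apply-▷ U (gen l , 0))
          (cong (_▷ gen l) (sym (idˡ (eval U)))))) Jβ
    ...   | Y , xᵉ , r , wk , asY , er with window Y r c₁ ↭-refl asY
    ...     | I , lenI , evI , loI with split-at I (length c₁) Y (trans lenI (length-++ c₁))
    ...       | Ic , IY , refl , lc , lY with walk-lift wk IY lY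
    ...         | IU , lU , evU , loU = subst (λ Q → Face (s ∷ c₁ ++ Q) (labels (s ∷ c₁) Q) (m ℕ.* length A)
        (power w m) (gen s , m) (β , k)) (sym eQ)
                  (true ∷ Ic ++ IU ++ true ∷ IV , cong suc lenT , trans (cong length out) count , trans
                      (cong eval out) product , here ,
                   there (Marked-++ʳ {labelsC c₁} {Ic} (trans lc (sym (length-map _ c₁)))
                       (subst (λ L → Marked L (IU ++ true ∷ IV) (β , k)) (sym (labelsQ-++ U (l ∷ V)))
                     (Marked-++ʳ {labelsQ U} {IU} (trans lU (sym (length-labelsQ U)))
                         (subst (λ y → Marked (map (apply U) (labelsQ (l ∷ V))) (true ∷ IV) y) el here)))))
      where
      open Twist d σ eσ
      IV = replicate (length V) false
      Oc = outside c₁ Ic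
      OU = outside U IU
      OY = outside Y IY
      lenT : length (Ic ++ IU ++ true ∷ IV) ≡ length (c₁ ++ U ++ l ∷ V)
      lenT = trans (length-++ Ic) (trans (cong₂ ℕ._+_ lc
          (trans (length-++ IU) (trans (cong₂ (λ a b → a ℕ.+ suc b) lU (length-replicate (length V)))
          (sym (length-++ U))))) (sym (length-++ c₁)))
      out : outside (c₁ ++ U ++ l ∷ V) (Ic ++ IU ++ true ∷ IV) ≡ Oc ++ OU ++ V
      out = trans (outside-++ c₁ Ic lc) (cong (Oc ++_) (trans (outside-++ U IU lU)
          (cong (OU ++_) (outside-none V))))
      outY : outside (c₁ ++ Y) (Ic ++ IY) ≡ Oc ++ OY
      outY = outside-++ c₁ Ic lc
      -- The lifted complement multiplies to Y r xᵉ = Y xᵉ l = U l, so it makes up for the deleted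
      -- `l`, and the rest `V` completes w∘ᵐ.
      product : eval (Oc ++ OU ++ V) ≡ power w m
      product = trans (eval-++ Oc (OU ++ V)) (trans
          (cong (eval Oc ∙_) (trans (eval-++ OU V) (cong (_∙ eval V) (trans (sym (idˡ _)) evU))))
        (trans (grp (x₀ ⊙ ((x₁ ⊙ x₂) ⊙ x₃)) ((x₀ ⊙ x₁) ⊙ (x₂ ⊙ x₃)) (eval Oc ∷ eval OY ∷ xᵉ ∷ eval V ∷ []) []
            refl)
        (trans (cong (_∙ (xᵉ ∙ eval V)) (trans (sym (eval-++ Oc OY)) (trans (cong eval (sym outY))
            (trans evI (eval-++ Y [ r ])))))
        (trans (cong (λ y → (eval Y ∙ y) ∙ (xᵉ ∙ eval V)) (sym er))
        (trans (grp ((x₀ ⊙ (x₁ ▸ y₀)) ⊙ (x₁ ⊙ x₂)) ((x₀ ⊙ x₁) ⊙ (y₀ ⊙ x₂)) (eval Y ∷ xᵉ ∷ eval V ∷ [])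
            (geni l ∷ []) refl)
        (trans (cong (_∙ (gen l ∙ eval V)) (trans (sym (walk-eval wk)) (idˡ (eval U))))
        (trans (sym (eval-split U l V)) (trans (cong eval (sym eQ)) (pow-eval m bl)))))))))
      count : length (Oc ++ OU ++ V) ≡ m ℕ.* length A
      count = trans (length-++ Oc) (trans (cong (length Oc ℕ.+_) (length-++ OU))
          (trans (sym (ℕ.+-assoc (length Oc) (length OU) (length V)))
        (trans (cong (ℕ._+ length V) step) (trans (sym (trans (length-++ U) (ℕ.+-suc (length U) (length V))))
            (trans (cong length (sym eQ)) (length-pow m σ A))))))
        where
        step : length Oc ℕ.+ length OU ≡ suc (length U)
        step = ℕ.+-cancelʳ-≡ (length Y) _ _ (trans (ℕ.+-assoc (length Oc) _ _)
            (trans (cong (length Oc ℕ.+_) loU) (trans (sym (ℕ.+-assoc (length Oc) _ _))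
          (trans (cong (ℕ._+ length U) (trans (sym (length-++ Oc)) (trans (cong length (sym outY)) loI)))
              (cong suc (ℕ.+-comm (length Y) (length U)))))))

  -- From words to group elements

  root : ColRoot → Root
  root (t , k) = eval t , k

  root⁻¹ : Root → ColRoot
  root⁻¹ (g , k) = rep g , k

  root-root⁻¹ : ∀ x → root (root⁻¹ x) ≡ x
  root-root⁻¹ (g , k) = cong (_, k) (eval-rep g)

  CEq⇒≡ : ∀ {x y} → CEq x y → root x ≡ root y
  CEq⇒≡ (e , refl) = cong (_, _) (eval-cong e)

  ≡⇒CEq : ∀ {x y} → root x ≡ root y → CEq x y
  ≡⇒CEq e = eval-sound (cong proj₁ e) , cong proj₂ e

  eval-conj : ∀ s t → eval (s ∷ t ++ [ s ]) ≡ gen s ▷ eval t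
  eval-conj s t = trans (eval-∷ s (t ++ [ s ]))
      (cong (gen s ∙_) (trans (eval-++ t [ s ]) (cong (eval t ∙_) (sym (⁻¹-gen s)))))

  Act⇒≡ : ∀ s {x y} → Act s x y → root y ≡ act s (root x)
  Act⇒≡ s {t , k} {y} (inj₁ (e , c)) = trans (CEq⇒≡ c) (sym
      (trans (cong (λ g → act s (g , k)) (eval-cong e)) (act-self s k)))
  Act⇒≡ s {t , k} {y} (inj₂ (ne , c)) = trans (CEq⇒≡ c)
      (trans (cong (_, k) (eval-conj s t)) (sym (act-other s (eval t) k (λ e → ne (eval-sound e)))))

  ≡⇒Act : ∀ s {x y} → root y ≡ act s (root x) → Act s x y
  ≡⇒Act s {t , k} {y} e with eval t ≟ gen s
  ... | yes e' = inj₁ (eval-sound e' , ≡⇒CEq {y} {[ s ] , suc k} e)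
  ... | no ne = inj₂ ((λ e' → ne (eval-cong e')) , ≡⇒CEq {y} {s ∷ t ++ [ s ] , k}
      (trans e (cong (_, k) (sym (eval-conj s t)))))

  ApplyWord⇒≡ : ∀ u {x y} → ApplyWord u x y → root y ≡ apply u (root x)
  ApplyWord⇒≡ [] {x} {y} c = sym (CEq⇒≡ {x} {y} c)
  ApplyWord⇒≡ (t ∷ u) {x} {y} (z , a , c) = trans (Act⇒≡ t {z} {y} c) (cong (act t) (ApplyWord⇒≡ u {x} {z} a))

  ≡⇒ApplyWord : ∀ u {x y} → root y ≡ apply u (root x) → ApplyWord u x y
  ≡⇒ApplyWord [] {x} {y} e = ≡⇒CEq {x} {y} (sym e)
  ≡⇒ApplyWord (t ∷ u) {x} {y} e = root⁻¹ (apply u (root x)) , ≡⇒ApplyWord u {x} (root-root⁻¹ _) ,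
    ≡⇒Act t {_} {y} (trans e (cong (act t) (sym (root-root⁻¹ _))))

  Tau⇒≡ : ∀ s {x y} → Tau s x y → root y ≡ τ s (root x)
  Tau⇒≡ s {t , k} {y} (inj₁ (e , refl , c)) = trans (CEq⇒≡ {y} c) (sym
      (trans (cong (λ g → τ s (g , 0)) (eval-cong e)) (τ-zero s)))
  Tau⇒≡ s {t , k} {y} (inj₂ (inj₁ (e , k' , refl , c))) = trans (CEq⇒≡ {y} c) (sym
      (trans (cong (λ g → τ s (g , suc k')) (eval-cong e)) (τ-suc s k')))
  Tau⇒≡ s {t , k} {y} (inj₂ (inj₂ (inj₁ (ne , refl , c)))) = trans (CEq⇒≡ {y} c)
      (sym (τ-top s (eval t) (λ e → ne (eval-sound e))))
  Tau⇒≡ s {t , k} {y} (inj₂ (inj₂ (inj₂ (ne , nk , c)))) = trans (CEq⇒≡ {y} c)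
      (trans (cong (_, k) (eval-conj s t)) (sym (τ-low s (eval t) k (λ e → ne (eval-sound e)) nk)))

  ≡⇒Tau : ∀ s x {y} → root y ≡ τ s (root x) → Tau s x y
  ≡⇒Tau s (t , k) {y} e = go (eval t ≟ gen s) k e
    where
    go : Dec (eval t ≡ gen s) → ∀ k → root y ≡ τ s (eval t , k) → Tau s (t , k) y
    go (yes e') zero e = inj₁ (eval-sound e' , refl , ≡⇒CEq {y} {[ s ] , m}
        (trans e (trans (cong (λ g → τ s (g , 0)) e') (τ-zero s))))
    go (yes e') (suc k) e = inj₂ (inj₁ (eval-sound e' , k , refl , ≡⇒CEq {y} {[ s ] , k}
        (trans e (trans (cong (λ g → τ s (g , suc k)) e') (τ-suc s k)))))
    go (no ne) k e with k ℕ.≟ m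
    ... | yes refl = inj₂ (inj₂ (inj₁ ((λ e' → ne (eval-cong e')) , refl , ≡⇒CEq {y} {t , m}
        (trans e (τ-top s (eval t) ne)))))
    ... | no nk = inj₂ (inj₂ (inj₂ ((λ e' → ne (eval-cong e')) , nk , ≡⇒CEq {y} {s ∷ t ++ [ s ] , k}
        (trans e (trans (τ-low s (eval t) k ne nk) (cong (_, k) (sym (eval-conj s t))))))))

  ValidRoot : Root → Set
  ValidRoot (t , k) = Refl t × ((k < m) ⊎ ((k ≡ m) × Σ (Fin n) λ s → t ≡ gen s))

  Valid⇒ : ∀ {x} → Valid x → ValidRoot (root x)
  Valid⇒ {t , k} ((u , s , e) , c) = (eval u , s , trans (eval-cong e) (trans (eval-split u s (reverse u))
      (cong (λ g → eval u ∙ (gen s ∙ g)) (eval-reverse u)))) , color c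
    where
    color : (k < m) ⊎ ((k ≡ m) × Σ (Fin n) λ s → t ≈ [ s ]) → (k < m) ⊎ ((k ≡ m) × Σ (Fin n) λ s → eval t ≡ gen
        s)
    color (inj₁ lt) = inj₁ lt
    color (inj₂ (e , s , e')) = inj₂ (e , s , eval-cong e')

  ⇒Valid : ∀ {x} → ValidRoot (root x) → Valid x
  ⇒Valid {t , k} ((g , s , e) , c) = (rep g , s , eval-sound
      (trans e (sym (trans (eval-split (rep g) s (reverse (rep g)))
      (cong₂ (λ a b → a ∙ (gen s ∙ b)) (eval-rep g) (trans (eval-reverse (rep g)) (cong _⁻¹ (eval-rep g))))))))
          , color c
    where
    color : (k < m) ⊎ ((k ≡ m) × Σ (Fin n) λ s → eval t ≡ gen s) → (k < m) ⊎ ((k ≡ m) × Σ (Fin n) λ s → t ≈ [ s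
        ])
    color (inj₁ lt) = inj₁ lt
    color (inj₂ (e , s , e')) = inj₂ (e , s , eval-sound e')

  valid-color : ∀ {x} → ValidRoot x → proj₂ x ≤ m
  valid-color (_ , inj₁ lt) = ℕ.<⇒≤ lt
  valid-color (_ , inj₂ (e , _)) = ℕ.≤-reflexive e

  τ-valid : ∀ s {x} → ValidRoot x → ValidRoot (τ s x)
  τ-valid s {t , k} v@(r , c) = go (t ≟ gen s) k (valid-color v) c
    where
    go : Dec (t ≡ gen s) → ∀ k → k ≤ m → (k < m) ⊎ ((k ≡ m) × Σ (Fin n) λ s → t ≡ gen s) → ValidRoot
        (τ s (t , k))
    go (yes refl) zero le c = subst ValidRoot (sym (τ-zero s)) (Refl-gen s , inj₂ (refl , s , refl))
    go (yes refl) (suc k) le c = subst ValidRoot (sym (τ-suc s k)) (Refl-gen s , inj₁ le)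
    go (no ne) k le (inj₁ lt) = subst ValidRoot (sym (τ-low s t k ne (ℕ.<⇒≢ lt))) (Refl-▷ (gen s) r , inj₁ lt)
    go (no ne) k le (inj₂ (refl , simple)) = subst ValidRoot (sym (τ-top s t ne)) (r , inj₂ (refl , simple))

  At-labelsQ : ∀ Q p x → (Σ (Fin n) λ t → At Q p t × (x ≡ apply (take p Q) (gen t , 0))) ⇔ At (labelsQ Q) p x
  At-labelsQ Q p x = mk⇔ (to Q p) (from Q p)
    where
    At-map : ∀ (f : Root → Root) L p {y} → At L p y → At (map f L) p (f y)
    At-map f (_ ∷ L) zero refl = refl
    At-map f (_ ∷ L) (suc p) a = At-map f L p a
    At-map⁻ : ∀ (f : Root → Root) L p {y} → At (map f L) p y → Σ Root λ z → At L p z × (y ≡ f z)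
    At-map⁻ f (z ∷ L) zero refl = z , refl , refl
    At-map⁻ f (_ ∷ L) (suc p) a = At-map⁻ f L p a
    to : ∀ Q p {x} → (Σ (Fin n) λ t → At Q p t × (x ≡ apply (take p Q) (gen t , 0))) → At (labelsQ Q) p x
    to (a ∷ Q) zero (t , refl , refl) = refl
    to (a ∷ Q) (suc p) (t , at , refl) = At-map (act a) (labelsQ Q) p (to Q p (t , at , refl))
    from : ∀ Q p {x} → At (labelsQ Q) p x → Σ (Fin n) λ t → At Q p t × (x ≡ apply (take p Q) (gen t , 0))
    from (a ∷ Q) zero refl = a , refl , refl
    from (a ∷ Q) (suc p) at with At-map⁻ (act a) (labelsQ Q) p at
    ... | z , az , refl with from Q p az
    ...   | t , at' , refl = t , at' , refl

  Label⇒At : ∀ c Q p {x} → Label c Q p x → At (labels c Q) p (root x)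
  Label⇒At c Q p {x} (inj₁ (lt , s , at , e)) = go c p lt at
    where
    go : ∀ c p → p < length c → At c p s → At (labels c Q) p (root x)
    go (_ ∷ c) zero lt refl = sym (CEq⇒≡ {x} e)
    go (_ ∷ c) (suc p) (s≤s lt) at = go c p lt at
  Label⇒At c Q p {x} (inj₂ (le , t , at , ap)) = go c p le
      (Equivalence.to (At-labelsQ Q (p ℕ.∸ length c) (root x)) (t , at , ApplyWord⇒≡ (take (p ℕ.∸ length c) Q)
      {[ t ] , 0} {x} ap))
    where
    go : ∀ c p → length c ≤ p → At (labelsQ Q) (p ℕ.∸ length c) (root x) → At (labels c Q) p (root x)
    go [] p le a = a
    go (_ ∷ c) (suc p) (s≤s le) a = go c p le a

  At⇒Label : ∀ c Q p {x} → At (labels c Q) p (root x) → Label c Q p x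
  At⇒Label c Q p {x} a = go (p ℕ.<? length c)
    where
    top : ∀ c p → p < length c → At (labels c Q) p (root x) → Σ (Fin n) λ s → At c p s × CEq x ([ s ] , m)
    top (s ∷ c) zero lt e = s , refl , ≡⇒CEq {x} {[ s ] , m} (sym e)
    top (_ ∷ c) (suc p) (s≤s lt) a = top c p lt a
    low : ∀ c p → length c ≤ p → At (labels c Q) p (root x) → At (labelsQ Q) (p ℕ.∸ length c) (root x)
    low [] p le a = a
    low (_ ∷ c) (suc p) (s≤s le) a = low c p le a
    go : Dec (p < length c) → Label c Q p x
    go (yes lt) = inj₁ (lt , top c p lt a)
    go (no nlt) with Equivalence.from (At-labelsQ Q (p ℕ.∸ length c) (root x)) (low c p (ℕ.≮⇒≥ nlt) a)
    ... | t , at , e = inj₂ (ℕ.≮⇒≥ nlt , t , at , ≡⇒ApplyWord (take (p ℕ.∸ length c) Q) {[ t ] , 0} {x} e)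

  At⇒Marked : ∀ L I p {x} → At I p true → At L p x → Marked L I x
  At⇒Marked (_ ∷ L) (_ ∷ I) zero refl refl = here
  At⇒Marked (_ ∷ L) (_ ∷ I) (suc p) a b = there (At⇒Marked L I p a b)

  Marked⇒At : ∀ {L I x} → Marked L I x → Σ ℕ λ p → At I p true × At L p x
  Marked⇒At here = 0 , refl , refl
  Marked⇒At (there q) with Marked⇒At q
  ... | p , a , b = suc p , a , b

  eval-replicate : ∀ k w → eval (concat (replicate k w)) ≡ power (eval w) k
  eval-replicate zero w = refl
  eval-replicate (suc k) w = trans (eval-++ w _) (cong (eval w ∙_) (eval-replicate k w))

  record Situation (c : Word) (X Y : Root) : Set where
    constructor situation
    field
      {w0}    : Word
      longest : IsLongest w0
      {σ}     : Fin n → Fin n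
      twisted : ∀ t → (w0 ++ t ∷ w0) ≈ [ σ t ]
      {q}     : Word
      sorting : W0c c w0 q
      face    : Face (c ++ pow m σ q) (labels c (pow m σ q)) (m ℕ.* length w0) (power (eval w0) m) X Y

  Compat⇒ : ∀ {c x y} → Compat c x y → (root x ≢ root y) × Situation c (root x) (root y)
  Compat⇒ {c} {x} {y} (ne , w0 , lg , σ , tw , q , wq , I , (len , lo , e) , p , p' , ap , ap' , lp , lp') =
    (λ e → ne (≡⇒CEq {x} {y} e)) , situation lg tw wq (I , len , lo , trans (eval-cong e)
        (eval-replicate m w0) ,
      At⇒Marked _ I p ap (Label⇒At c (pow m σ q) p {x} lp) , At⇒Marked _ I p' ap' (Label⇒At c (pow m σ q) p' {y}
          lp'))

  ⇒Compat : ∀ {c x y} → root x ≢ root y → Situation c (root x) (root y) → Compat c x y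
  ⇒Compat {c} {x} {y} ne (situation {w0} lg {σ} tw {q} wq (I , len , lo , e , mx , my)) with Marked⇒At mx |
      Marked⇒At my
  ... | p , ap , lp | p' , ap' , lp' = (λ e → ne (CEq⇒≡ {x} {y} e)) , w0 , lg , σ , tw , q , wq , I ,
        (len , lo , eval-sound (trans e (sym (eval-replicate m w0)))) , p , p' , ap , ap' ,
        At⇒Label c (pow m σ q) p {x} lp , At⇒Label c (pow m σ q) p' {y} lp'

  twist : ∀ {w0} {σ : Fin n → Fin n} → IsLongest w0 → (∀ t → (w0 ++ t ∷ w0) ≈ [ σ t ]) → ∀ t → gen (σ t) ≡ eval
      w0 ▷ gen t
  twist {w0} lg tw t = trans (sym (eval-cong (tw t))) (trans (eval-split w0 t w0)
      (cong (λ g → eval w0 ∙ (gen t ∙ g))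
    (sym (allDescents-⁻¹ (longest⇒allDescents lg)))))

  initial⇒N : ∀ {s c} → Initial s c → N (eval c) (gen s) ≡ true
  initial⇒N {s} {c} (rest , e , red) = trans (cong (λ g → N g (gen s)) (sym (eval-cong e)))
      (N-true (eval (s ∷ rest)) (Refl-gen s)
    (ℕ.≤-trans (ℓ-≤ rest (trans (grp x₀ (y₀ ⊙ (y₀ ⊙ x₀)) (eval rest ∷ []) (geni s ∷ []) refl)
        (cong (gen s ∙_) (sym (eval-∷ s rest)))))
      (ℕ.≤-trans (ℕ.n≤1+n _) (ℕ.≤-reflexive (sym (ℓ-reduced (IsReduced⇒Reduced red)))))))

  Unique-reduced : ∀ {w} → Unique w → Reduced w
  Unique-reduced {w} uq w' e = subst (length w ≤_) (length-map gen w')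
    (proj₁ (minimal-factorisation w uq (map gen w') (All-Refl-gen w') (trans (prod-gen w') e)))

  N⇒initial : ∀ {s c} → CoxWord c → N (eval c) (gen s) ≡ true → Initial s c
  N⇒initial {s} {c} pc e with first (c , pc , refl) s e
  ... | c₁ , p₁ , e₁ = c₁ , eval-sound e₁ , Reduced⇒IsReduced (Unique-reduced (unique p₁))

  -- Properties (i) and (ii)

  satII : SatII Compat
  satII c pc s ini c' pc' ec x y vx vy x' y' tx ty =
    mk⇔ (λ cp → onwards (Compat⇒ {c} {x} {y} cp)) (λ cp → backwards (Compat⇒ {c'} {x'} {y'} cp))
    where
    es : N (eval c) (gen s) ≡ true
    es = initial⇒N ini
    ec' : eval c' ≡ gen s ▷ eval c
    ec' = trans (eval-cong ec) (eval-conj s c)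
    ex : root x' ≡ τ s (root x)
    ex = Tau⇒≡ s {x} {x'} tx
    ey : root y' ≡ τ s (root y)
    ey = Tau⇒≡ s {y} {y'} ty
    lx = valid-color (Valid⇒ vx)
    ly = valid-color (Valid⇒ vy)
    rotated : ∀ {w0} (lg : IsLongest w0) {σ : Fin n → Fin n} (tw : ∀ t → (w0 ++ t ∷ w0) ≈ [ σ t ]) →
              Twist.Rotation (longest⇒allDescents lg) σ (twist lg tw) c c' s w0
    rotated {w0} lg {σ} tw = Twist.rotation (longest⇒allDescents lg) σ (twist lg tw) 1≤m {c} {c'} {s} {w0} pc
        pc' es ec' refl
    onwards : (root x ≢ root y) × Situation c (root x) (root y) → Compat c' x' y'
    onwards (ne , situation {w0} lg {σ} tw {q} wq f) = ⇒Compat {c'} {x'} {y'}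
        (λ e → ne (τ-injective s lx ly (trans (sym ex) (trans e ey))))
        (situation {w0 = w0} lg {σ} tw {q'} sorted' (subst₂ (FaceOf c' q' (m ℕ.* length w0)) (sym ex) (sym ey)
          (onward (subst (λ q → FaceOf c q (m ℕ.* length w0) (root x) (root y)) (W0c-unique {c} ≈-refl wq
              sorted) f))))
      where
      open Twist (longest⇒allDescents lg) σ (twist lg tw)
      open Rotation (rotated lg tw) renaming (q to q₀)
    backwards : (root x' ≢ root y') × Situation c' (root x') (root y') → Compat c x y
    backwards (ne , situation {w0} lg {σ} tw {q} wq f) = ⇒Compat {c} {x} {y}
        (λ e → ne (trans ex (trans (cong (τ s) e) (sym ey))))
        (situation {w0 = w0} lg {σ} tw {q₀} sorted (backward lx ly (subst₂ (FaceOf c' q' (m ℕ.* length w0)) ex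
            ey
          (subst (λ q → FaceOf c' q (m ℕ.* length w0) (root x') (root y')) (W0c-unique {c'} ≈-refl wq sorted')
              f))))
      where
      open Twist (longest⇒allDescents lg) σ (twist lg tw)
      open Rotation (rotated lg tw) renaming (q to q₀)

  InPara⇒ : ∀ {s x} → InParaCol s x → InW (_≢ s) (proj₁ (root x))
  InPara⇒ (_ , w , e , ps) = w , eval-cong e , ps

  ⇒InPara : ∀ {s x} → Valid x → InW (_≢ s) (proj₁ (root x)) → InParaCol s x
  ⇒InPara v (w , e , ps) = v , w , eval-sound e , ps

  satI-first : ∀ s c₁ → CoxWord (s ∷ c₁) → ∀ t → t ≈ [ s ] → ∀ x → Valid x → Compat (s ∷ c₁) (t , m) x ⇔
      InParaCol s x
  satI-first s c₁ pc t et x vx =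
    mk⇔ (λ cp → necessary (Compat⇒ {s ∷ c₁} {t , m} {x} cp))
        (λ ip → sufficient ip (longest-Alt (s ∷ c₁ , pc , refl)))
    where
    es : eval t ≡ gen s
    es = eval-cong et
    necessary : (root (t , m) ≢ root x) × Situation (s ∷ c₁) (root (t , m)) (root x) → InParaCol s x
    necessary (ne , situation {w0} lg {σ} tw {q} (ps , (lk , pt , rq , eq) , least) f) = ⇒InPara {s} {x} vx
        (face-parabolic pc (longest⇒allDescents lg) σ (twist lg tw) {q} (block (IsReduced⇒Reduced rq)
            (eval-cong eq)) {root x}
          (λ e → ne (trans (cong (_, m) es) e))
          (subst₂ (λ K X → FaceOf (s ∷ c₁) q K X (root x)) (cong (m ℕ.*_) same) (cong (_, m) es) f))
      where
      open Twist (longest⇒allDescents lg) σ (twist lg tw)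
      same : length w0 ≡ length q
      same = trans (sym (ℓ-reduced (IsReduced⇒Reduced (proj₁ lg))))
          (trans (cong ℓ (sym (eval-cong eq))) (ℓ-reduced (IsReduced⇒Reduced rq)))
    sufficient : InParaCol s x → (Σ Word λ A → Alt (eval (s ∷ c₁)) A × Reduced A × AllDescents (eval A)) →
        Compat (s ∷ c₁) (t , m) x
    sufficient ip (A , as , red , d) = sorted (W0c-exists pc as red {A} refl)
      where
      σ : Fin n → Fin n
      σ r = proj₁ (opposite d r)
      eσ : ∀ r → gen (σ r) ≡ eval A ▷ gen r
      eσ r = proj₂ (opposite d r)
      open Twist d σ eσ
      tw : ∀ r → (A ++ r ∷ A) ≈ [ σ r ]
      tw r = eval-sound (trans (eval-split A r A)
          (trans (cong (λ g → eval A ∙ (gen r ∙ g)) (sym (allDescents-⁻¹ d))) (sym (eσ r))))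
      Jx : InW (_≢ s) (proj₁ (root x))
      Jx = InPara⇒ {s} {x} ip
      distinct : root (t , m) ≢ root x
      distinct e = InW-gen⁻ {_≢ s} (subst (InW (_≢ s)) (trans (sym (cong proj₁ e)) es) Jx) refl
      face : ValidRoot (root x) → FaceOf (s ∷ c₁) A (m ℕ.* length A) (gen s , m) (root x)
      face (r , inj₁ lt) = parabolic-face pc d σ eσ (block red refl) as r Jx lt
      face (_ , inj₂ (e , r , er)) = subst (FaceOf (s ∷ c₁) A (m ℕ.* length A) (gen s , m))
          (cong₂ _,_ (sym er) (sym e))
        (parabolic-face-top pc d σ eσ (block red refl) (InW-gen⁻ {_≢ s} (subst (InW (_≢ s)) er Jx)))
      sorted : (Σ Word λ q → W0c (s ∷ c₁) A q × (q ∼ A)) → Compat (s ∷ c₁) (t , m) x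
      sorted (q , wq , q∼) = ⇒Compat {s ∷ c₁} {t , m} {x} distinct
          (situation {w0 = A} (allDescents⇒longest red d) {σ} tw {q} wq
        (subst (λ X → FaceOf (s ∷ c₁) q (m ℕ.* length A) X (root x)) (cong (_, m) (sym es))
          (face-∼ {s ∷ c₁} {s ∷ c₁} {A} {q} ∼-refl (∼-sym q∼) (face (Valid⇒ vx)))))

  τ-parabolic : ∀ {s r} → r ≢ s → ∀ x → InW (_≢ s) (proj₁ x) ⇔ InW (_≢ s) (proj₁ (τ r x))
  τ-parabolic {s} {r} r≢s (t , k) with t ≟ gen r
  ... | yes refl = mk⇔ (λ p → p) (λ p → p)
  ... | no _ with k ℕ.≟ m
  ...   | yes _ = mk⇔ (λ p → p) (λ p → p)
  ...   | no _ = mk⇔ (InW-▷ (InW-gen r≢s)) (InW-▷⁻ (InW-gen r≢s))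

  -- Letters in front of `s` are rotated to the end by (ii). For r ≠ s, τ_r fixes α_s⁽ᵐ⁾, and it
  -- preserves the roots of W_⟨s⟩ since `r` lies in that subgroup.
  satI-split : ∀ s pre post → CoxWord (pre ++ s ∷ post) → ∀ t → t ≈ [ s ] → ∀ x → Valid x → Compat
      (pre ++ s ∷ post) (t , m) x ⇔ InParaCol s x
  satI-split s [] post pc t et x vx = satI-first s post pc t et x vx
  satI-split s (r ∷ pre) post pc t et x vx = mk⇔
      (λ cp → ⇒InPara vx (Equivalence.from (τ-parabolic r≢s (root x)) (subst (λ X → InW (_≢ s) (proj₁ X)) ex
          (InPara⇒ {s} {x'} (Equivalence.to ih (subst (λ c → Compat c (t , m) x') eqc
          (Equivalence.to rotated cp)))))))
      (λ ip → Equivalence.from rotated (subst (λ c → Compat c (t , m) x') (sym eqc) (Equivalence.from ih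
        (⇒InPara vx' (subst (λ X → InW (_≢ s) (proj₁ X)) (sym ex) (Equivalence.to (τ-parabolic r≢s (root x))
            (InPara⇒ {s} {x} ip)))))))
    where
    c₁ = pre ++ s ∷ post
    r≢s : r ≢ s
    r≢s refl = ∉-rest pc (∈-middle pre)
    x' = root⁻¹ (τ r (root x))
    ex : root x' ≡ τ r (root x)
    ex = root-root⁻¹ _
    vx' : Valid x'
    vx' = ⇒Valid (subst ValidRoot (sym ex) (τ-valid r (Valid⇒ vx)))
    eqc : (pre ++ s ∷ post) ++ [ r ] ≡ pre ++ s ∷ post ++ [ r ]
    eqc = ++-assoc pre (s ∷ post) [ r ]
    vt : Valid (t , m)
    vt = ⇒Valid (subst Refl (sym (eval-cong et)) (Refl-gen s) , inj₂ (refl , s , eval-cong et))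
    rotated : Compat (r ∷ c₁) (t , m) x ⇔ Compat (c₁ ++ [ r ]) (t , m) x'
    rotated = satII (r ∷ c₁) pc r (N⇒initial pc (first-N pc)) (c₁ ++ [ r ]) (rotate-↭ pc) (eval-sound
        (trans (eval-rotate r c₁) (sym (eval-conj r (r ∷ c₁)))))
      (t , m) x vt vx (t , m) x' (≡⇒Tau r (t , m) {t , m}
          (sym (τ-top r (eval t) (λ e → r≢s (gen-injective (trans (sym e) (eval-cong et)))))))
          (≡⇒Tau r x {x'} ex)
    ih : Compat (pre ++ s ∷ post ++ [ r ]) (t , m) x' ⇔ InParaCol s x'
    ih = satI-split s pre (post ++ [ r ]) (↭-trans (↭-reflexive (sym eqc)) (rotate-↭ pc)) t et x' vx'

  satI : SatI Compat
  satI c pc s t et x vx with ∈-∃++ (∈-resp-↭ (↭-sym pc) (∈-allFin s))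
  ... | pre , post , refl = satI-split s pre post pc t et x vx

  -- Uniqueness

  module _ (R R' : Word → ColRoot → ColRoot → Set) (iR : SatI R) (iiR : SatII R) (iR' : SatI R')
      (iiR' : SatII R') where

    -- `R` is a relation on words that is not assumed to respect `_≈_`, so the statement ranges over
    -- all words representing the coloured root `X`.
    Transfer : Word → Root → Set
    Transfer c X = ∀ x y → root x ≡ X → Valid x → Valid y → R c x y → R' c x y

    transfer-top : ∀ {c} → CoxWord c → ∀ s → Transfer c (gen s , m)
    transfer-top {c} pc s (t , k) y ex vx vy rxy with cong proj₂ ex
    ... | refl = Equivalence.from (iR' c pc s t (eval-sound (cong proj₁ ex)) y vy)
        (Equivalence.to (iR c pc s t (eval-sound (cong proj₁ ex)) y vy) rxy)

    transfer-step : ∀ {c} → CoxWord c → ∀ a X → N (eval c) (gen a) ≡ true →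
      (∀ c' → CoxWord c' → eval c' ≡ gen a ▷ eval c → Transfer c' (τ a X)) → Transfer c X
    transfer-step {c} pc a X ea next x y ex vx vy rxy with IsCox-rotate a (c , pc , refl) ea
    ... | c' , pc' , ec' = Equivalence.from (rot R' iiR') (next c' pc' ec' x' y'
        (trans ex' (cong (τ a) ex)) vx' vy' (Equivalence.to (rot R iiR) rxy))
      where
      x' = root⁻¹ (τ a (root x))
      y' = root⁻¹ (τ a (root y))
      ex' : root x' ≡ τ a (root x)
      ex' = root-root⁻¹ _
      ey' : root y' ≡ τ a (root y)
      ey' = root-root⁻¹ _
      vx' : Valid x'
      vx' = ⇒Valid (subst ValidRoot (sym ex') (τ-valid a (Valid⇒ vx)))
      vy' : Valid y'
      vy' = ⇒Valid (subst ValidRoot (sym ey') (τ-valid a (Valid⇒ vy)))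
      rot : ∀ R → SatII R → R c x y ⇔ R c' x' y'
      rot R ii = ii c pc a (N⇒initial pc ea) c' pc' (eval-sound (trans ec' (sym (eval-conj a c)))) x y vx vy x'
          y' (≡⇒Tau a x {x'} ex') (≡⇒Tau a y {y'} ey')

    -- Every reflection is an inversion of w∘, so an alternating word for w∘ is bound to meet `t`.
    -- The recursion is on the colour, which drops each time this happens, until colour 0 turns into
    -- `m`.
    transfer-low : ∀ k {c t} → CoxWord c → Refl t → k < m → Transfer c (t , k)

    -- Rotating along an alternating word for w∘, the reflection t eventually
    -- becomes the initial letter, and the colour drops.
    transfer-along : ∀ k {c t} u a v → CoxWord c → Alt (eval c) (u ++ a ∷ v) → k < m → t ≡ eval u ▷ gen
        a → Transfer c (t , k)
    transfer-hit : ∀ k {c} a → CoxWord c → N (eval c) (gen a) ≡ true → k < m → Transfer c (gen a , k)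

    transfer-hit zero {c} a pc ea k<m = transfer-step pc a (gen a , 0) ea λ c' pc' _ → subst (Transfer c')
        (sym (τ-zero a)) (transfer-top pc' a)
    transfer-hit (suc k) {c} a pc ea k<m = transfer-step pc a (gen a , suc k) ea λ c' pc' _ → subst
        (Transfer c') (sym (τ-suc a k))
      (transfer-low k pc' (Refl-gen a) (ℕ.<-trans (ℕ.n<1+n k) k<m))

    transfer-along k {c} {t} [] a v pc (ea ∷ _) k<m e = subst (λ g → Transfer c (g , k)) (sym
        (trans e (grp (ι ▸ y₀) y₀ [] (geni a ∷ []) refl))) (transfer-hit k a pc ea k<m)
    transfer-along k {c} {t} (b ∷ u) a v pc (eb ∷ as) k<m e with t ≟ gen b
    ... | yes refl = transfer-hit k b pc eb k<m
    ... | no ne = transfer-step pc b (t , k) eb λ c' pc' ec' → subst (Transfer c')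
        (sym (τ-low b t k ne (ℕ.<⇒≢ k<m)))
          (transfer-along k u a v pc' (subst (λ g → Alt g (u ++ a ∷ v)) (sym ec') as) k<m
            (trans (cong (gen b ▷_) (trans e (trans
                (cong (_▷ gen a) (eval-∷ b u)) (▷-∙ (gen b) (eval u) (gen a))))) (gen-▷² b _)))

    transfer-low k {c} {t} pc rt k<m with longest-Alt (c , pc , refl)
    ... | A , as , red , d with exchange A t (trans (sym (N-eval A t)) (trans (N≡ν⁻¹ (eval A) t)
        (trans (cong (λ g → ν g t) (allDescents-⁻¹ d)) (allDescents-inverts d rt))))
    ...   | u , a , v , refl , e = transfer-along k u a v pc as k<m e

    transfer : ∀ c → CoxWord c → ∀ x y → Valid x → Valid y → R c x y → R' c x y
    transfer c pc x y vx vy rxy with Valid⇒ vx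
    ... | rt , inj₁ lt = transfer-low (proj₂ x) pc rt lt x y refl vx vy rxy
    ... | rt , inj₂ (e , s , es) = transfer-top pc s x y (cong₂ _,_ es e) vx vy rxy

  compatibility : SatI Compat × SatII Compat ×
    ((R : Word → ColRoot → ColRoot → Set) → SatI R → SatII R → ∀ c → CoxWord c → ∀ x y → Valid x → Valid y →
      (R c x y ⇔ Compat c x y))
  compatibility = satI , satII , λ R iR iiR c pc x y vx vy →
    mk⇔ (transfer R Compat iR iiR satI satII c pc x y vx vy)
        (transfer Compat R satI satII iR iiR c pc x y vx vy)

mainTheorem11 : (n : ℕ) (M : Fin n → Fin n → ℕ) → IsCoxeterMatrix n M →
    (m : ℕ) → 1 ≤ m → Cox.IsFinite n M m →
    Cox.SatI n M m (Cox.Compat n M m) × Cox.SatII n M m (Cox.Compat n M m) ×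
    ((R : Cox.Word n M m → Cox.ColRoot n M m → Cox.ColRoot n M m → Set) →
    Cox.SatI n M m R → Cox.SatII n M m R →
    ∀ c → Cox.CoxWord n M m c → ∀ x y →
    Cox.Valid n M m x → Cox.Valid n M m y →
    (R c x y ⇔ Cox.Compat n M m c x y))
mainTheorem11 n M cox m 1≤m fin = System.compatibility n M m cox fin 1≤m (model n M m fin)
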